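{- For all terms $M,N$ of the same type $\sigma$: $M\sqsubseteq N$ if and only if $[\![M]\!]\varepsilon\subseteq[\![N]\!]\varepsilon$ for every environment $\varepsilon$.
   Context: Types: type expressions $\sigma ::= t \mid \sigma+\sigma \mid \sigma\times\sigma\mid \sigma\to\sigma\mid \mu t.\sigma\mid \mathrm{void}$ (types = closed ones); types having the same infinite unfolding (type tree, from repeated unfoldings $\mu t.\tau\rhd\tau[\mu t.\tau/t]$) are equivalent and interchangeable in typing. $\mathrm{bool}=\mathrm{void}+\mathrm{void}$. Terms: typed $\lambda$-terms over typed variables $x^\sigma$ and the constants, for all types $\sigma,\tau,\rho$: $0_{\sigma,\tau}:\sigma\to(\sigma+\tau)$, $1_{\sigma,\tau}:\tau\to(\sigma+\tau)$, $\mathrm{case}_{\sigma,\tau,\rho}:(\sigma+\tau)\to(\sigma\to\rho)\to(\tau\to\rho)\to\rho$, $\mathrm{pcase}_{\sigma,\tau,\rho}:(\sigma+\tau)\to\rho\to\rho\to\rho$, $\mathrm{pair}_{\sigma,\tau}:\sigma\to\tau\to(\sigma\times\tau)$, $\mathrm{fst}:(\sigma\times\tau)\to\sigma$, $\mathrm{snd}:(\sigma\times\tau)\to\tau$, $\Omega_\sigma:\sigma$. Reduction $\to$: $\beta$-reduction and $\mathrm{case}(0x)yz\to yx$; $\mathrm{case}(1x)yz\to zx$; $\mathrm{fst}(\mathrm{pair}\,x\,y)\to x$; $\mathrm{snd}(\mathrm{pair}\,x\,y)\to y$; $\mathrm{pcase}(0x)yz\to y$; $\mathrm{pcase}(1x)yz\to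 z$; $\mathrm{pcase}\,x(0y)(0z)\to 0(\mathrm{pcase}\,xyz)$; $\mathrm{pcase}\,x(1y)(1z)\to 1(\mathrm{pcase}\,xyz)$; $\mathrm{pcase}\,x(\mathrm{pair}\,y_1y_2)(\mathrm{pair}\,z_1z_2)\to\mathrm{pair}(\mathrm{pcase}\,x\,y_1z_1)(\mathrm{pcase}\,x\,y_2z_2)$; $(\mathrm{pcase}\,xyz)w\to\mathrm{pcase}\,x(yw)(zw)$ (functional result type), applied in any context; $\to^*$ reflexive transitive closure. Semantics: each type $\sigma$ is interpreted by a prime system (set of primes with consistency and entailment) with domain $D_\sigma$ of elements (downward closed, pairwise consistent sets of primes, ordered by $\subseteq$, $\bot=\emptyset$): $D_{\mathrm{void}}=\{\bot\}$; $D_{\tau+\rho}=\{\bot\}\cup\{0d\}\cup\{1d\}$ with $0d=\{0\}\cup(\{0\}\times d)$, $1d=\{1\}\cup(\{1\}\times d)$ (so $D_{\mathrm{bool}}=\{\bot,0,1\}$); $D_{\tau\times\rho}$ consists of $\mathrm{pair}\,d\,e=(\{0\}\times d)\cup(\{1\}\times e)$; $D_{\tau\to\rho}$ has primes $(X,b)$ ($X$ finite pairwise consistent, pairwise incomparable set of primes of $\tau$, $b$ a prime of $\rho$) and its elements correspond isomorphically to continuous functions via $r\,d=\{b\mid\exists X\subseteq d,(X,b)\in r\}$, inverse $\mathrm{Pr}(f)=\{(X,b)\mid b\in f(\downarrow X)\}$; recursive types are interpreted as the union of the chain of prime systems of the finite prefixes of the type tree. Environments $\varepsilon$ map $x^\sigma$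 into $D_\sigma$. $[\![\cdot]\!]\varepsilon$: $\Omega\mapsto\bot$; $0,1$ injections; $\mathrm{case}\,\bot fg=\bot$, $\mathrm{case}\,(0e)fg=f\,e$, $\mathrm{case}\,(1e)fg=g\,e$; $\mathrm{pcase}\,\bot bc=b\cap c$, $\mathrm{pcase}\,(0a)bc=b$, $\mathrm{pcase}\,(1a)bc=c$; pairing and projections; $x\mapsto\varepsilon(x)$; $\lambda x.M\mapsto\mathrm{Pr}(d\mapsto[\![M]\!](\varepsilon[x\mapsto d]))$; application as function application. For closed $M$ write $[\![M]\!]$. Programs are closed terms of type $\mathrm{bool}$. For a program $M$, $\mathcal O(M)=0$ if $M\to^*0M'$, $=1$ if $M\to^*1M'$ (some $M'$), and $=\bot$ otherwise. A context $C[\,]$ is a term with a hole; $C[M]$ is the result of placing $M$ in the hole (free variables of $M$ may become bound). The operational preorder: $M\sqsubseteq N$ iff for all contexts $C[\,]$ such that $C[M]$ and $C[N]$ are programs, $\mathcal O(C[M])\subseteq\mathcal O(C[N])$. -}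

module Defs where

open import Data.Nat using (ℕ; zero; suc; _⊔_)
open import Data.Fin using (Fin; zero; suc)
open import Data.List using (List; []; _∷_)
open import Data.List.Relation.Unary.All using (All)
open import Data.List.Relation.Unary.AllPairs using (AllPairs)
open import Data.Product using (Σ; _×_; _,_; ∃)
open import Data.Sum using (_⊎_)
open import Data.Unit using (⊤)
open import Data.Empty using (⊥)
open import Relation.Nullary using (¬_)
open import Relation.Binary.PropositionalEquality using (_≡_)
open import Relation.Binary.Construct.Closure.ReflexiveTransitive using (Star)

infixr 7 _⇒_
infixr 8 _⊕_
infixr 9 _⊗_

data Ty (n : ℕ) : Set where
  tvar : Fin n → Ty n
  void : Ty n
  _⊕_  : Ty n → Ty n → Ty n
  _⊗_  : Ty n → Ty n → Ty n
  _⇒_  : Ty n → Ty n → Ty n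
  μ    : Ty (suc n) → Ty n

Type : Set
Type = Ty 0

bool : Type
bool = void ⊕ void

extʳ : ∀ {n m} → (Fin n → Fin m) → Fin (suc n) → Fin (suc m)
extʳ r zero    = zero
extʳ r (suc i) = suc (r i)

renTy : ∀ {n m} → (Fin n → Fin m) → Ty n → Ty m
renTy r (tvar i) = tvar (r i)
renTy r void     = void
renTy r (a ⊕ b)  = renTy r a ⊕ renTy r b
renTy r (a ⊗ b)  = renTy r a ⊗ renTy r b
renTy r (a ⇒ b)  = renTy r a ⇒ renTy r b
renTy r (μ a)    = μ (renTy (extʳ r) a)

extˢ : ∀ {n m} → (Fin n → Ty m) → Fin (suc n) → Ty (suc m)
extˢ s zero    = tvar zero
extˢ s (suc i) = renTy suc (s i)

subTy : ∀ {n m} → (Fin n → Ty m) → Ty n → Ty m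
subTy s (tvar i) = s i
subTy s void     = void
subTy s (a ⊕ b)  = subTy s a ⊕ subTy s b
subTy s (a ⊗ b)  = subTy s a ⊗ subTy s b
subTy s (a ⇒ b)  = subTy s a ⇒ subTy s b
subTy s (μ a)    = μ (subTy (extˢ s) a)

unfoldμ : Ty 1 → Type
unfoldμ τ = subTy (λ { zero → μ τ }) τ

-- head constructor of the type tree (obtained by repeated unfolding);
-- 'loopH' is the head of a non-contractive type (e.g. μt.t), whose
-- unfolding never produces a constructor.
data Head : Set where
  voidH loopH : Head
  sumH prodH arrH : Type → Type → Head

muDepth : ∀ {n} → Ty n → ℕ
muDepth (μ a) = suc (muDepth a)
muDepth _     = 0

hd : ℕ → Type → Head
hd k (tvar ())
hd k void          = voidH
hd k (a ⊕ b)       = sumH a b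
hd k (a ⊗ b)       = prodH a b
hd k (a ⇒ b)       = arrH a b
hd zero (μ a)      = loopH
hd (suc k) (μ a)   = hd k (unfoldμ a)

-- a closed type with k leading μ's is contractive iff k unfoldings
-- expose a constructor
head : Type → Head
head σ = hd (muDepth σ) σ

data Tree : Set where
  cut voidT loopT : Tree
  sumT prodT arrT : Tree → Tree → Tree

mutual
  trunc : ℕ → Type → Tree
  trunc zero    σ = cut
  trunc (suc n) σ = truncH n (head σ)

  truncH : ℕ → Head → Tree
  truncH n voidH       = voidT
  truncH n loopH       = loopT
  truncH n (sumH a b)  = sumT (trunc n a) (trunc n b)
  truncH n (prodH a b) = prodT (trunc n a) (trunc n b)
  truncH n (arrH a b)  = arrT (trunc n a) (trunc n b)

-- equivalence of types: same infinite unfolding (type tree)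
infix 4 _≈_
_≈_ : Type → Type → Set
σ ≈ τ = ∀ n → trunc n σ ≡ trunc n τ

infixl 6 _·_

data Tm : Set where
  `_∶_   : ℕ → Type → Tm
  ƛ      : Type → Tm → Tm
  _·_    : Tm → Tm → Tm
  c0 c1  : Type → Type → Tm
  ccase cpcase : Type → Type → Type → Tm
  cpair cfst csnd : Type → Type → Tm
  cΩ     : Type → Tm

Ctxt : Set
Ctxt = List Type

infix 4 _∋_∶_
data _∋_∶_ : Ctxt → ℕ → Type → Set where
  here  : ∀ {Γ σ} → (σ ∷ Γ) ∋ 0 ∶ σ
  there : ∀ {Γ σ τ i} → Γ ∋ i ∶ σ → (τ ∷ Γ) ∋ suc i ∶ σ

infix 3 _⊢_∶_
data _⊢_∶_ : Ctxt → Tm → Type → Set where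
  tvar   : ∀ {Γ i σ} → Γ ∋ i ∶ σ → Γ ⊢ (` i ∶ σ) ∶ σ
  tlam   : ∀ {Γ σ τ M} → (σ ∷ Γ) ⊢ M ∶ τ → Γ ⊢ ƛ σ M ∶ σ ⇒ τ
  tapp   : ∀ {Γ σ τ M N} → Γ ⊢ M ∶ σ ⇒ τ → Γ ⊢ N ∶ σ → Γ ⊢ M · N ∶ τ
  tc0    : ∀ {Γ σ τ} → Γ ⊢ c0 σ τ ∶ σ ⇒ (σ ⊕ τ)
  tc1    : ∀ {Γ σ τ} → Γ ⊢ c1 σ τ ∶ τ ⇒ (σ ⊕ τ)
  tcase  : ∀ {Γ σ τ ρ} → Γ ⊢ ccase σ τ ρ ∶ (σ ⊕ τ) ⇒ (σ ⇒ ρ) ⇒ (τ ⇒ ρ) ⇒ ρ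
  tpcase : ∀ {Γ σ τ ρ} → Γ ⊢ cpcase σ τ ρ ∶ (σ ⊕ τ) ⇒ ρ ⇒ ρ ⇒ ρ
  tpair  : ∀ {Γ σ τ} → Γ ⊢ cpair σ τ ∶ σ ⇒ τ ⇒ (σ ⊗ τ)
  tfst   : ∀ {Γ σ τ} → Γ ⊢ cfst σ τ ∶ (σ ⊗ τ) ⇒ σ
  tsnd   : ∀ {Γ σ τ} → Γ ⊢ csnd σ τ ∶ (σ ⊗ τ) ⇒ τ
  tΩ     : ∀ {Γ σ} → Γ ⊢ cΩ σ ∶ σ
  tconv  : ∀ {Γ σ τ M} → Γ ⊢ M ∶ σ → σ ≈ τ → Γ ⊢ M ∶ τ

liftᵣ : (ℕ → ℕ) → ℕ → ℕ
liftᵣ r zero    = zero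
liftᵣ r (suc i) = suc (r i)

ren : (ℕ → ℕ) → Tm → Tm
ren r (` i ∶ σ)        = ` r i ∶ σ
ren r (ƛ σ M)          = ƛ σ (ren (liftᵣ r) M)
ren r (M · N)          = ren r M · ren r N
ren r (c0 a b)         = c0 a b
ren r (c1 a b)         = c1 a b
ren r (ccase a b c)    = ccase a b c
ren r (cpcase a b c)   = cpcase a b c
ren r (cpair a b)      = cpair a b
ren r (cfst a b)       = cfst a b
ren r (csnd a b)       = csnd a b
ren r (cΩ a)           = cΩ a

Subst : Set
Subst = ℕ → Type → Tm

liftₛ : Subst → Subst
liftₛ s zero    σ = ` zero ∶ σ
liftₛ s (suc i) σ = ren suc (s i σ)

sub : Subst → Tm → Tm
sub s (` i ∶ σ)        = s i σ
sub s (ƛ σ M)          = ƛ σ (sub (liftₛ s) M)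
sub s (M · N)          = sub s M · sub s N
sub s (c0 a b)         = c0 a b
sub s (c1 a b)         = c1 a b
sub s (ccase a b c)    = ccase a b c
sub s (cpcase a b c)   = cpcase a b c
sub s (cpair a b)      = cpair a b
sub s (cfst a b)       = cfst a b
sub s (csnd a b)       = csnd a b
sub s (cΩ a)           = cΩ a

_[_] : Tm → Tm → Tm
M [ N ] = sub s M
  where
  s : Subst
  s zero    σ = N
  s (suc i) σ = ` i ∶ σ

infix 2 _⟶_
data _⟶_ : Tm → Tm → Set where
  β      : ∀ {σ M N} → ƛ σ M · N ⟶ M [ N ]
  case0  : ∀ {a b c a' b' x y z} → ccase a b c · (c0 a' b' · x) · y · z ⟶ y · x
  case1  : ∀ {a b c a' b' x y z} → ccase a b c · (c1 a' b' · x) · y · z ⟶ z · x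
  fstβ   : ∀ {a b a' b' x y} → cfst a b · (cpair a' b' · x · y) ⟶ x
  sndβ   : ∀ {a b a' b' x y} → csnd a b · (cpair a' b' · x · y) ⟶ y
  pcase0 : ∀ {a b c a' b' x y z} → cpcase a b c · (c0 a' b' · x) · y · z ⟶ y
  pcase1 : ∀ {a b c a' b' x y z} → cpcase a b c · (c1 a' b' · x) · y · z ⟶ z
  pcase00 : ∀ {a b c a' b' a'' b'' x y z} →
    cpcase a b c · x · (c0 a' b' · y) · (c0 a'' b'' · z)
      ⟶ c0 a' b' · (cpcase a b a' · x · y · z)
  pcase11 : ∀ {a b c a' b' a'' b'' x y z} →
    cpcase a b c · x · (c1 a' b' · y) · (c1 a'' b'' · z)
      ⟶ c1 a' b' · (cpcase a b b' · x · y · z)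
  pcasePair : ∀ {a b c a' b' a'' b'' x y₁ y₂ z₁ z₂} →
    cpcase a b c · x · (cpair a' b' · y₁ · y₂) · (cpair a'' b'' · z₁ · z₂)
      ⟶ cpair a' b' · (cpcase a b a' · x · y₁ · z₁) · (cpcase a b b' · x · y₂ · z₂)
  pcaseApp : ∀ {a b ρ ρ₁ ρ₂ x y z w} → head ρ ≡ arrH ρ₁ ρ₂ →
    (cpcase a b ρ · x · y · z) · w ⟶ cpcase a b ρ₂ · x · (y · w) · (z · w)
  appL   : ∀ {M M' N} → M ⟶ M' → M · N ⟶ M' · N
  appR   : ∀ {M N N'} → N ⟶ N' → M · N ⟶ M · N'
  lamξ   : ∀ {σ M M'} → M ⟶ M' → ƛ σ M ⟶ ƛ σ M'

infix 2 _⟶*_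
_⟶*_ : Tm → Tm → Set
_⟶*_ = Star _⟶_

_⇓0 : Tm → Set
M ⇓0 = Σ Type λ a → Σ Type λ b → Σ Tm λ M' → M ⟶* c0 a b · M'

_⇓1 : Tm → Set
M ⇓1 = Σ Type λ a → Σ Type λ b → Σ Tm λ M' → M ⟶* c1 a b · M'

Program : Tm → Set
Program M = [] ⊢ M ∶ bool

-- O(M) ⊆ O(N) in D_bool = {⊥, 0, 1}
_⊆O_ : Tm → Tm → Set
M ⊆O N = (M ⇓0 → N ⇓0) × (M ⇓1 → N ⇓1)

data Ctx : Set where
  ∙    : Ctx
  ƛC   : Type → Ctx → Ctx
  _·L_ : Ctx → Tm → Ctx
  _·R_ : Tm → Ctx → Ctx

-- plugging (free variables of M may become bound)
_⟨_⟩ : Ctx → Tm → Tm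
∙ ⟨ M ⟩        = M
ƛC σ C ⟨ M ⟩   = ƛ σ (C ⟨ M ⟩)
(C ·L N) ⟨ M ⟩ = (C ⟨ M ⟩) · N
(N ·R C) ⟨ M ⟩ = N · (C ⟨ M ⟩)

infix 4 _⊑_
_⊑_ : Tm → Tm → Set
M ⊑ N = ∀ (C : Ctx) → Program (C ⟨ M ⟩) → Program (C ⟨ N ⟩) → (C ⟨ M ⟩) ⊆O (C ⟨ N ⟩)

data Prm : Set where
  tag0 tag1 : Prm               -- the primes 0 and 1 of a sum
  in0 in1   : Prm → Prm         -- (0,p), (1,p) of a sum
  pr0 pr1   : Prm → Prm         -- (0,p), (1,p) of a product
  fun       : List Prm → Prm → Prm   -- (X, b) of a function type

mutual
  Leq : Type → Prm → Prm → Set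
  Leq σ p q = LeqH (head σ) p q

  LeqH : Head → Prm → Prm → Set
  LeqH (sumH a b) tag0 tag0         = ⊤
  LeqH (sumH a b) tag0 (in0 q)      = ⊤
  LeqH (sumH a b) (in0 p) (in0 q)   = Leq a p q
  LeqH (sumH a b) tag1 tag1         = ⊤
  LeqH (sumH a b) tag1 (in1 q)      = ⊤
  LeqH (sumH a b) (in1 p) (in1 q)   = Leq b p q
  LeqH (prodH a b) (pr0 p) (pr0 q)  = Leq a p q
  LeqH (prodH a b) (pr1 p) (pr1 q)  = Leq b p q
  -- (X,b) ≤ (Y,c)  iff  b ≤ c and ↓Y ⊆ ↓X
  LeqH (arrH a b) (fun X p) (fun Y q) = Leq b p q × AllAny a Y X
  LeqH _ _ _ = ⊥

  AllAny : Type → List Prm → List Prm → Set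
  AllAny a []      X = ⊤
  AllAny a (y ∷ Y) X = AnyLeq a y X × AllAny a Y X

  AnyLeq : Type → Prm → List Prm → Set
  AnyLeq a y []      = ⊥
  AnyLeq a y (x ∷ X) = Leq a y x ⊎ AnyLeq a y X

-- depth of a raw prime (used only as a termination measure for Con)
depth : Prm → ℕ
depthL : List Prm → ℕ
depth tag0 = 1
depth tag1 = 1
depth (in0 p) = suc (depth p)
depth (in1 p) = suc (depth p)
depth (pr0 p) = suc (depth p)
depth (pr1 p) = suc (depth p)
depth (fun X p) = suc (depthL X ⊔ depth p)
depthL [] = 0
depthL (x ∷ X) = depth x ⊔ depthL X

-- consistency of primes, computed with a sufficient amount of fuel
mutual
  Conₖ : ℕ → Type → Prm → Prm → Set
  Conₖ zero σ p q    = ⊤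
  Conₖ (suc k) σ p q = ConH k (head σ) p q

  ConH : ℕ → Head → Prm → Prm → Set
  ConH k (sumH a b) tag0 tag0       = ⊤
  ConH k (sumH a b) tag0 (in0 q)    = ⊤
  ConH k (sumH a b) (in0 p) tag0    = ⊤
  ConH k (sumH a b) (in0 p) (in0 q) = Conₖ k a p q
  ConH k (sumH a b) tag1 tag1       = ⊤
  ConH k (sumH a b) tag1 (in1 q)    = ⊤
  ConH k (sumH a b) (in1 p) tag1    = ⊤
  ConH k (sumH a b) (in1 p) (in1 q) = Conₖ k b p q
  ConH k (prodH a b) (pr0 p) (pr0 q) = Conₖ k a p q
  ConH k (prodH a b) (pr0 p) (pr1 q) = ⊤
  ConH k (prodH a b) (pr1 p) (pr0 q) = ⊤
  ConH k (prodH a b) (pr1 p) (pr1 q) = Conₖ k b p q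
  -- (X,b) and (Y,c) are consistent iff (X ∪ Y consistent ⇒ b, c consistent)
  ConH k (arrH a b) (fun X p) (fun Y q) =
    (ConLL k a X X × ConLL k a X Y × ConLL k a Y Y) → Conₖ k b p q
  ConH k _ _ _ = ⊥

  ConL : ℕ → Type → Prm → List Prm → Set
  ConL k a x []      = ⊤
  ConL k a x (y ∷ Y) = Conₖ k a x y × ConL k a x Y

  ConLL : ℕ → Type → List Prm → List Prm → Set
  ConLL k a []      Y = ⊤
  ConLL k a (x ∷ X) Y = ConL k a x Y × ConLL k a X Y

Con : Type → Prm → Prm → Set
Con σ p q = Conₖ (depth p ⊔ depth q) σ p q

Incomparable : Type → Prm → Prm → Set
Incomparable σ p q = ¬ Leq σ p q × ¬ Leq σ q p

mutual
  IsPrime : Type → Prm → Set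
  IsPrime σ p = IsPrimeH (head σ) p

  IsPrimeH : Head → Prm → Set
  IsPrimeH (sumH a b) tag0      = ⊤
  IsPrimeH (sumH a b) tag1      = ⊤
  IsPrimeH (sumH a b) (in0 p)   = IsPrime a p
  IsPrimeH (sumH a b) (in1 p)   = IsPrime b p
  IsPrimeH (prodH a b) (pr0 p)  = IsPrime a p
  IsPrimeH (prodH a b) (pr1 p)  = IsPrime b p
  IsPrimeH (arrH a b) (fun X p) = PrimeSet a X × IsPrime b p
  IsPrimeH _ _ = ⊥

  AllPrime : Type → List Prm → Set
  AllPrime a []      = ⊤
  AllPrime a (x ∷ X) = IsPrime a x × AllPrime a X

  PrimeSet : Type → List Prm → Set
  PrimeSet a X = AllPrime a X × AllPairs (Con a) X × AllPairs (Incomparable a) X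

Pred : Set₁
Pred = Prm → Set

IsElem : Type → Pred → Set
IsElem σ d =
  (∀ p → d p → IsPrime σ p) ×
  (∀ p q → IsPrime σ p → Leq σ p q → d q → d p) ×
  (∀ p q → d p → d q → Con σ p q)

infix 4 _⊆_
_⊆_ : Pred → Pred → Set
d ⊆ e = ∀ p → d p → e p

down : Type → List Prm → Pred
down σ X p = IsPrime σ p × AnyLeq σ p X

Pr : Type → (Pred → Pred) → Pred
Pr σ f (fun X b) = PrimeSet σ X × f (down σ X) b
Pr σ f _ = ⊥

apS : Pred → Pred → Pred
apS r d b = Σ (List Prm) λ X → All d X × r (fun X b)

inj0 : Pred → Pred
inj0 d tag0    = ⊤
inj0 d (in0 p) = d p
inj0 d _       = ⊥

inj1 : Pred → Pred
inj1 d tag1    = ⊤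
inj1 d (in1 p) = d p
inj1 d _       = ⊥

-- case ⊥ f g = ⊥, case (0e) f g = f e, case (1e) f g = g e
caseS : Pred → Pred → Pred → Pred
caseS e f g b = (e tag0 × apS f (λ p → e (in0 p)) b) ⊎ (e tag1 × apS g (λ p → e (in1 p)) b)

-- pcase ⊥ b c = b ∩ c, pcase (0a) b c = b, pcase (1a) b c = c
pcaseS : Pred → Pred → Pred → Pred
pcaseS e y z b = (e tag0 × y b) ⊎ (e tag1 × z b) ⊎ (y b × z b)

pairS : Pred → Pred → Pred
pairS d e (pr0 p) = d p
pairS d e (pr1 p) = e p
pairS d e _       = ⊥

fstS : Pred → Pred
fstS d p = d (pr0 p)

sndS : Pred → Pred
sndS d p = d (pr1 p)

REnv : Set₁
REnv = ℕ → Pred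

_∷ₑ_ : Pred → REnv → REnv
(d ∷ₑ ρ) zero    = d
(d ∷ₑ ρ) (suc i) = ρ i

⟦_⟧ : Tm → REnv → Pred
⟦ ` i ∶ σ ⟧ ρ        = ρ i
⟦ ƛ σ M ⟧ ρ          = Pr σ (λ d → ⟦ M ⟧ (d ∷ₑ ρ))
⟦ M · N ⟧ ρ          = apS (⟦ M ⟧ ρ) (⟦ N ⟧ ρ)
⟦ c0 a b ⟧ ρ         = Pr a inj0
⟦ c1 a b ⟧ ρ         = Pr b inj1
⟦ ccase a b c ⟧ ρ    = Pr (a ⊕ b) λ e → Pr (a ⇒ c) λ f → Pr (b ⇒ c) λ g → caseS e f g
⟦ cpcase a b c ⟧ ρ   = Pr (a ⊕ b) λ e → Pr c λ y → Pr c λ z → pcaseS e y z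
⟦ cpair a b ⟧ ρ      = Pr a λ d → Pr b λ e → pairS d e
⟦ cfst a b ⟧ ρ       = Pr (a ⊗ b) fstS
⟦ csnd a b ⟧ ρ       = Pr (a ⊗ b) sndS
⟦ cΩ a ⟧ ρ           = λ _ → ⊥

data Env : Ctxt → Set₁ where
  []  : Env []
  _∷_ : ∀ {σ Γ} → (Σ Pred (IsElem σ)) → Env Γ → Env (σ ∷ Γ)

envR : ∀ {Γ} → Env Γ → REnv
envR []             i       = λ _ → ⊥
envR ((d , _) ∷ ε)  zero    = d
envR ((d , _) ∷ ε)  (suc i) = envR ε i

{-# OPTIONS --safe #-}
module Submission where

-- Denotation to observation. Reduction never adds primes to the denotation of a term, and
-- conversely a prime of the denotation of a closed term is realised by its reducts. Hence a
-- program reduces to 0 or 1 exactly when its denotation contains that tag, and denotational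
-- inclusion, which is preserved by contexts, implies the operational preorder.
--
-- Observation to denotation. If p ∈ ⟦M⟧ε then by continuity p ∈ ⟦M⟧ε′ for an environment ε′ ⊆ ε
-- of finite elements. Finite elements are definable and every prime p has a definable test, so
-- there is a closing context C with C[L] ⇓ 0 iff p ∈ ⟦L⟧ε′, and M ⊑ N gives p ∈ ⟦N⟧ε′ ⊆ ⟦N⟧ε.
--
-- Definability goes by induction on the depth of primes. A finite element of a function type is
-- turned into a list of primes b guarded by tests on the argument; guards of inconsistent primes
-- exclude each other, and the parallel conditional over a term separating two such guards
-- combines the partial definitions.

open import Defs
open import Data.Bool using (Bool; true; false)
open import Data.Empty using (⊥; ⊥-elim)
import Data.Fin as Fin
open import Data.List using (List; []; _∷_; _++_; map; concatMap; filter)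
open import Data.List.Membership.Propositional using (_∈_; find; lose)
open import Data.List.Membership.Propositional.Properties using (∈-++⁺ˡ; ∈-++⁺ʳ; ∈-++⁻; ∈-filter⁺; ∈-filter⁻; ∈-map⁺; ∈-map⁻; ∈-concatMap⁺; ∈-concatMap⁻)
open import Data.List.Relation.Unary.All as All using (All; []; _∷_)
open import Data.List.Relation.Unary.All.Properties using (++⁺)
open import Data.List.Relation.Unary.AllPairs as AllPairs using (AllPairs; []; _∷_)
import Data.List.Relation.Unary.AllPairs.Properties as AllPairsₚ
open import Data.List.Relation.Unary.Any as Any using (Any; here; there)
open import Data.Maybe using (Maybe; just; nothing)
open import Data.Nat using (ℕ; zero; suc; _⊔_; _≤_; z≤n; s≤s; s≤s⁻¹)
open import Data.Nat.Properties using (≤-refl; ≤-trans; m≤m⊔n; m≤n⊔m; ⊔-lub)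
open import Data.Product using (Σ; _×_; _,_; ∃; proj₁; proj₂)
open import Data.Sum using (_⊎_; inj₁; inj₂)
open import Data.Unit using (⊤; tt)
open import Function using (_∘_; id; case_of_)
open import Function.Bundles using (_⇔_; mk⇔)
open import Relation.Binary.Construct.Closure.ReflexiveTransitive using (_◅_; _◅◅_) renaming (ε to ε*)
open import Relation.Binary.PropositionalEquality using (_≡_; refl; sym; trans; cong; cong₂; subst)
open import Relation.Nullary using (¬_; Dec; yes; no)
open import Relation.Nullary.Decidable using (_×-dec_; _⊎-dec_; _→-dec_; ¬?; decidable-stable)

-- Types may be recursive, so neither realisability nor definability can go by recursion on types.
-- What decreases instead is a bound on the depth of primes, which are finite objects even over an
-- infinite type tree. Consistency and realisability carry this bound as fuel; since arguments of
-- functions occur contravariantly, each comes with a lemma that all sufficient amounts agree.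
--
-- Definability is proved together with two companions: membership of a prime in the value of a term
-- is testable, and inconsistent primes are separable. Defining a function takes tests and
-- separators for its argument; testing or separating function values takes a definable argument to
-- apply them to. The value of `pcase` at an undefined scrutinee is what both branches share. This
-- gives parallel or, and lets a choice between two candidates stay open wherever they agree.
--
-- Elements are arbitrary predicates; what gets decided are only relations between finite primes,
-- namely entailment and consistency. That a closed term cannot show both tags is read off its
-- denotation.

private variable
  σ τ ρ a b c a′ b′ : Type
  H H′ : Head
  p q r x y : Prm
  X Y Z : List Prm
  k j : ℕ
  Γ Δ : Ctxt
  M N M′ : Tm
  d e d′ e′ f g : Pred
  η θ : REnv

-- Type equivalence

≈-refl : σ ≈ σ
≈-refl n = refl

≈-sym : σ ≈ τ → τ ≈ σ
≈-sym e n = sym (e n)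

≈-trans : σ ≈ τ → τ ≈ ρ → σ ≈ ρ
≈-trans e f n = trans (e n) (f n)

⇒-cong : a ≈ a′ → b ≈ b′ → a ⇒ b ≈ a′ ⇒ b′
⇒-cong e f zero    = refl
⇒-cong e f (suc n) = cong₂ arrT (e n) (f n)

-- One layer of `≈`, matched constructor by constructor. Transport along `≈` can then recurse on
-- primes, as types need not shrink when unfolded.
data _~_ : Head → Head → Set where
  void~ : voidH ~ voidH
  loop~ : loopH ~ loopH
  sum~  : a ≈ a′ → b ≈ b′ → sumH a b ~ sumH a′ b′
  prod~ : a ≈ a′ → b ≈ b′ → prodH a b ~ prodH a′ b′
  arr~  : a ≈ a′ → b ≈ b′ → arrH a b ~ arrH a′ b′

leftT rightT : Tree → Tree
leftT (sumT s t)  = s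
leftT (prodT s t) = s
leftT (arrT s t)  = s
leftT t           = t
rightT (sumT s t)  = t
rightT (prodT s t) = t
rightT (arrT s t)  = t
rightT t           = t

truncH⇒~ : ∀ H H′ → (∀ n → truncH n H ≡ truncH n H′) → H ~ H′
truncH⇒~ voidH voidH e = void~
truncH⇒~ loopH loopH e = loop~
truncH⇒~ (sumH _ _) (sumH _ _) e = sum~ (cong leftT ∘ e) (cong rightT ∘ e)
truncH⇒~ (prodH _ _) (prodH _ _) e = prod~ (cong leftT ∘ e) (cong rightT ∘ e)
truncH⇒~ (arrH _ _) (arrH _ _) e = arr~ (cong leftT ∘ e) (cong rightT ∘ e)
truncH⇒~ voidH loopH e with () ← e 0
truncH⇒~ voidH (sumH _ _) e with () ← e 0
truncH⇒~ voidH (prodH _ _) e with () ← e 0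
truncH⇒~ voidH (arrH _ _) e with () ← e 0
truncH⇒~ loopH voidH e with () ← e 0
truncH⇒~ loopH (sumH _ _) e with () ← e 0
truncH⇒~ loopH (prodH _ _) e with () ← e 0
truncH⇒~ loopH (arrH _ _) e with () ← e 0
truncH⇒~ (sumH _ _) voidH e with () ← e 0
truncH⇒~ (sumH _ _) loopH e with () ← e 0
truncH⇒~ (sumH _ _) (prodH _ _) e with () ← e 0
truncH⇒~ (sumH _ _) (arrH _ _) e with () ← e 0
truncH⇒~ (prodH _ _) voidH e with () ← e 0
truncH⇒~ (prodH _ _) loopH e with () ← e 0
truncH⇒~ (prodH _ _) (sumH _ _) e with () ← e 0
truncH⇒~ (prodH _ _) (arrH _ _) e with () ← e 0
truncH⇒~ (arrH _ _) voidH e with () ← e 0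
truncH⇒~ (arrH _ _) loopH e with () ← e 0
truncH⇒~ (arrH _ _) (sumH _ _) e with () ← e 0
truncH⇒~ (arrH _ _) (prodH _ _) e with () ← e 0

≈⇒~ : σ ≈ τ → head σ ~ head τ
≈⇒~ e = truncH⇒~ _ _ (e ∘ suc)

⇒-inj : a ⇒ b ≈ a′ ⇒ b′ → a ≈ a′ × b ≈ b′
⇒-inj e with arr~ f g ← ≈⇒~ e = f , g

⊕-inj : a ⊕ b ≈ a′ ⊕ b′ → a ≈ a′ × b ≈ b′
⊕-inj e with sum~ f g ← ≈⇒~ e = f , g

⊗-inj : a ⊗ b ≈ a′ ⊗ b′ → a ≈ a′ × b ≈ b′
⊗-inj e with prod~ f g ← ≈⇒~ e = f , g

-- The type `μt.t` represents all non-contractive types; like `void` it has no primes.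
headType : Head → Type
headType voidH       = void
headType loopH       = μ (tvar Fin.zero)
headType (sumH a b)  = a ⊕ b
headType (prodH a b) = a ⊗ b
headType (arrH a b)  = a ⇒ b

head≡⇒≈ : head σ ≡ H → σ ≈ headType H
head≡⇒≈ eq zero = refl
head≡⇒≈ {H = voidH} eq (suc n) rewrite eq = refl
head≡⇒≈ {H = loopH} eq (suc n) rewrite eq = refl
head≡⇒≈ {H = sumH a b} eq (suc n) rewrite eq = refl
head≡⇒≈ {H = prodH a b} eq (suc n) rewrite eq = refl
head≡⇒≈ {H = arrH a b} eq (suc n) rewrite eq = refl

-- The entailment order on primes

mutual
  Leq-≈ : ∀ p q → σ ≈ τ → Leq σ p q → Leq τ p q
  Leq-≈ p q e = LeqH-~ p q (≈⇒~ e)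

  LeqH-~ : ∀ p q → H ~ H′ → LeqH H p q → LeqH H′ p q
  LeqH-~ tag0 tag0 (sum~ e f) h = h
  LeqH-~ tag0 (in0 q) (sum~ e f) h = h
  LeqH-~ (in0 p) (in0 q) (sum~ e f) h = Leq-≈ p q e h
  LeqH-~ tag1 tag1 (sum~ e f) h = h
  LeqH-~ tag1 (in1 q) (sum~ e f) h = h
  LeqH-~ (in1 p) (in1 q) (sum~ e f) h = Leq-≈ p q f h
  LeqH-~ (pr0 p) (pr0 q) (prod~ e f) h = Leq-≈ p q e h
  LeqH-~ (pr1 p) (pr1 q) (prod~ e f) h = Leq-≈ p q f h
  LeqH-~ (fun X p) (fun Y q) (arr~ e f) (h , h′) = Leq-≈ p q f h , AllAny-≈ Y X e h′

  AllAny-≈ : ∀ Y X → σ ≈ τ → AllAny σ Y X → AllAny τ Y X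
  AllAny-≈ [] X e h = tt
  AllAny-≈ (y ∷ Y) X e (h , h′) = AnyLeq-≈ y X e h , AllAny-≈ Y X e h′

  AnyLeq-≈ : ∀ y X → σ ≈ τ → AnyLeq σ y X → AnyLeq τ y X
  AnyLeq-≈ y (x ∷ X) e (inj₁ h) = inj₁ (Leq-≈ y x e h)
  AnyLeq-≈ y (x ∷ X) e (inj₂ h) = inj₂ (AnyLeq-≈ y X e h)

mutual
  Leq-trans : ∀ σ p q r → Leq σ p q → Leq σ q r → Leq σ p r
  Leq-trans σ p q r = LeqH-trans (head σ) p q r

  LeqH-trans : ∀ H p q r → LeqH H p q → LeqH H q r → LeqH H p r
  LeqH-trans (sumH a b) tag0 tag0 tag0 h h′ = tt
  LeqH-trans (sumH a b) tag0 tag0 (in0 r) h h′ = tt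
  LeqH-trans (sumH a b) tag0 (in0 q) (in0 r) h h′ = tt
  LeqH-trans (sumH a b) (in0 p) (in0 q) (in0 r) h h′ = Leq-trans a p q r h h′
  LeqH-trans (sumH a b) tag1 tag1 tag1 h h′ = tt
  LeqH-trans (sumH a b) tag1 tag1 (in1 r) h h′ = tt
  LeqH-trans (sumH a b) tag1 (in1 q) (in1 r) h h′ = tt
  LeqH-trans (sumH a b) (in1 p) (in1 q) (in1 r) h h′ = Leq-trans b p q r h h′
  LeqH-trans (prodH a b) (pr0 p) (pr0 q) (pr0 r) h h′ = Leq-trans a p q r h h′
  LeqH-trans (prodH a b) (pr1 p) (pr1 q) (pr1 r) h h′ = Leq-trans b p q r h h′
  LeqH-trans (arrH a b) (fun X p) (fun Y q) (fun Z r) (h , g) (h′ , g′) =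
    Leq-trans b p q r h h′ , AllAny-trans a Z Y X g′ g

  AllAny-trans : ∀ σ Z Y X → AllAny σ Z Y → AllAny σ Y X → AllAny σ Z X
  AllAny-trans σ [] Y X h h′ = tt
  AllAny-trans σ (z ∷ Z) Y X (h , g) h′ = AnyAll-trans σ z Y X h h′ , AllAny-trans σ Z Y X g h′

  AnyAll-trans : ∀ σ z Y X → AnyLeq σ z Y → AllAny σ Y X → AnyLeq σ z X
  AnyAll-trans σ z (y ∷ Y) X (inj₁ h) (h′ , _) = AnyLeq-trans σ z y X h h′
  AnyAll-trans σ z (y ∷ Y) X (inj₂ h) (_ , h′) = AnyAll-trans σ z Y X h h′

  AnyLeq-trans : ∀ σ z y X → Leq σ z y → AnyLeq σ y X → AnyLeq σ z X
  AnyLeq-trans σ z y (x ∷ X) h (inj₁ h′) = inj₁ (Leq-trans σ z y x h h′)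
  AnyLeq-trans σ z y (x ∷ X) h (inj₂ h′) = inj₂ (AnyLeq-trans σ z y X h h′)

mutual
  Leq-refl : ∀ σ p → IsPrime σ p → Leq σ p p
  Leq-refl σ p = LeqH-refl (head σ) p

  LeqH-refl : ∀ H p → IsPrimeH H p → LeqH H p p
  LeqH-refl (sumH a b) tag0 h = tt
  LeqH-refl (sumH a b) tag1 h = tt
  LeqH-refl (sumH a b) (in0 p) h = Leq-refl a p h
  LeqH-refl (sumH a b) (in1 p) h = Leq-refl b p h
  LeqH-refl (prodH a b) (pr0 p) h = Leq-refl a p h
  LeqH-refl (prodH a b) (pr1 p) h = Leq-refl b p h
  LeqH-refl (arrH a b) (fun X p) ((h , _) , h′) = Leq-refl b p h′ , AllAny-refl a X X id h

  AllAny-refl : ∀ σ Y X → (∀ {y} → AnyLeq σ y Y → AnyLeq σ y X) → AllPrime σ Y → AllAny σ Y X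
  AllAny-refl σ [] X i h = tt
  AllAny-refl σ (y ∷ Y) X i (h , h′) = i (inj₁ (Leq-refl σ y h)) , AllAny-refl σ Y X (i ∘ inj₂) h′

mutual
  -- Used to thin finite lists of primes to antichains in `maximal`.
  Leq? : ∀ σ p q → Dec (Leq σ p q)
  Leq? σ p q = LeqH? (head σ) p q

  LeqH? : ∀ H p q → Dec (LeqH H p q)
  LeqH? (sumH a b) tag0 tag0 = yes tt
  LeqH? (sumH a b) tag0 (in0 q) = yes tt
  LeqH? (sumH a b) (in0 p) (in0 q) = Leq? a p q
  LeqH? (sumH a b) tag1 tag1 = yes tt
  LeqH? (sumH a b) tag1 (in1 q) = yes tt
  LeqH? (sumH a b) (in1 p) (in1 q) = Leq? b p q
  LeqH? (prodH a b) (pr0 p) (pr0 q) = Leq? a p q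
  LeqH? (prodH a b) (pr1 p) (pr1 q) = Leq? b p q
  LeqH? (arrH a b) (fun X p) (fun Y q) = Leq? b p q ×-dec AllAny? a Y X
  LeqH? voidH _ _ = no λ ()
  LeqH? loopH _ _ = no λ ()
  LeqH? (sumH _ _) tag0 tag1 = no λ ()
  LeqH? (sumH _ _) tag0 (in1 _) = no λ ()
  LeqH? (sumH _ _) tag0 (pr0 _) = no λ ()
  LeqH? (sumH _ _) tag0 (pr1 _) = no λ ()
  LeqH? (sumH _ _) tag0 (fun _ _) = no λ ()
  LeqH? (sumH _ _) tag1 tag0 = no λ ()
  LeqH? (sumH _ _) tag1 (in0 _) = no λ ()
  LeqH? (sumH _ _) tag1 (pr0 _) = no λ ()
  LeqH? (sumH _ _) tag1 (pr1 _) = no λ ()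
  LeqH? (sumH _ _) tag1 (fun _ _) = no λ ()
  LeqH? (sumH _ _) (in0 _) tag0 = no λ ()
  LeqH? (sumH _ _) (in0 _) tag1 = no λ ()
  LeqH? (sumH _ _) (in0 _) (in1 _) = no λ ()
  LeqH? (sumH _ _) (in0 _) (pr0 _) = no λ ()
  LeqH? (sumH _ _) (in0 _) (pr1 _) = no λ ()
  LeqH? (sumH _ _) (in0 _) (fun _ _) = no λ ()
  LeqH? (sumH _ _) (in1 _) tag0 = no λ ()
  LeqH? (sumH _ _) (in1 _) tag1 = no λ ()
  LeqH? (sumH _ _) (in1 _) (in0 _) = no λ ()
  LeqH? (sumH _ _) (in1 _) (pr0 _) = no λ ()
  LeqH? (sumH _ _) (in1 _) (pr1 _) = no λ ()
  LeqH? (sumH _ _) (in1 _) (fun _ _) = no λ ()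
  LeqH? (sumH _ _) (pr0 _) _ = no λ ()
  LeqH? (sumH _ _) (pr1 _) _ = no λ ()
  LeqH? (sumH _ _) (fun _ _) _ = no λ ()
  LeqH? (prodH _ _) tag0 _ = no λ ()
  LeqH? (prodH _ _) tag1 _ = no λ ()
  LeqH? (prodH _ _) (in0 _) _ = no λ ()
  LeqH? (prodH _ _) (in1 _) _ = no λ ()
  LeqH? (prodH _ _) (pr0 _) tag0 = no λ ()
  LeqH? (prodH _ _) (pr0 _) tag1 = no λ ()
  LeqH? (prodH _ _) (pr0 _) (in0 _) = no λ ()
  LeqH? (prodH _ _) (pr0 _) (in1 _) = no λ ()
  LeqH? (prodH _ _) (pr0 _) (pr1 _) = no λ ()
  LeqH? (prodH _ _) (pr0 _) (fun _ _) = no λ ()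
  LeqH? (prodH _ _) (pr1 _) tag0 = no λ ()
  LeqH? (prodH _ _) (pr1 _) tag1 = no λ ()
  LeqH? (prodH _ _) (pr1 _) (in0 _) = no λ ()
  LeqH? (prodH _ _) (pr1 _) (in1 _) = no λ ()
  LeqH? (prodH _ _) (pr1 _) (pr0 _) = no λ ()
  LeqH? (prodH _ _) (pr1 _) (fun _ _) = no λ ()
  LeqH? (prodH _ _) (fun _ _) _ = no λ ()
  LeqH? (arrH _ _) tag0 _ = no λ ()
  LeqH? (arrH _ _) tag1 _ = no λ ()
  LeqH? (arrH _ _) (in0 _) _ = no λ ()
  LeqH? (arrH _ _) (in1 _) _ = no λ ()
  LeqH? (arrH _ _) (pr0 _) _ = no λ ()
  LeqH? (arrH _ _) (pr1 _) _ = no λ ()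
  LeqH? (arrH _ _) (fun _ _) tag0 = no λ ()
  LeqH? (arrH _ _) (fun _ _) tag1 = no λ ()
  LeqH? (arrH _ _) (fun _ _) (in0 _) = no λ ()
  LeqH? (arrH _ _) (fun _ _) (in1 _) = no λ ()
  LeqH? (arrH _ _) (fun _ _) (pr0 _) = no λ ()
  LeqH? (arrH _ _) (fun _ _) (pr1 _) = no λ ()

  AllAny? : ∀ σ Y X → Dec (AllAny σ Y X)
  AllAny? σ [] X = yes tt
  AllAny? σ (y ∷ Y) X = AnyLeq? σ y X ×-dec AllAny? σ Y X

  AnyLeq? : ∀ σ y X → Dec (AnyLeq σ y X)
  AnyLeq? σ y [] = no λ ()
  AnyLeq? σ y (x ∷ X) = Leq? σ y x ⊎-dec AnyLeq? σ y X

AnyLeq⁺ : ∀ σ y → x ∈ X → Leq σ y x → AnyLeq σ y X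
AnyLeq⁺ σ y (here refl) h = inj₁ h
AnyLeq⁺ σ y (there i)   h = inj₂ (AnyLeq⁺ σ y i h)

AnyLeq⁻ : ∀ σ y X → AnyLeq σ y X → ∃ λ x → x ∈ X × Leq σ y x
AnyLeq⁻ σ y (x ∷ X) (inj₁ h) = x , here refl , h
AnyLeq⁻ σ y (x ∷ X) (inj₂ h) with x′ , i , h′ ← AnyLeq⁻ σ y X h = x′ , there i , h′

AllAny⁺ : ∀ σ Y X → (∀ {y} → y ∈ Y → AnyLeq σ y X) → AllAny σ Y X
AllAny⁺ σ [] X h = tt
AllAny⁺ σ (y ∷ Y) X h = h (here refl) , AllAny⁺ σ Y X (h ∘ there)

AllAny⁻ : ∀ σ Y X → AllAny σ Y X → y ∈ Y → AnyLeq σ y X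
AllAny⁻ σ (y ∷ Y) X (h , _) (here refl) = h
AllAny⁻ σ (y ∷ Y) X (_ , h) (there i)   = AllAny⁻ σ Y X h i

AllPrime⁺ : ∀ σ X → (∀ {x} → x ∈ X → IsPrime σ x) → AllPrime σ X
AllPrime⁺ σ [] h = tt
AllPrime⁺ σ (x ∷ X) h = h (here refl) , AllPrime⁺ σ X (h ∘ there)

AllPrime⁻ : ∀ σ X → AllPrime σ X → x ∈ X → IsPrime σ x
AllPrime⁻ σ (x ∷ X) (h , _) (here refl) = h
AllPrime⁻ σ (x ∷ X) (_ , h) (there i)   = AllPrime⁻ σ X h i

-- Consistency

mutual
  Conₖ-≈ : ∀ k p q → σ ≈ τ → Conₖ k σ p q → Conₖ k τ p q
  Conₖ-≈ zero p q e h = tt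
  Conₖ-≈ (suc k) p q e h = ConH-~ k p q (≈⇒~ e) h

  ConH-~ : ∀ k p q → H ~ H′ → ConH k H p q → ConH k H′ p q
  ConH-~ k tag0 tag0 (sum~ e f) h = h
  ConH-~ k tag0 (in0 q) (sum~ e f) h = h
  ConH-~ k (in0 p) tag0 (sum~ e f) h = h
  ConH-~ k (in0 p) (in0 q) (sum~ e f) h = Conₖ-≈ k p q e h
  ConH-~ k tag1 tag1 (sum~ e f) h = h
  ConH-~ k tag1 (in1 q) (sum~ e f) h = h
  ConH-~ k (in1 p) tag1 (sum~ e f) h = h
  ConH-~ k (in1 p) (in1 q) (sum~ e f) h = Conₖ-≈ k p q f h
  ConH-~ k (pr0 p) (pr0 q) (prod~ e f) h = Conₖ-≈ k p q e h
  ConH-~ k (pr0 p) (pr1 q) (prod~ e f) h = h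
  ConH-~ k (pr1 p) (pr0 q) (prod~ e f) h = h
  ConH-~ k (pr1 p) (pr1 q) (prod~ e f) h = Conₖ-≈ k p q f h
  ConH-~ k (fun X p) (fun Y q) (arr~ e f) h (u , v , w) =
    Conₖ-≈ k p q f (h (ConLL-≈ k X X e⁻¹ u , ConLL-≈ k X Y e⁻¹ v , ConLL-≈ k Y Y e⁻¹ w))
    where e⁻¹ = ≈-sym e

  ConL-≈ : ∀ k x Y → σ ≈ τ → ConL k σ x Y → ConL k τ x Y
  ConL-≈ k x [] e h = tt
  ConL-≈ k x (y ∷ Y) e (h , h′) = Conₖ-≈ k x y e h , ConL-≈ k x Y e h′

  ConLL-≈ : ∀ k X Y → σ ≈ τ → ConLL k σ X Y → ConLL k τ X Y
  ConLL-≈ k [] Y e h = tt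
  ConLL-≈ k (x ∷ X) Y e (h , h′) = ConL-≈ k x Y e h , ConLL-≈ k X Y e h′

ConLL⁺ : ∀ k σ X Y → (∀ {x y} → x ∈ X → y ∈ Y → Conₖ k σ x y) → ConLL k σ X Y
ConLL⁺ k σ [] Y h = tt
ConLL⁺ k σ (x ∷ X) Y h = row Y (h (here refl)) , ConLL⁺ k σ X Y (h ∘ there)
  where
  row : ∀ Y → (∀ {y} → y ∈ Y → Conₖ k σ x y) → ConL k σ x Y
  row [] h = tt
  row (y ∷ Y) h = h (here refl) , row Y (h ∘ there)

ConLL⁻ : ∀ k σ X Y → ConLL k σ X Y → x ∈ X → y ∈ Y → Conₖ k σ x y
ConLL⁻ k σ (x ∷ X) Y (h , _) (here refl) i = row Y h i
  where
  row : ∀ Y → ConL k σ x Y → y ∈ Y → Conₖ k σ x y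
  row (y ∷ Y) (h , _) (here refl) = h
  row (y ∷ Y) (_ , h) (there i)   = row Y h i
ConLL⁻ k σ (x ∷ X) Y (_ , h) (there i) i′ = ConLL⁻ k σ X Y h i i′

mutual
  Conₖ-sym : ∀ k σ p q → Conₖ k σ p q → Conₖ k σ q p
  Conₖ-sym zero σ p q h = tt
  Conₖ-sym (suc k) σ p q h = ConH-sym k (head σ) p q h

  ConH-sym : ∀ k H p q → ConH k H p q → ConH k H q p
  ConH-sym k (sumH a b) tag0 tag0 h = tt
  ConH-sym k (sumH a b) tag0 (in0 q) h = tt
  ConH-sym k (sumH a b) (in0 p) tag0 h = tt
  ConH-sym k (sumH a b) (in0 p) (in0 q) h = Conₖ-sym k a p q h
  ConH-sym k (sumH a b) tag1 tag1 h = tt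
  ConH-sym k (sumH a b) tag1 (in1 q) h = tt
  ConH-sym k (sumH a b) (in1 p) tag1 h = tt
  ConH-sym k (sumH a b) (in1 p) (in1 q) h = Conₖ-sym k b p q h
  ConH-sym k (prodH a b) (pr0 p) (pr0 q) h = Conₖ-sym k a p q h
  ConH-sym k (prodH a b) (pr0 p) (pr1 q) h = tt
  ConH-sym k (prodH a b) (pr1 p) (pr0 q) h = tt
  ConH-sym k (prodH a b) (pr1 p) (pr1 q) h = Conₖ-sym k b p q h
  ConH-sym k (arrH a b) (fun X p) (fun Y q) h (u , v , w) = Conₖ-sym k b p q
    (h (w , ConLL⁺ k a X Y (λ i i′ → Conₖ-sym k a _ _ (ConLL⁻ k a Y X v i′ i)) , u))

mutual
  Conₖ-refl : ∀ k σ p → IsPrime σ p → Conₖ k σ p p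
  Conₖ-refl zero σ p h = tt
  Conₖ-refl (suc k) σ p h = ConH-refl k (head σ) p h

  ConH-refl : ∀ k H p → IsPrimeH H p → ConH k H p p
  ConH-refl k (sumH a b) tag0 h = tt
  ConH-refl k (sumH a b) tag1 h = tt
  ConH-refl k (sumH a b) (in0 p) h = Conₖ-refl k a p h
  ConH-refl k (sumH a b) (in1 p) h = Conₖ-refl k b p h
  ConH-refl k (prodH a b) (pr0 p) h = Conₖ-refl k a p h
  ConH-refl k (prodH a b) (pr1 p) h = Conₖ-refl k b p h
  ConH-refl k (arrH a b) (fun X p) (_ , h) _ = Conₖ-refl k b p h

mutual
  -- At an arrow the smaller prime has the larger argument set: `X′` lies below `X`, so consistency
  -- of `X` with `Y` passes to `X′` with `Y` before `h` is applied.
  Conₖ-↓ : ∀ k σ p p′ q → Leq σ p p′ → Conₖ k σ p′ q → Conₖ k σ p q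
  Conₖ-↓ zero σ p p′ q l h = tt
  Conₖ-↓ (suc k) σ p p′ q l h = ConH-↓ k (head σ) p p′ q l h

  ConH-↓ : ∀ k H p p′ q → LeqH H p p′ → ConH k H p′ q → ConH k H p q
  ConH-↓ k (sumH a b) tag0 tag0 q l h = h
  ConH-↓ k (sumH a b) tag0 (in0 p′) tag0 l h = tt
  ConH-↓ k (sumH a b) tag0 (in0 p′) (in0 q) l h = tt
  ConH-↓ k (sumH a b) (in0 p) (in0 p′) tag0 l h = tt
  ConH-↓ k (sumH a b) (in0 p) (in0 p′) (in0 q) l h = Conₖ-↓ k a p p′ q l h
  ConH-↓ k (sumH a b) tag1 tag1 q l h = h
  ConH-↓ k (sumH a b) tag1 (in1 p′) tag1 l h = tt
  ConH-↓ k (sumH a b) tag1 (in1 p′) (in1 q) l h = tt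
  ConH-↓ k (sumH a b) (in1 p) (in1 p′) tag1 l h = tt
  ConH-↓ k (sumH a b) (in1 p) (in1 p′) (in1 q) l h = Conₖ-↓ k b p p′ q l h
  ConH-↓ k (prodH a b) (pr0 p) (pr0 p′) (pr0 q) l h = Conₖ-↓ k a p p′ q l h
  ConH-↓ k (prodH a b) (pr0 p) (pr0 p′) (pr1 q) l h = tt
  ConH-↓ k (prodH a b) (pr1 p) (pr1 p′) (pr0 q) l h = tt
  ConH-↓ k (prodH a b) (pr1 p) (pr1 p′) (pr1 q) l h = Conₖ-↓ k b p p′ q l h
  ConH-↓ k (arrH a b) (fun X p) (fun X′ p′) (fun Y q) (l , m) h (u , v , w) =
    Conₖ-↓ k b p p′ q l (h
      ( ConLL⁺ k a X′ X′ (λ i i′ → Conₖ-below k a X X X′ X′ m m u i i′)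
      , ConLL⁺ k a X′ Y (λ {x′} {y} i i′ →
          let (x , ix , lx) = AnyLeq⁻ a x′ X (AllAny⁻ a X′ X m i)
          in Conₖ-↓ k a x′ x y lx (ConLL⁻ k a X Y v ix i′))
      , w))

  Conₖ-below : ∀ k σ X Y X′ Y′ → AllAny σ X′ X → AllAny σ Y′ Y → ConLL k σ X Y →
    x ∈ X′ → y ∈ Y′ → Conₖ k σ x y
  Conₖ-below {x = x′} {y = y′} k σ X Y X′ Y′ l m h i i′ =
    let (x , ix , lx) = AnyLeq⁻ σ x′ X (AllAny⁻ σ X′ X l i)
        (y , iy , ly) = AnyLeq⁻ σ y′ Y (AllAny⁻ σ Y′ Y m i′)
    in Conₖ-↓ k σ x′ x y′ lx (Conₖ-sym k σ y′ x
         (Conₖ-↓ k σ y′ y x ly (Conₖ-sym k σ x y (ConLL⁻ k σ X Y h ix iy))))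

mutual
  -- The arrow case is an implication between decidable statements, and the fuel keeps the recursion
  -- structural. `ConAll⊎` rests on it.
  Conₖ? : ∀ k σ p q → Dec (Conₖ k σ p q)
  Conₖ? zero σ p q = yes tt
  Conₖ? (suc k) σ p q = ConH? k (head σ) p q

  ConH? : ∀ k H p q → Dec (ConH k H p q)
  ConH? k (sumH a b) tag0 tag0 = yes tt
  ConH? k (sumH a b) tag0 (in0 q) = yes tt
  ConH? k (sumH a b) (in0 p) tag0 = yes tt
  ConH? k (sumH a b) (in0 p) (in0 q) = Conₖ? k a p q
  ConH? k (sumH a b) tag1 tag1 = yes tt
  ConH? k (sumH a b) tag1 (in1 q) = yes tt
  ConH? k (sumH a b) (in1 p) tag1 = yes tt
  ConH? k (sumH a b) (in1 p) (in1 q) = Conₖ? k b p q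
  ConH? k (prodH a b) (pr0 p) (pr0 q) = Conₖ? k a p q
  ConH? k (prodH a b) (pr0 p) (pr1 q) = yes tt
  ConH? k (prodH a b) (pr1 p) (pr0 q) = yes tt
  ConH? k (prodH a b) (pr1 p) (pr1 q) = Conₖ? k b p q
  ConH? k (arrH a b) (fun X p) (fun Y q) =
    (ConLL? k a X X ×-dec (ConLL? k a X Y ×-dec ConLL? k a Y Y)) →-dec Conₖ? k b p q
  ConH? k voidH _ _ = no λ ()
  ConH? k loopH _ _ = no λ ()
  ConH? k (sumH _ _) tag0 tag1 = no λ ()
  ConH? k (sumH _ _) tag0 (in1 _) = no λ ()
  ConH? k (sumH _ _) tag0 (pr0 _) = no λ ()
  ConH? k (sumH _ _) tag0 (pr1 _) = no λ ()
  ConH? k (sumH _ _) tag0 (fun _ _) = no λ ()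
  ConH? k (sumH _ _) tag1 tag0 = no λ ()
  ConH? k (sumH _ _) tag1 (in0 _) = no λ ()
  ConH? k (sumH _ _) tag1 (pr0 _) = no λ ()
  ConH? k (sumH _ _) tag1 (pr1 _) = no λ ()
  ConH? k (sumH _ _) tag1 (fun _ _) = no λ ()
  ConH? k (sumH _ _) (in0 _) tag1 = no λ ()
  ConH? k (sumH _ _) (in0 _) (in1 _) = no λ ()
  ConH? k (sumH _ _) (in0 _) (pr0 _) = no λ ()
  ConH? k (sumH _ _) (in0 _) (pr1 _) = no λ ()
  ConH? k (sumH _ _) (in0 _) (fun _ _) = no λ ()
  ConH? k (sumH _ _) (in1 _) tag0 = no λ ()
  ConH? k (sumH _ _) (in1 _) (in0 _) = no λ ()
  ConH? k (sumH _ _) (in1 _) (pr0 _) = no λ ()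
  ConH? k (sumH _ _) (in1 _) (pr1 _) = no λ ()
  ConH? k (sumH _ _) (in1 _) (fun _ _) = no λ ()
  ConH? k (sumH _ _) (pr0 _) _ = no λ ()
  ConH? k (sumH _ _) (pr1 _) _ = no λ ()
  ConH? k (sumH _ _) (fun _ _) _ = no λ ()
  ConH? k (prodH _ _) tag0 _ = no λ ()
  ConH? k (prodH _ _) tag1 _ = no λ ()
  ConH? k (prodH _ _) (in0 _) _ = no λ ()
  ConH? k (prodH _ _) (in1 _) _ = no λ ()
  ConH? k (prodH _ _) (pr0 _) tag0 = no λ ()
  ConH? k (prodH _ _) (pr0 _) tag1 = no λ ()
  ConH? k (prodH _ _) (pr0 _) (in0 _) = no λ ()
  ConH? k (prodH _ _) (pr0 _) (in1 _) = no λ ()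
  ConH? k (prodH _ _) (pr0 _) (fun _ _) = no λ ()
  ConH? k (prodH _ _) (pr1 _) tag0 = no λ ()
  ConH? k (prodH _ _) (pr1 _) tag1 = no λ ()
  ConH? k (prodH _ _) (pr1 _) (in0 _) = no λ ()
  ConH? k (prodH _ _) (pr1 _) (in1 _) = no λ ()
  ConH? k (prodH _ _) (pr1 _) (fun _ _) = no λ ()
  ConH? k (prodH _ _) (fun _ _) _ = no λ ()
  ConH? k (arrH _ _) tag0 _ = no λ ()
  ConH? k (arrH _ _) tag1 _ = no λ ()
  ConH? k (arrH _ _) (in0 _) _ = no λ ()
  ConH? k (arrH _ _) (in1 _) _ = no λ ()
  ConH? k (arrH _ _) (pr0 _) _ = no λ ()
  ConH? k (arrH _ _) (pr1 _) _ = no λ ()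
  ConH? k (arrH _ _) (fun _ _) tag0 = no λ ()
  ConH? k (arrH _ _) (fun _ _) tag1 = no λ ()
  ConH? k (arrH _ _) (fun _ _) (in0 _) = no λ ()
  ConH? k (arrH _ _) (fun _ _) (in1 _) = no λ ()
  ConH? k (arrH _ _) (fun _ _) (pr0 _) = no λ ()
  ConH? k (arrH _ _) (fun _ _) (pr1 _) = no λ ()

  ConL? : ∀ k σ x Y → Dec (ConL k σ x Y)
  ConL? k σ x [] = yes tt
  ConL? k σ x (y ∷ Y) = Conₖ? k σ x y ×-dec ConL? k σ x Y

  ConLL? : ∀ k σ X Y → Dec (ConLL k σ X Y)
  ConLL? k σ [] Y = yes tt
  ConLL? k σ (x ∷ X) Y = ConL? k σ x Y ×-dec ConLL? k σ X Y

-- Independence of consistency from the fuel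

depth>0 : ∀ p → 1 ≤ depth p
depth>0 tag0 = s≤s z≤n
depth>0 tag1 = s≤s z≤n
depth>0 (in0 p) = s≤s z≤n
depth>0 (in1 p) = s≤s z≤n
depth>0 (pr0 p) = s≤s z≤n
depth>0 (pr1 p) = s≤s z≤n
depth>0 (fun X p) = s≤s z≤n

¬depth≤0 : ∀ p → ¬ depth p ≤ 0
¬depth≤0 p h with () ← ≤-trans (depth>0 p) h

∈⇒depth≤ : x ∈ X → depth x ≤ depthL X
∈⇒depth≤ (here refl) = m≤m⊔n _ _
∈⇒depth≤ {X = y ∷ X} (there i) = ≤-trans (∈⇒depth≤ i) (m≤n⊔m (depth y) _)

depthL-lub : ∀ X → (∀ {x} → x ∈ X → depth x ≤ k) → depthL X ≤ k
depthL-lub [] h = z≤n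
depthL-lub (x ∷ X) h = ⊔-lub (h (here refl)) (depthL-lub X (h ∘ there))

fun-argsDepth : ∀ X p → depth (fun X p) ≤ suc k → x ∈ X → depth x ≤ k
fun-argsDepth X p h i = ≤-trans (∈⇒depth≤ i) (≤-trans (m≤m⊔n (depthL X) (depth p)) (s≤s⁻¹ h))

fun-resultDepth : ∀ X p → depth (fun X p) ≤ suc k → depth p ≤ k
fun-resultDepth X p h = ≤-trans (m≤n⊔m (depthL X) (depth p)) (s≤s⁻¹ h)

Within : ℕ → ℕ → Prm → Set
Within k j p = depth p ≤ k × depth p ≤ j

mutual
  -- `Con` takes its fuel from the primes at hand, so facts about different pairs meet only after a
  -- change of fuel. Both bounds are carried along because the premise of the arrow case travels
  -- from `j` back to `k`.
  Conₖ-stable : ∀ k j σ p q → Within k j p → Within k j q → Conₖ k σ p q → Conₖ j σ p q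
  Conₖ-stable k zero σ p q u v h = tt
  Conₖ-stable zero (suc j) σ p q (u , _) v h = ⊥-elim (¬depth≤0 p u)
  Conₖ-stable (suc k) (suc j) σ p q u v h = ConH-stable k j (head σ) p q u v h

  ConH-stable : ∀ k j H p q → Within (suc k) (suc j) p → Within (suc k) (suc j) q →
    ConH k H p q → ConH j H p q
  ConH-stable k j (sumH a b) tag0 tag0 u v h = tt
  ConH-stable k j (sumH a b) tag0 (in0 q) u v h = tt
  ConH-stable k j (sumH a b) (in0 p) tag0 u v h = tt
  ConH-stable k j (sumH a b) (in0 p) (in0 q) (s≤s u , s≤s u′) (s≤s v , s≤s v′) h =
    Conₖ-stable k j a p q (u , u′) (v , v′) h
  ConH-stable k j (sumH a b) tag1 tag1 u v h = tt
  ConH-stable k j (sumH a b) tag1 (in1 q) u v h = tt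
  ConH-stable k j (sumH a b) (in1 p) tag1 u v h = tt
  ConH-stable k j (sumH a b) (in1 p) (in1 q) (s≤s u , s≤s u′) (s≤s v , s≤s v′) h =
    Conₖ-stable k j b p q (u , u′) (v , v′) h
  ConH-stable k j (prodH a b) (pr0 p) (pr0 q) (s≤s u , s≤s u′) (s≤s v , s≤s v′) h =
    Conₖ-stable k j a p q (u , u′) (v , v′) h
  ConH-stable k j (prodH a b) (pr0 p) (pr1 q) u v h = tt
  ConH-stable k j (prodH a b) (pr1 p) (pr0 q) u v h = tt
  ConH-stable k j (prodH a b) (pr1 p) (pr1 q) (s≤s u , s≤s u′) (s≤s v , s≤s v′) h =
    Conₖ-stable k j b p q (u , u′) (v , v′) h
  ConH-stable k j (arrH a b) (fun X p) (fun Y q) (u , u′) (v , v′) h (l , m , n) =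
    Conₖ-stable k j b p q
      (fun-resultDepth X p u , fun-resultDepth X p u′)
      (fun-resultDepth Y q v , fun-resultDepth Y q v′)
      (h (lower X X inX inX l , lower X Y inX inY m , lower Y Y inY inY n))
    where
    inX : ∀ {x} → x ∈ X → Within j k x
    inX i = fun-argsDepth X p u′ i , fun-argsDepth X p u i

    inY : ∀ {y} → y ∈ Y → Within j k y
    inY i = fun-argsDepth Y q v′ i , fun-argsDepth Y q v i

    lower : ∀ X Y → (∀ {x} → x ∈ X → Within j k x) → (∀ {y} → y ∈ Y → Within j k y) →
      ConLL j a X Y → ConLL k a X Y
    lower X Y f g l = ConLL⁺ k a X Y λ i i′ →
      Conₖ-stable j k a _ _ (f i) (g i′) (ConLL⁻ j a X Y l i i′)

Con⇒Conₖ : ∀ k σ p q → depth p ≤ k → depth q ≤ k → Con σ p q → Conₖ k σ p q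
Con⇒Conₖ k σ p q u v = Conₖ-stable (depth p ⊔ depth q) k σ p q
  (m≤m⊔n _ _ , u) (m≤n⊔m (depth p) _ , v)

Conₖ⇒Con : ∀ k σ p q → depth p ≤ k → depth q ≤ k → Conₖ k σ p q → Con σ p q
Conₖ⇒Con k σ p q u v = Conₖ-stable k (depth p ⊔ depth q) σ p q
  (u , m≤m⊔n _ _) (v , m≤n⊔m (depth p) _)

Con-≈ : ∀ p q → σ ≈ τ → Con σ p q → Con τ p q
Con-≈ p q = Conₖ-≈ (depth p ⊔ depth q) p q

Con? : ∀ σ p q → Dec (Con σ p q)
Con? σ p q = Conₖ? (depth p ⊔ depth q) σ p q

Con-sym : ∀ σ p q → Con σ p q → Con σ q p
Con-sym σ p q h = Conₖ⇒Con (depth p ⊔ depth q) σ q p (m≤n⊔m (depth p) _) (m≤m⊔n _ _)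
  (Conₖ-sym (depth p ⊔ depth q) σ p q h)

Con-refl : ∀ σ p → IsPrime σ p → Con σ p p
Con-refl σ p = Conₖ-refl (depth p ⊔ depth p) σ p

Con-↓ˡ : ∀ σ p p′ q → Leq σ p p′ → Con σ p′ q → Con σ p q
Con-↓ˡ σ p p′ q l h = Conₖ⇒Con K σ p q p≤K q≤K
  (Conₖ-↓ K σ p p′ q l (Con⇒Conₖ K σ p′ q p′≤K q≤K h))
  where
  K = depth p ⊔ (depth p′ ⊔ depth q)
  p≤K : depth p ≤ K
  p≤K = m≤m⊔n _ _
  p′≤K : depth p′ ≤ K
  p′≤K = ≤-trans (m≤m⊔n _ (depth q)) (m≤n⊔m (depth p) _)
  q≤K : depth q ≤ K
  q≤K = ≤-trans (m≤n⊔m (depth p′) _) (m≤n⊔m (depth p) _)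

Con-↓ : ∀ σ p p′ q q′ → Leq σ p p′ → Leq σ q q′ → Con σ p′ q′ → Con σ p q
Con-↓ σ p p′ q q′ l m h = Con-↓ˡ σ p p′ q l
  (Con-sym σ q p′ (Con-↓ˡ σ q q′ p′ m (Con-sym σ p′ q′ h)))

-- The fuel-free counterpart of `ConLL`, phrased by membership so that sublists and unions need no
-- bookkeeping.
ConAll : Type → List Prm → List Prm → Set
ConAll σ X Y = ∀ {x y} → x ∈ X → y ∈ Y → Con σ x y

ConAll-++ : ∀ σ X Y → ConAll σ X X → ConAll σ X Y → ConAll σ Y Y → ConAll σ (X ++ Y) (X ++ Y)
ConAll-++ σ X Y u v w {x} {y} i j with ∈-++⁻ X i | ∈-++⁻ X j
... | inj₁ i | inj₁ j = u i j
... | inj₁ i | inj₂ j = v i j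
... | inj₂ i | inj₁ j = Con-sym σ y x (v j i)
... | inj₂ i | inj₂ j = w i j

ConLL⇒ConAll : ∀ k σ X Y → (∀ {x} → x ∈ X → depth x ≤ k) → (∀ {y} → y ∈ Y → depth y ≤ k) →
  ConLL k σ X Y → ConAll σ X Y
ConLL⇒ConAll k σ X Y u v h {x} {y} i j = Conₖ⇒Con k σ x y (u i) (v j) (ConLL⁻ k σ X Y h i j)

ConAll⇒ConLL : ∀ k σ X Y → (∀ {x} → x ∈ X → depth x ≤ k) → (∀ {y} → y ∈ Y → depth y ≤ k) →
  ConAll σ X Y → ConLL k σ X Y
ConAll⇒ConLL k σ X Y u v h = ConLL⁺ k σ X Y λ {x} {y} i j → Con⇒Conₖ k σ x y (u i) (v j) (h i j)

-- The negative case names a concrete inconsistent pair: in `define-⇒` it is the pair for which a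
-- separator of the argument is built.
ConAll⊎ : ∀ σ X Y → ConAll σ X Y ⊎ (∃ λ x → ∃ λ y → x ∈ X × y ∈ Y × ¬ Con σ x y)
ConAll⊎ σ X Y with Any.any? (λ x → Any.any? (λ y → ¬? (Con? σ x y)) Y) X
... | yes h = let x , i , h′ = find h ; y , j , ¬c = find h′ in inj₂ (x , y , i , j , ¬c)
... | no ¬h = inj₁ λ {x} {y} i j → decidable-stable (Con? σ x y) λ ¬c → ¬h (lose i (lose j ¬c))

module _ (a b : Type) (X : List Prm) (p : Prm) (Y : List Prm) (q : Prm) where
  private
    -- The fuel that is left once `Con` at `a ⇒ b` has spent one unit on the arrow.
    k₀ = (depthL X ⊔ depth p) ⊔ (depthL Y ⊔ depth q)

    inX : ∀ {x} → x ∈ X → depth x ≤ k₀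
    inX i = ≤-trans (∈⇒depth≤ i) (≤-trans (m≤m⊔n _ (depth p)) (m≤m⊔n _ _))

    inY : ∀ {y} → y ∈ Y → depth y ≤ k₀
    inY i = ≤-trans (∈⇒depth≤ i) (≤-trans (m≤m⊔n _ (depth q)) (m≤n⊔m (depthL X ⊔ depth p) _))

    p≤ : depth p ≤ k₀
    p≤ = ≤-trans (m≤n⊔m (depthL X) _) (m≤m⊔n _ _)

    q≤ : depth q ≤ k₀
    q≤ = ≤-trans (m≤n⊔m (depthL Y) _) (m≤n⊔m (depthL X ⊔ depth p) _)

  Con-fun⁺ : (ConAll a X X → ConAll a X Y → ConAll a Y Y → Con b p q) →
    Con (a ⇒ b) (fun X p) (fun Y q)
  Con-fun⁺ h (u , v , w) = Con⇒Conₖ k₀ b p q p≤ q≤ (h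
    (ConLL⇒ConAll k₀ a X X inX inX u)
    (ConLL⇒ConAll k₀ a X Y inX inY v)
    (ConLL⇒ConAll k₀ a Y Y inY inY w))

  Con-fun⁻ : Con (a ⇒ b) (fun X p) (fun Y q) →
    ConAll a X X → ConAll a X Y → ConAll a Y Y → Con b p q
  Con-fun⁻ h u v w = Conₖ⇒Con k₀ b p q p≤ q≤ (h
    ( ConAll⇒ConLL k₀ a X X inX inX u
    , ConAll⇒ConLL k₀ a X Y inX inY v
    , ConAll⇒ConLL k₀ a Y Y inY inY w))

-- Primes and elements

mutual
  IsPrime-≈ : ∀ p → σ ≈ τ → IsPrime σ p → IsPrime τ p
  IsPrime-≈ p e = IsPrimeH-~ p (≈⇒~ e)

  IsPrimeH-~ : ∀ p → H ~ H′ → IsPrimeH H p → IsPrimeH H′ p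
  IsPrimeH-~ tag0 (sum~ e f) h = h
  IsPrimeH-~ tag1 (sum~ e f) h = h
  IsPrimeH-~ (in0 p) (sum~ e f) h = IsPrime-≈ p e h
  IsPrimeH-~ (in1 p) (sum~ e f) h = IsPrime-≈ p f h
  IsPrimeH-~ (pr0 p) (prod~ e f) h = IsPrime-≈ p e h
  IsPrimeH-~ (pr1 p) (prod~ e f) h = IsPrime-≈ p f h
  IsPrimeH-~ (fun X p) (arr~ e f) (h , h′) = PrimeSet-≈ X e h , IsPrime-≈ p f h′

  AllPrime-≈ : ∀ X → σ ≈ τ → AllPrime σ X → AllPrime τ X
  AllPrime-≈ [] e h = tt
  AllPrime-≈ (x ∷ X) e (h , h′) = IsPrime-≈ x e h , AllPrime-≈ X e h′

  PrimeSet-≈ : ∀ X → σ ≈ τ → PrimeSet σ X → PrimeSet τ X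
  PrimeSet-≈ X e (h , c , i) = AllPrime-≈ X e h , AllPairs.map (λ {x} {y} → Con-≈ x y e) c ,
    AllPairs.map (λ {x} {y} (u , v) → u ∘ Leq-≈ x y (≈-sym e) , v ∘ Leq-≈ y x (≈-sym e)) i

IsElem-≈ : ∀ {d} → σ ≈ τ → IsElem σ d → IsElem τ d
IsElem-≈ e (u , v , w) =
  (λ p h → IsPrime-≈ p e (u p h)) ,
  (λ p q h l → v p q (IsPrime-≈ p (≈-sym e) h) (Leq-≈ p q (≈-sym e) l)) ,
  (λ p q h h′ → Con-≈ p q e (w p q h h′))

AllPairs⁺ : ∀ {R : Prm → Prm → Set} X → (∀ {x y} → x ∈ X → y ∈ X → R x y) → AllPairs R X
AllPairs⁺ [] h = []
AllPairs⁺ (x ∷ X) h = All.tabulate (λ i → h (here refl) (there i)) ∷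
  AllPairs⁺ X (λ i j → h (there i) (there j))

PrimeSet⇒ConAll : ∀ σ X → PrimeSet σ X → ConAll σ X X
PrimeSet⇒ConAll σ X (h , c , _) = go X h c
  where
  go : ∀ X → AllPrime σ X → AllPairs (Con σ) X → ConAll σ X X
  go (x ∷ X) h c (here refl) (here refl) = Con-refl σ x (proj₁ h)
  go (x ∷ X) h (c ∷ cs) (here refl) (there j) = All.lookup c j
  go (x ∷ X) h (c ∷ cs) {y} (there i) (here refl) = Con-sym σ x y (All.lookup c i)
  go (x ∷ X) h (c ∷ cs) (there i) (there j) = go X (proj₂ h) cs i j

PrimeSet⇒prime : ∀ σ X → PrimeSet σ X → x ∈ X → IsPrime σ x
PrimeSet⇒prime σ X h = AllPrime⁻ σ X (proj₁ h)

-- `PrimeSet` asks for pairwise incomparable members, which lists obtained by continuity or union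
-- need not have. A new `x` is dropped if something kept already lies above it; otherwise it evicts
-- whatever lies below it.
maximal : ∀ σ X → (∀ {x} → x ∈ X → IsPrime σ x) → ∃ λ Y →
  (∀ {y} → y ∈ Y → y ∈ X) × AllPairs (Incomparable σ) Y × (∀ {x} → x ∈ X → AnyLeq σ x Y)
maximal σ [] h = [] , (λ ()) , [] , λ ()
maximal σ (x ∷ X) h with Y , sub , inc , cov ← maximal σ X (h ∘ there) with AnyLeq? σ x Y
... | yes l = Y , there ∘ sub , inc , λ { (here refl) → l ; (there i) → cov i }
... | no ¬l = x ∷ Y′ , sub′ , All.tabulate incx ∷ AllPairsₚ.filter⁺ P? inc , cov′
  where
  P? = λ y → ¬? (Leq? σ y x)
  Y′ = filter P? Y

  sub′ : ∀ {y} → y ∈ x ∷ Y′ → y ∈ x ∷ X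
  sub′ (here e) = here e
  sub′ (there i) = there (sub (proj₁ (∈-filter⁻ P? i)))

  incx : ∀ {y} → y ∈ Y′ → Incomparable σ x y
  incx i with j , ¬m ← ∈-filter⁻ P? {xs = Y} i = (λ m → ¬l (AnyLeq⁺ σ x j m)) , ¬m

  cov′ : ∀ {z} → z ∈ x ∷ X → AnyLeq σ z (x ∷ Y′)
  cov′ (here refl) = inj₁ (Leq-refl σ x (h (here refl)))
  cov′ {z} (there i) with y , j , m ← AnyLeq⁻ σ z Y (cov i) with Leq? σ y x
  ... | yes n = inj₁ (Leq-trans σ z y x m n)
  ... | no ¬n = inj₂ (AnyLeq⁺ σ z (∈-filter⁺ P? j ¬n) m)

primeSet : ∀ σ X → (∀ {x} → x ∈ X → IsPrime σ x) → ConAll σ X X → ∃ λ Y →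
  PrimeSet σ Y × (∀ {y} → y ∈ Y → y ∈ X) × (∀ {x} → x ∈ X → down σ Y x)
primeSet σ X h c with Y , sub , inc , cov ← maximal σ X h =
  Y , (AllPrime⁺ σ Y (h ∘ sub) , AllPairs⁺ Y (λ i j → c (sub i) (sub j)) , inc) , sub ,
  λ i → h i , cov i

down-elem : ∀ σ X → ConAll σ X X → IsElem σ (down σ X)
down-elem σ X c =
  (λ p → proj₁) ,
  (λ p q h l (_ , m) → h , AnyLeq-trans σ p q X l m) ,
  λ p q (_ , l) (_ , m) →
    let (x , i , l′) = AnyLeq⁻ σ p X l
        (y , j , m′) = AnyLeq⁻ σ q X m
    in Con-↓ σ p x q y l′ m′ (c i j)

down-primeSet : ∀ σ X → PrimeSet σ X → IsElem σ (down σ X)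
down-primeSet σ X h = down-elem σ X (PrimeSet⇒ConAll σ X h)

∈⇒down : ∀ σ X → IsPrime σ x → x ∈ X → down σ X x
∈⇒down σ X h i = h , AnyLeq⁺ σ _ i (Leq-refl σ _ h)

down⊆ : ∀ σ X {d} → IsElem σ d → (∀ {x} → x ∈ X → d x) → down σ X ⊆ d
down⊆ σ X (_ , v , _) h p (h′ , l) with x , i , l′ ← AnyLeq⁻ σ p X l = v p x h′ l′ (h i)

down-AllAny : ∀ σ Y X → AllAny σ Y X → down σ Y ⊆ down σ X
down-AllAny σ Y X h p (h′ , l) = h′ , AnyAll-trans σ p Y X l h

down-mono : ∀ σ X Y → (∀ {x} → x ∈ X → x ∈ Y) → down σ X ⊆ down σ Y
down-mono σ X Y h p (h′ , l) with x , i , l′ ← AnyLeq⁻ σ p X l = h′ , AnyLeq⁺ σ p (h i) l′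

-- Monotonicity and continuity

Mono : (Pred → Pred) → Set₁
Mono f = ∀ {d e} → d ⊆ e → f d ⊆ f e

⌊_⌋ : List Prm → Pred
⌊ X ⌋ p = p ∈ X

-- The approximants are bare lists, neither downward closed nor antichains; monotonicity makes up
-- the difference wherever an element is required.
Cont : (Pred → Pred) → Set₁
Cont f = ∀ d p → f d p → ∃ λ X → ⌊ X ⌋ ⊆ d × f ⌊ X ⌋ p

Pr-⊆ : ∀ {f g : Pred → Pred} σ → (∀ d → f d ⊆ g d) → Pr σ f ⊆ Pr σ g
Pr-⊆ σ h (fun X p) (u , v) = u , h _ p v

Mono-Pr : ∀ {f : Pred → Pred → Pred} σ → (∀ e → Mono (λ d → f d e)) → Mono (λ d → Pr σ (f d))
Mono-Pr σ h s = Pr-⊆ σ (λ e → h e s)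

Cont-Pr : ∀ {f : Pred → Pred → Pred} σ → (∀ e → Cont (λ d → f d e)) → Cont (λ d → Pr σ (f d))
Cont-Pr σ h d (fun X p) (u , v) with Y , s , w ← h (down σ X) d p v = Y , s , u , w

apS-⊆ : d ⊆ d′ → e ⊆ e′ → apS d e ⊆ apS d′ e′
apS-⊆ s t p (X , h , h′) = X , All.map (λ {x} → t x) h , s _ h′

⟦⟧-mono : ∀ M → (∀ i → η i ⊆ θ i) → ⟦ M ⟧ η ⊆ ⟦ M ⟧ θ
⟦⟧-mono (` i ∶ σ) s = s i
⟦⟧-mono (ƛ σ M) s = Pr-⊆ σ λ d → ⟦⟧-mono M λ { zero p → id ; (suc i) → s i }
⟦⟧-mono (M · N) s = apS-⊆ (⟦⟧-mono M s) (⟦⟧-mono N s)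
⟦⟧-mono (c0 a b) s p = id
⟦⟧-mono (c1 a b) s p = id
⟦⟧-mono (ccase a b c) s p = id
⟦⟧-mono (cpcase a b c) s p = id
⟦⟧-mono (cpair a b) s p = id
⟦⟧-mono (cfst a b) s p = id
⟦⟧-mono (csnd a b) s p = id
⟦⟧-mono (cΩ a) s p = id

⟦⟧-mono-∷ : ∀ M η → Mono (λ d → ⟦ M ⟧ (d ∷ₑ η))
⟦⟧-mono-∷ M η s = ⟦⟧-mono M λ { zero → s ; (suc i) p → id }

Support : REnv → (REnv → Set) → Set
Support η P = ∃ λ (F : ℕ → List Prm) → (∀ i → ⌊ F i ⌋ ⊆ η i) × P (λ i → ⌊ F i ⌋)

singleton : ℕ → Prm → ℕ → List Prm
singleton zero    p zero    = p ∷ []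
singleton zero    p (suc j) = []
singleton (suc i) p zero    = []
singleton (suc i) p (suc j) = singleton i p j

∈-singleton : ∀ i p → p ∈ singleton i p i
∈-singleton zero    p = here refl
∈-singleton (suc i) p = ∈-singleton i p

singleton⊆ : ∀ i p (η : REnv) → η i p → ∀ j → ⌊ singleton i p j ⌋ ⊆ η j
singleton⊆ zero    p η h zero q (here refl) = h
singleton⊆ (suc i) p η h (suc j) q k = singleton⊆ i p (η ∘ suc) h j q k

mutual
  -- Continuity in all variables at once. An abstraction forgets the support found for its bound
  -- variable, whose value `down σ X` is recorded in the prime itself.
  ⟦⟧-support : ∀ M η p → ⟦ M ⟧ η p → Support η (λ θ → ⟦ M ⟧ θ p)
  ⟦⟧-support (` i ∶ σ) η p h = singleton i p , singleton⊆ i p η h , ∈-singleton i p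
  ⟦⟧-support (ƛ σ M) η (fun X p) (u , h) with F , s , h′ ← ⟦⟧-support M _ p h =
    F ∘ suc , s ∘ suc , u , ⟦⟧-mono M (λ { zero → s zero ; (suc i) q → id }) p h′
  ⟦⟧-support (M · N) η p (X , h , h′)
    with F , s , u ← ⟦⟧-support M η _ h′ | G , t , v ← ⟦⟧-supportAll N η X h =
    (λ i → F i ++ G i) ,
    (λ i q k → case ∈-++⁻ (F i) k of λ { (inj₁ k) → s i q k ; (inj₂ k) → t i q k }) ,
    X , All.map (λ {x} → ⟦⟧-mono N (λ i q → ∈-++⁺ʳ (F i)) x) v ,
    ⟦⟧-mono M (λ i q → ∈-++⁺ˡ) _ u
  ⟦⟧-support (c0 a b) η p h = (λ _ → []) , (λ i p ()) , h
  ⟦⟧-support (c1 a b) η p h = (λ _ → []) , (λ i p ()) , h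
  ⟦⟧-support (ccase a b c) η p h = (λ _ → []) , (λ i p ()) , h
  ⟦⟧-support (cpcase a b c) η p h = (λ _ → []) , (λ i p ()) , h
  ⟦⟧-support (cpair a b) η p h = (λ _ → []) , (λ i p ()) , h
  ⟦⟧-support (cfst a b) η p h = (λ _ → []) , (λ i p ()) , h
  ⟦⟧-support (csnd a b) η p h = (λ _ → []) , (λ i p ()) , h

  ⟦⟧-supportAll : ∀ M η X → All (⟦ M ⟧ η) X → Support η (λ θ → All (⟦ M ⟧ θ) X)
  ⟦⟧-supportAll M η [] h = (λ _ → []) , (λ i p ()) , []
  ⟦⟧-supportAll M η (x ∷ X) (h ∷ h′)
    with F , s , u ← ⟦⟧-support M η x h | G , t , v ← ⟦⟧-supportAll M η X h′ =
    (λ i → F i ++ G i) ,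
    (λ i q k → case ∈-++⁻ (F i) k of λ { (inj₁ k) → s i q k ; (inj₂ k) → t i q k }) ,
    ⟦⟧-mono M (λ i q → ∈-++⁺ˡ) x u ∷ All.map (λ {x} → ⟦⟧-mono M (λ i q → ∈-++⁺ʳ (F i)) x) v

⟦⟧-cont-∷ : ∀ M η → Cont (λ d → ⟦ M ⟧ (d ∷ₑ η))
⟦⟧-cont-∷ M η d p h with F , s , h′ ← ⟦⟧-support M (d ∷ₑ η) p h =
  F zero , s zero , ⟦⟧-mono M (λ { zero q → id ; (suc i) → s (suc i) }) p h′

apS-Pr⁻ : ∀ {f : Pred → Pred} σ → Mono f → IsElem σ d → apS (Pr σ f) d ⊆ f d
apS-Pr⁻ σ m E p (X , h , _ , h′) = m (down⊆ σ X E (All.lookup h)) p h′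

-- Application consumes a `PrimeSet`, so the list given by continuity is first thinned to an
-- antichain; its downward closure still covers that list, and monotonicity does the rest.
apS-Pr⁺ : ∀ {f : Pred → Pred} σ → Mono f → Cont f → IsElem σ d → f d ⊆ apS (Pr σ f) d
apS-Pr⁺ {d = d} σ m c E@(u , _ , w) p h with X , s , h′ ← c d p h
  with Y , ps , sub , cov ← primeSet σ X (λ {x} i → u x (s x i)) (λ {x} {y} i j → w x y (s x i) (s y j)) =
  Y , All.tabulate (λ {y} i → s y (sub i)) , ps , m (λ q → cov) p h′

-- Elements

Valid : Ctxt → REnv → Set
Valid Γ η = ∀ {i σ} → Γ ∋ i ∶ σ → IsElem σ (η i)

Valid-∷ : IsElem σ d → Valid Γ η → Valid (σ ∷ Γ) (d ∷ₑ η)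
Valid-∷ E v here = E
Valid-∷ E v (there i) = v i

Valid-tail : Valid (σ ∷ Γ) η → Valid Γ (η ∘ suc)
Valid-tail v = v ∘ there

⊥-elem : ∀ σ → IsElem σ (λ _ → ⊥)
⊥-elem σ = (λ p ()) , (λ p q h l ()) , (λ p q ())

-- For consistency of `(X, p)` and `(Y, q)`: if `X` and `Y` are jointly consistent, then `p` and `q`
-- both lie in the single element `f (↓(X ++ Y))`.
Pr-elem : ∀ {f : Pred → Pred} σ τ → Mono f → (∀ d → IsElem σ d → IsElem τ (f d)) →
  IsElem (σ ⇒ τ) (Pr σ f)
Pr-elem {f} σ τ m E = prime , closed , consistent
  where
  prime : ∀ p → Pr σ f p → IsPrime (σ ⇒ τ) p
  prime (fun X p) (u , h) = u , proj₁ (E _ (down-primeSet σ X u)) p h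

  closed : ∀ p q → IsPrime (σ ⇒ τ) p → Leq (σ ⇒ τ) p q → Pr σ f q → Pr σ f p
  closed (fun X p) (fun Y q) (u , h) (l , l′) (v , h′) = u ,
    m (down-AllAny σ Y X l′) p (proj₁ (proj₂ (E _ (down-primeSet σ Y v))) p q h l h′)

  consistent : ∀ p q → Pr σ f p → Pr σ f q → Con (σ ⇒ τ) p q
  consistent (fun X p) (fun Y q) (u , h) (v , h′) = Con-fun⁺ σ τ X p Y q λ s t w →
    proj₂ (proj₂ (E _ (down-elem σ (X ++ Y) (ConAll-++ σ X Y s t w)))) p q
      (m (down-mono σ X (X ++ Y) ∈-++⁺ˡ) p h) (m (down-mono σ Y (X ++ Y) (∈-++⁺ʳ X)) q h′)

apS-elem : ∀ σ τ → IsElem (σ ⇒ τ) f → IsElem σ d → IsElem τ (apS f d)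
apS-elem σ τ (u , v , w) (_ , _ , w′) =
  (λ { p (X , h , h′) → proj₂ (u (fun X p) h′) }) ,
  (λ { p q hp l (X , h , h′) → let hX = proj₁ (u (fun X q) h′) in
       X , h , v (fun X p) (fun X q) (hX , hp) (l , AllAny-refl σ X X id (proj₁ hX)) h′ }) ,
  (λ { p q (X , h , h′) (Y , k , k′) → Con-fun⁻ σ τ X p Y q (w (fun X p) (fun Y q) h′ k′)
       (λ {x} {y} i j → w′ x y (All.lookup h i) (All.lookup h j))
       (λ {x} {y} i j → w′ x y (All.lookup h i) (All.lookup k j))
       (λ {x} {y} i j → w′ x y (All.lookup k i) (All.lookup k j)) })

inj0-elem : ∀ a b → IsElem a d → IsElem (a ⊕ b) (inj0 d)
inj0-elem {d} a b (u , v , w) = prime , closed , consistent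
  where
  prime : ∀ p → inj0 d p → IsPrime (a ⊕ b) p
  prime tag0 h = tt
  prime (in0 p) h = u p h

  closed : ∀ p q → IsPrime (a ⊕ b) p → Leq (a ⊕ b) p q → inj0 d q → inj0 d p
  closed tag0 tag0 _ _ _ = tt
  closed tag0 (in0 q) _ _ _ = tt
  closed (in0 p) (in0 q) hp l h = v p q hp l h

  consistent : ∀ p q → inj0 d p → inj0 d q → Con (a ⊕ b) p q
  consistent tag0 tag0 _ _ = tt
  consistent tag0 (in0 q) _ _ = tt
  consistent (in0 p) tag0 _ _ = tt
  consistent (in0 p) (in0 q) h h′ = w p q h h′

inj1-elem : ∀ a b → IsElem b d → IsElem (a ⊕ b) (inj1 d)
inj1-elem {d} a b (u , v , w) = prime , closed , consistent
  where
  prime : ∀ p → inj1 d p → IsPrime (a ⊕ b) p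
  prime tag1 h = tt
  prime (in1 p) h = u p h

  closed : ∀ p q → IsPrime (a ⊕ b) p → Leq (a ⊕ b) p q → inj1 d q → inj1 d p
  closed tag1 tag1 _ _ _ = tt
  closed tag1 (in1 q) _ _ _ = tt
  closed (in1 p) (in1 q) hp l h = v p q hp l h

  consistent : ∀ p q → inj1 d p → inj1 d q → Con (a ⊕ b) p q
  consistent tag1 tag1 _ _ = tt
  consistent tag1 (in1 q) _ _ = tt
  consistent (in1 p) tag1 _ _ = tt
  consistent (in1 p) (in1 q) h h′ = w p q h h′

out0-elem : ∀ a b → IsElem (a ⊕ b) d → IsElem a (λ p → d (in0 p))
out0-elem a b (u , v , w) =
  (λ p → u (in0 p)) , (λ p q → v (in0 p) (in0 q)) , (λ p q → w (in0 p) (in0 q))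

out1-elem : ∀ a b → IsElem (a ⊕ b) d → IsElem b (λ p → d (in1 p))
out1-elem a b (u , v , w) =
  (λ p → u (in1 p)) , (λ p q → v (in1 p) (in1 q)) , (λ p q → w (in1 p) (in1 q))

tags-disjoint : ∀ a b → IsElem (a ⊕ b) d → d tag0 → d tag1 → ⊥
tags-disjoint a b (_ , _ , w) h h′ = w tag0 tag1 h h′

caseS-elem : ∀ a b c → IsElem (a ⊕ b) e → IsElem (a ⇒ c) f → IsElem (b ⇒ c) g →
  IsElem c (caseS e f g)
caseS-elem a b c E F G
  with u , v , w ← apS-elem a c F (out0-elem a b E)
     | u′ , v′ , w′ ← apS-elem b c G (out1-elem a b E) =
  (λ { p (inj₁ (_ , h)) → u p h ; p (inj₂ (_ , h)) → u′ p h }) ,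
  (λ { p q hp l (inj₁ (t , h)) → inj₁ (t , v p q hp l h)
     ; p q hp l (inj₂ (t , h)) → inj₂ (t , v′ p q hp l h) }) ,
  (λ { p q (inj₁ (_ , h)) (inj₁ (_ , h′)) → w p q h h′
     ; p q (inj₁ (t , h)) (inj₂ (t′ , h′)) → ⊥-elim (tags-disjoint a b E t t′)
     ; p q (inj₂ (t , h)) (inj₁ (t′ , h′)) → ⊥-elim (tags-disjoint a b E t′ t)
     ; p q (inj₂ (_ , h)) (inj₂ (_ , h′)) → w′ p q h h′ })

-- Any two ways for primes to enter the result share one branch, whose consistency applies. The
-- exception pairs `tag0` with `tag1`, which an element cannot both contain.
pcaseS-elem : ∀ a b c → IsElem (a ⊕ b) e → IsElem c f → IsElem c g → IsElem c (pcaseS e f g)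
pcaseS-elem a b c E (u , v , w) (u′ , v′ , w′) =
  (λ { p (inj₁ (_ , h)) → u p h
     ; p (inj₂ (inj₁ (_ , h))) → u′ p h
     ; p (inj₂ (inj₂ (h , _))) → u p h }) ,
  (λ { p q hp l (inj₁ (t , h)) → inj₁ (t , v p q hp l h)
     ; p q hp l (inj₂ (inj₁ (t , h))) → inj₂ (inj₁ (t , v′ p q hp l h))
     ; p q hp l (inj₂ (inj₂ (h , h′))) → inj₂ (inj₂ (v p q hp l h , v′ p q hp l h′)) }) ,
  (λ { p q (inj₁ (_ , h)) (inj₁ (_ , h′)) → w p q h h′
     ; p q (inj₁ (t , _)) (inj₂ (inj₁ (t′ , _))) → ⊥-elim (tags-disjoint a b E t t′)
     ; p q (inj₁ (_ , h)) (inj₂ (inj₂ (h′ , _))) → w p q h h′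
     ; p q (inj₂ (inj₁ (t , _))) (inj₁ (t′ , _)) → ⊥-elim (tags-disjoint a b E t′ t)
     ; p q (inj₂ (inj₁ (_ , h))) (inj₂ (inj₁ (_ , h′))) → w′ p q h h′
     ; p q (inj₂ (inj₁ (_ , h))) (inj₂ (inj₂ (_ , h′))) → w′ p q h h′
     ; p q (inj₂ (inj₂ (h , _))) (inj₁ (_ , h′)) → w p q h h′
     ; p q (inj₂ (inj₂ (_ , h))) (inj₂ (inj₁ (_ , h′))) → w′ p q h h′
     ; p q (inj₂ (inj₂ (h , _))) (inj₂ (inj₂ (h′ , _))) → w p q h h′ })

pairS-elem : ∀ a b → IsElem a d → IsElem b e → IsElem (a ⊗ b) (pairS d e)
pairS-elem {d} {e} a b (u , v , w) (u′ , v′ , w′) = prime , closed , consistent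
  where
  prime : ∀ p → pairS d e p → IsPrime (a ⊗ b) p
  prime (pr0 p) h = u p h
  prime (pr1 p) h = u′ p h

  closed : ∀ p q → IsPrime (a ⊗ b) p → Leq (a ⊗ b) p q → pairS d e q → pairS d e p
  closed (pr0 p) (pr0 q) = v p q
  closed (pr1 p) (pr1 q) = v′ p q

  consistent : ∀ p q → pairS d e p → pairS d e q → Con (a ⊗ b) p q
  consistent (pr0 p) (pr0 q) h h′ = w p q h h′
  consistent (pr0 p) (pr1 q) h h′ = tt
  consistent (pr1 p) (pr0 q) h h′ = tt
  consistent (pr1 p) (pr1 q) h h′ = w′ p q h h′

fstS-elem : ∀ a b → IsElem (a ⊗ b) d → IsElem a (fstS d)
fstS-elem a b (u , v , w) =
  (λ p → u (pr0 p)) , (λ p q → v (pr0 p) (pr0 q)) , (λ p q → w (pr0 p) (pr0 q))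

sndS-elem : ∀ a b → IsElem (a ⊗ b) d → IsElem b (sndS d)
sndS-elem a b (u , v , w) =
  (λ p → u (pr1 p)) , (λ p q → v (pr1 p) (pr1 q)) , (λ p q → w (pr1 p) (pr1 q))

inj0-mono : Mono inj0
inj0-mono s tag0 h = h
inj0-mono s (in0 p) h = s p h

inj1-mono : Mono inj1
inj1-mono s tag1 h = h
inj1-mono s (in1 p) h = s p h

caseS-⊆ : d ⊆ d′ → e ⊆ e′ → f ⊆ g → caseS d e f ⊆ caseS d′ e′ g
caseS-⊆ s t u p (inj₁ (h , h′)) = inj₁ (s tag0 h , apS-⊆ t (λ q → s (in0 q)) p h′)
caseS-⊆ s t u p (inj₂ (h , h′)) = inj₂ (s tag1 h , apS-⊆ u (λ q → s (in1 q)) p h′)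

pcaseS-⊆ : d ⊆ d′ → e ⊆ e′ → f ⊆ g → pcaseS d e f ⊆ pcaseS d′ e′ g
pcaseS-⊆ s t u p (inj₁ (h , h′)) = inj₁ (s tag0 h , t p h′)
pcaseS-⊆ s t u p (inj₂ (inj₁ (h , h′))) = inj₂ (inj₁ (s tag1 h , u p h′))
pcaseS-⊆ s t u p (inj₂ (inj₂ (h , h′))) = inj₂ (inj₂ (t p h , u p h′))

pairS-⊆ : d ⊆ d′ → e ⊆ e′ → pairS d e ⊆ pairS d′ e′
pairS-⊆ s t (pr0 p) h = s p h
pairS-⊆ s t (pr1 p) h = t p h

⊆-refl : d ⊆ d
⊆-refl p h = h

module PCase (a b c : Type) where
  mono₃ : ∀ d e → Mono (pcaseS d e)
  mono₃ d e s = pcaseS-⊆ {d} {d} {e} {e} ⊆-refl ⊆-refl s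

  mono₂ : ∀ d → Mono (λ e → Pr c (pcaseS d e))
  mono₂ d = Mono-Pr c λ f {e} s → pcaseS-⊆ {d} {d} {f = f} {g = f} ⊆-refl s ⊆-refl

  mono₁ : Mono (λ d → Pr c λ e → Pr c (pcaseS d e))
  mono₁ = Mono-Pr c λ e → Mono-Pr c λ f s → pcaseS-⊆ {e = e} {e} {f} {f} s ⊆-refl ⊆-refl

  elem : IsElem ((a ⊕ b) ⇒ c ⇒ c ⇒ c) (Pr (a ⊕ b) λ d → Pr c λ e → Pr c (pcaseS d e))
  elem = Pr-elem (a ⊕ b) _ mono₁ λ d D → Pr-elem c _ (mono₂ d) λ e E →
    Pr-elem c _ (mono₃ d e) λ f F → pcaseS-elem a b c D E F

  cont₃ : ∀ d e → Cont (pcaseS d e)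
  cont₃ d e f p (inj₁ h) = [] , (λ q ()) , inj₁ h
  cont₃ d e f p (inj₂ (inj₁ (t , h))) =
    p ∷ [] , (λ { q (here refl) → h }) , inj₂ (inj₁ (t , here refl))
  cont₃ d e f p (inj₂ (inj₂ (t , h))) =
    p ∷ [] , (λ { q (here refl) → h }) , inj₂ (inj₂ (t , here refl))

  cont₂ : ∀ d → Cont (λ e → Pr c (pcaseS d e))
  cont₂ d = Cont-Pr c λ
    { f e p (inj₁ (t , h)) → p ∷ [] , (λ { q (here refl) → h }) , inj₁ (t , here refl)
    ; f e p (inj₂ (inj₁ h)) → [] , (λ q ()) , inj₂ (inj₁ h)
    ; f e p (inj₂ (inj₂ (h , t))) → p ∷ [] , (λ { q (here refl) → h }) , inj₂ (inj₂ (here refl , t)) }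

  cont₁ : Cont (λ d → Pr c λ e → Pr c (pcaseS d e))
  cont₁ = Cont-Pr c λ e → Cont-Pr c λ
    { f d p (inj₁ (h , t)) → tag0 ∷ [] , (λ { q (here refl) → h }) , inj₁ (here refl , t)
    ; f d p (inj₂ (inj₁ (h , t))) → tag1 ∷ [] , (λ { q (here refl) → h }) , inj₂ (inj₁ (here refl , t))
    ; f d p (inj₂ (inj₂ h)) → [] , (λ q ()) , inj₂ (inj₂ h) }

module Case (a b c : Type) where
  mono₃ : ∀ d e → Mono (caseS d e)
  mono₃ d e s = caseS-⊆ {d} {d} {e} {e} ⊆-refl ⊆-refl s

  mono₂ : ∀ d → Mono (λ e → Pr (b ⇒ c) (caseS d e))
  mono₂ d = Mono-Pr (b ⇒ c) λ f {e} s → caseS-⊆ {d} {d} {f = f} {g = f} ⊆-refl s ⊆-refl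

  mono₁ : Mono (λ d → Pr (a ⇒ c) λ e → Pr (b ⇒ c) (caseS d e))
  mono₁ = Mono-Pr (a ⇒ c) λ e → Mono-Pr (b ⇒ c) λ f s → caseS-⊆ {e = e} {e} {f} {f} s ⊆-refl ⊆-refl

  elem : IsElem ((a ⊕ b) ⇒ (a ⇒ c) ⇒ (b ⇒ c) ⇒ c)
    (Pr (a ⊕ b) λ d → Pr (a ⇒ c) λ e → Pr (b ⇒ c) (caseS d e))
  elem = Pr-elem (a ⊕ b) _ mono₁ λ d D → Pr-elem (a ⇒ c) _ (mono₂ d) λ e E →
    Pr-elem (b ⇒ c) _ (mono₃ d e) λ f F → caseS-elem a b c D E F

  cont₃ : ∀ d e → Cont (caseS d e)
  cont₃ d e f p (inj₁ h) = [] , (λ q ()) , inj₁ h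
  cont₃ d e f p (inj₂ (t , X , h , h′)) =
    fun X p ∷ [] , (λ { q (here refl) → h′ }) , inj₂ (t , X , h , here refl)

  cont₂ : ∀ d → Cont (λ e → Pr (b ⇒ c) (caseS d e))
  cont₂ d = Cont-Pr (b ⇒ c) λ
    { f e p (inj₁ (t , X , h , h′)) →
        fun X p ∷ [] , (λ { q (here refl) → h′ }) , inj₁ (t , X , h , here refl)
    ; f e p (inj₂ h) → [] , (λ q ()) , inj₂ h }

  cont₁ : Cont (λ d → Pr (a ⇒ c) λ e → Pr (b ⇒ c) (caseS d e))
  cont₁ = Cont-Pr (a ⇒ c) λ e → Cont-Pr (b ⇒ c) λ
    { f d p (inj₁ (t , X , h , h′)) → tag0 ∷ map in0 X ,
        (λ { q (here refl) → t
           ; q (there i) → case ∈-map⁻ in0 i of λ { (x , j , refl) → All.lookup h j } }) ,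
        inj₁ (here refl , X , All.tabulate (λ i → there (∈-map⁺ in0 i)) , h′)
    ; f d p (inj₂ (t , X , h , h′)) → tag1 ∷ map in1 X ,
        (λ { q (here refl) → t
           ; q (there i) → case ∈-map⁻ in1 i of λ { (x , j , refl) → All.lookup h j } }) ,
        inj₂ (here refl , X , All.tabulate (λ i → there (∈-map⁺ in1 i)) , h′) }

module Pair (a b : Type) where
  mono₂ : ∀ d → Mono (pairS d)
  mono₂ d s = pairS-⊆ {d} {d} ⊆-refl s

  mono₁ : Mono (λ d → Pr b (pairS d))
  mono₁ = Mono-Pr b λ e s → pairS-⊆ {e = e} {e} s ⊆-refl

  elem : IsElem (a ⇒ b ⇒ a ⊗ b) (Pr a λ d → Pr b (pairS d))
  elem = Pr-elem a _ mono₁ λ d D → Pr-elem b _ (mono₂ d) λ e E → pairS-elem a b D E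

  cont₂ : ∀ d → Cont (pairS d)
  cont₂ d e (pr0 p) h = [] , (λ q ()) , h
  cont₂ d e (pr1 p) h = p ∷ [] , (λ { q (here refl) → h }) , here refl

  cont₁ : Cont (λ d → Pr b (pairS d))
  cont₁ = Cont-Pr b left
    where
    left : ∀ e → Cont (λ d → pairS d e)
    left e d (pr0 p) h = p ∷ [] , (λ { q (here refl) → h }) , here refl
    left e d (pr1 p) h = [] , (λ q ()) , h

fstS-mono : Mono fstS
fstS-mono s p = s (pr0 p)

sndS-mono : Mono sndS
sndS-mono s p = s (pr1 p)

⟦⟧-elem : Γ ⊢ M ∶ σ → Valid Γ η → IsElem σ (⟦ M ⟧ η)
⟦⟧-elem (tvar i) v = v i
⟦⟧-elem {η = η} (tlam {σ = σ} {τ} {M} h) v =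
  Pr-elem σ τ (⟦⟧-mono-∷ M η) λ d D → ⟦⟧-elem h (Valid-∷ D v)
⟦⟧-elem (tapp {σ = σ} {τ} h h′) v = apS-elem σ τ (⟦⟧-elem h v) (⟦⟧-elem h′ v)
⟦⟧-elem (tc0 {σ = a} {b}) v = Pr-elem a (a ⊕ b) inj0-mono λ d → inj0-elem a b
⟦⟧-elem (tc1 {σ = a} {b}) v = Pr-elem b (a ⊕ b) inj1-mono λ d → inj1-elem a b
⟦⟧-elem (tcase {σ = a} {b} {c}) v = Case.elem a b c
⟦⟧-elem (tpcase {σ = a} {b} {c}) v = PCase.elem a b c
⟦⟧-elem (tpair {σ = a} {b}) v = Pair.elem a b
⟦⟧-elem (tfst {σ = a} {b}) v = Pr-elem (a ⊗ b) a fstS-mono λ d → fstS-elem a b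
⟦⟧-elem (tsnd {σ = a} {b}) v = Pr-elem (a ⊗ b) b sndS-mono λ d → sndS-elem a b
⟦⟧-elem (tΩ {σ = σ}) v = ⊥-elem σ
⟦⟧-elem (tconv h e) v = IsElem-≈ e (⟦⟧-elem h v)

-- Saturated applications of the constants

infix 4 _≐_
_≐_ : Pred → Pred → Set
d ≐ e = d ⊆ e × e ⊆ d

≐-refl : d ≐ d
≐-refl = ⊆-refl , ⊆-refl

≐-trans : d ≐ e → e ≐ f → d ≐ f
≐-trans (s , t) (s′ , t′) = (λ p → s′ p ∘ s p) , (λ p → t p ∘ t′ p)

apS-cong : d ≐ d′ → e ≐ e′ → apS d e ≐ apS d′ e′
apS-cong (s , t) (s′ , t′) = apS-⊆ s s′ , apS-⊆ t t′

apS-Pr : ∀ {f : Pred → Pred} σ → Mono f → Cont f → IsElem σ d → apS (Pr σ f) d ≐ f d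
apS-Pr σ m c E = apS-Pr⁻ σ m E , apS-Pr⁺ σ m c E

apS-inj0 : ∀ a → IsElem a d → apS (Pr a inj0) d ≐ inj0 d
apS-inj0 a = apS-Pr a inj0-mono cont
  where
  cont : Cont inj0
  cont d tag0 h = [] , (λ q ()) , tt
  cont d (in0 p) h = p ∷ [] , (λ { q (here refl) → h }) , here refl

apS-inj1 : ∀ b → IsElem b d → apS (Pr b inj1) d ≐ inj1 d
apS-inj1 b = apS-Pr b inj1-mono cont
  where
  cont : Cont inj1
  cont d tag1 h = [] , (λ q ()) , tt
  cont d (in1 p) h = p ∷ [] , (λ { q (here refl) → h }) , here refl

apS-fst : ∀ a b → IsElem (a ⊗ b) d → apS (Pr (a ⊗ b) fstS) d ≐ fstS d
apS-fst a b = apS-Pr (a ⊗ b) fstS-mono λ d p h →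
  pr0 p ∷ [] , (λ { q (here refl) → h }) , here refl

apS-snd : ∀ a b → IsElem (a ⊗ b) d → apS (Pr (a ⊗ b) sndS) d ≐ sndS d
apS-snd a b = apS-Pr (a ⊗ b) sndS-mono λ d p h →
  pr1 p ∷ [] , (λ { q (here refl) → h }) , here refl

apS-pair : ∀ a b → IsElem a d → IsElem b e → apS (apS (Pr a λ d → Pr b (pairS d)) d) e ≐ pairS d e
apS-pair {d} a b D E = ≐-trans (apS-cong (apS-Pr a mono₁ cont₁ D) ≐-refl)
  (apS-Pr b (mono₂ d) (cont₂ d) E)
  where open Pair a b

apS-pcase : ∀ a b c → IsElem (a ⊕ b) d → IsElem c e → IsElem c f →
  apS (apS (apS (Pr (a ⊕ b) λ d → Pr c λ e → Pr c (pcaseS d e)) d) e) f ≐ pcaseS d e f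
apS-pcase {d} {e} a b c D E F =
  ≐-trans (apS-cong (apS-cong (apS-Pr (a ⊕ b) mono₁ cont₁ D) ≐-refl) ≐-refl)
  (≐-trans (apS-cong (apS-Pr c (mono₂ d) (cont₂ d) E) ≐-refl)
  (apS-Pr c (mono₃ d e) (cont₃ d e) F))
  where open PCase a b c

apS-case : ∀ a b c → IsElem (a ⊕ b) d → IsElem (a ⇒ c) e → IsElem (b ⇒ c) f →
  apS (apS (apS (Pr (a ⊕ b) λ d → Pr (a ⇒ c) λ e → Pr (b ⇒ c) (caseS d e)) d) e) f ≐ caseS d e f
apS-case {d} {e} a b c D E F =
  ≐-trans (apS-cong (apS-cong (apS-Pr (a ⊕ b) mono₁ cont₁ D) ≐-refl) ≐-refl)
  (≐-trans (apS-cong (apS-Pr (a ⇒ c) (mono₂ d) (cont₂ d) E) ≐-refl)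
  (apS-Pr (b ⇒ c) (mono₃ d e) (cont₃ d e) F))
  where open Case a b c

apS-ƛ : ∀ M η → IsElem σ d → apS (⟦ ƛ σ M ⟧ η) d ≐ ⟦ M ⟧ (d ∷ₑ η)
apS-ƛ {σ} M η = apS-Pr σ (⟦⟧-mono-∷ M η) (⟦⟧-cont-∷ M η)

-- Typing

type-unique : Γ ⊢ M ∶ σ → Γ ⊢ M ∶ τ → σ ≈ τ
type-unique h (tconv h′ e) = ≈-trans (type-unique h h′) e
type-unique (tconv h e) h′ = ≈-trans (≈-sym e) (type-unique h h′)
type-unique (tvar i) (tvar j) n = refl
type-unique (tlam h) (tlam h′) = ⇒-cong ≈-refl (type-unique h h′)
type-unique (tapp h _) (tapp h′ _) = proj₂ (⇒-inj (type-unique h h′))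
type-unique tc0 tc0 n = refl
type-unique tc1 tc1 n = refl
type-unique tcase tcase n = refl
type-unique tpcase tpcase n = refl
type-unique tpair tpair n = refl
type-unique tfst tfst n = refl
type-unique tsnd tsnd n = refl
type-unique tΩ tΩ n = refl

app-inv : Γ ⊢ M · N ∶ τ → ∃ λ σ → Γ ⊢ M ∶ σ ⇒ τ × Γ ⊢ N ∶ σ
app-inv (tapp h h′) = _ , h , h′
app-inv (tconv h e) with σ , h₁ , h₂ ← app-inv h = σ , tconv h₁ (⇒-cong ≈-refl e) , h₂

lam-inv : Γ ⊢ ƛ σ M ∶ ρ → ∃ λ τ → (σ ∷ Γ) ⊢ M ∶ τ × σ ⇒ τ ≈ ρ
lam-inv (tlam h) = _ , h , ≈-refl
lam-inv (tconv h e) with τ , h′ , e′ ← lam-inv h = τ , h′ , ≈-trans e′ e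

var-inv : ∀ {i} → Γ ⊢ ` i ∶ σ ∶ τ → Γ ∋ i ∶ σ
var-inv (tvar i) = i
var-inv (tconv h e) = var-inv h

-- Uniqueness of types up to `≈` identifies the argument type hidden in the application with the
-- annotated one. The inversions for the constants are instances.
app-inv-at : Γ ⊢ M ∶ a ⇒ b → Γ ⊢ M · N ∶ τ → Γ ⊢ N ∶ a × b ≈ τ
app-inv-at h h′ with _ , h₁ , h₂ ← app-inv h′ with e , f ← ⇒-inj (type-unique h h₁) =
  tconv h₂ (≈-sym e) , f

c0-inv : Γ ⊢ c0 a b · M ∶ τ → Γ ⊢ M ∶ a × a ⊕ b ≈ τ
c0-inv = app-inv-at tc0

c1-inv : Γ ⊢ c1 a b · M ∶ τ → Γ ⊢ M ∶ b × a ⊕ b ≈ τ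
c1-inv = app-inv-at tc1

fst-inv : Γ ⊢ cfst a b · M ∶ τ → Γ ⊢ M ∶ a ⊗ b × a ≈ τ
fst-inv = app-inv-at tfst

snd-inv : Γ ⊢ csnd a b · M ∶ τ → Γ ⊢ M ∶ a ⊗ b × b ≈ τ
snd-inv = app-inv-at tsnd

pair-inv : ∀ {x y} → Γ ⊢ cpair a b · x · y ∶ τ → Γ ⊢ x ∶ a × Γ ⊢ y ∶ b × a ⊗ b ≈ τ
pair-inv h with _ , h′ , _ ← app-inv h with hx , _ ← app-inv-at tpair h′
  with hy , e ← app-inv-at (tapp tpair hx) h = hx , hy , e

pcase-inv : ∀ {x y z} → Γ ⊢ cpcase a b c · x · y · z ∶ τ →
  Γ ⊢ x ∶ a ⊕ b × Γ ⊢ y ∶ c × Γ ⊢ z ∶ c × c ≈ τ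
pcase-inv h with _ , h′ , _ ← app-inv h with _ , h″ , _ ← app-inv h′
  with hx , _ ← app-inv-at tpcase h″ with hy , _ ← app-inv-at (tapp tpcase hx) h′
  with hz , e ← app-inv-at (tapp (tapp tpcase hx) hy) h = hx , hy , hz , e

case-inv : ∀ {x y z} → Γ ⊢ ccase a b c · x · y · z ∶ τ →
  Γ ⊢ x ∶ a ⊕ b × Γ ⊢ y ∶ a ⇒ c × Γ ⊢ z ∶ b ⇒ c × c ≈ τ
case-inv h with _ , h′ , _ ← app-inv h with _ , h″ , _ ← app-inv h′
  with hx , _ ← app-inv-at tcase h″ with hy , _ ← app-inv-at (tapp tcase hx) h′
  with hz , e ← app-inv-at (tapp (tapp tcase hx) hy) h = hx , hy , hz , e

liftᵣ-∋ : ∀ {r} → (∀ {i σ} → Γ ∋ i ∶ σ → Δ ∋ r i ∶ σ) →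
  ∀ {i σ} → (τ ∷ Γ) ∋ i ∶ σ → (τ ∷ Δ) ∋ liftᵣ r i ∶ σ
liftᵣ-∋ h here = here
liftᵣ-∋ h (there i) = there (h i)

ren-⊢ : ∀ {r} → (∀ {i σ} → Γ ∋ i ∶ σ → Δ ∋ r i ∶ σ) → Γ ⊢ M ∶ τ → Δ ⊢ ren r M ∶ τ
ren-⊢ r (tvar i) = tvar (r i)
ren-⊢ r (tlam h) = tlam (ren-⊢ (liftᵣ-∋ r) h)
ren-⊢ r (tapp h h′) = tapp (ren-⊢ r h) (ren-⊢ r h′)
ren-⊢ r tc0 = tc0
ren-⊢ r tc1 = tc1
ren-⊢ r tcase = tcase
ren-⊢ r tpcase = tpcase
ren-⊢ r tpair = tpair
ren-⊢ r tfst = tfst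
ren-⊢ r tsnd = tsnd
ren-⊢ r tΩ = tΩ
ren-⊢ r (tconv h e) = tconv (ren-⊢ r h) e

sub-⊢ : ∀ {s} → (∀ {i σ} → Γ ∋ i ∶ σ → Δ ⊢ s i σ ∶ σ) → Γ ⊢ M ∶ τ → Δ ⊢ sub s M ∶ τ
sub-⊢ s (tvar i) = s i
sub-⊢ s (tlam h) = tlam (sub-⊢ (λ { here → tvar here ; (there i) → ren-⊢ there (s i) }) h)
sub-⊢ s (tapp h h′) = tapp (sub-⊢ s h) (sub-⊢ s h′)
sub-⊢ s tc0 = tc0
sub-⊢ s tc1 = tc1
sub-⊢ s tcase = tcase
sub-⊢ s tpcase = tpcase
sub-⊢ s tpair = tpair
sub-⊢ s tfst = tfst
sub-⊢ s tsnd = tsnd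
sub-⊢ s tΩ = tΩ
sub-⊢ s (tconv h e) = tconv (sub-⊢ s h) e

-- The annotations inside a redex match only up to `≈`; injectivity of the type constructors
-- supplies the conversions for its pieces.
subject-reduction : M ⟶ M′ → Γ ⊢ M ∶ τ → Γ ⊢ M′ ∶ τ
subject-reduction β h with _ , h₁ , h₂ ← app-inv h with _ , h₃ , e ← lam-inv h₁
  with e₁ , e₂ ← ⇒-inj e =
  tconv (sub-⊢ (λ { here → tconv h₂ (≈-sym e₁) ; (there i) → tvar i }) h₃) e₂
subject-reduction case0 h with hx , hy , hz , e ← case-inv h with hx′ , e′ ← c0-inv hx =
  tconv (tapp hy (tconv hx′ (proj₁ (⊕-inj e′)))) e
subject-reduction case1 h with hx , hy , hz , e ← case-inv h with hx′ , e′ ← c1-inv hx =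
  tconv (tapp hz (tconv hx′ (proj₂ (⊕-inj e′)))) e
subject-reduction fstβ h with h′ , e ← fst-inv h with hx , hy , e′ ← pair-inv h′ =
  tconv hx (≈-trans (proj₁ (⊗-inj e′)) e)
subject-reduction sndβ h with h′ , e ← snd-inv h with hx , hy , e′ ← pair-inv h′ =
  tconv hy (≈-trans (proj₂ (⊗-inj e′)) e)
subject-reduction pcase0 h with hx , hy , hz , e ← pcase-inv h = tconv hy e
subject-reduction pcase1 h with hx , hy , hz , e ← pcase-inv h = tconv hz e
subject-reduction pcase00 h with hx , hy , hz , e ← pcase-inv h
  with hy′ , e₁ ← c0-inv hy | hz′ , e₂ ← c0-inv hz =
  tconv (tapp tc0 (tapp (tapp (tapp tpcase hx) hy′)
    (tconv hz′ (proj₁ (⊕-inj (≈-trans e₂ (≈-sym e₁))))))) (≈-trans e₁ e)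
subject-reduction pcase11 h with hx , hy , hz , e ← pcase-inv h
  with hy′ , e₁ ← c1-inv hy | hz′ , e₂ ← c1-inv hz =
  tconv (tapp tc1 (tapp (tapp (tapp tpcase hx) hy′)
    (tconv hz′ (proj₂ (⊕-inj (≈-trans e₂ (≈-sym e₁))))))) (≈-trans e₁ e)
subject-reduction pcasePair h with hx , hy , hz , e ← pcase-inv h
  with hy₁ , hy₂ , e₁ ← pair-inv hy | hz₁ , hz₂ , e₂ ← pair-inv hz
  with e₃ , e₄ ← ⊗-inj (≈-trans e₂ (≈-sym e₁)) =
  tconv (tapp (tapp tpair (tapp (tapp (tapp tpcase hx) hy₁) (tconv hz₁ e₃)))
    (tapp (tapp (tapp tpcase hx) hy₂) (tconv hz₂ e₄))) (≈-trans e₁ e)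
subject-reduction (pcaseApp eq) h with _ , h₁ , hw ← app-inv h with hx , hy , hz , e ← pcase-inv h₁
  with e₁ , e₂ ← ⇒-inj (≈-trans (≈-sym (head≡⇒≈ eq)) e) =
  tconv (tapp (tapp (tapp tpcase hx)
    (tapp (tconv hy (head≡⇒≈ eq)) (tconv hw (≈-sym e₁))))
    (tapp (tconv hz (head≡⇒≈ eq)) (tconv hw (≈-sym e₁)))) e₂
subject-reduction (appL s) h with _ , h₁ , h₂ ← app-inv h = tapp (subject-reduction s h₁) h₂
subject-reduction (appR s) h with _ , h₁ , h₂ ← app-inv h = tapp h₁ (subject-reduction s h₂)
subject-reduction (lamξ s) h with _ , h′ , e ← lam-inv h = tconv (tlam (subject-reduction s h′)) e

subject-reduction* : M ⟶* M′ → Γ ⊢ M ∶ τ → Γ ⊢ M′ ∶ τ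
subject-reduction* ε* h = h
subject-reduction* (s ◅ ss) h = subject-reduction* ss (subject-reduction s h)

appL* : M ⟶* M′ → M · N ⟶* M′ · N
appL* ε* = ε*
appL* (s ◅ ss) = appL s ◅ appL* ss

appR* : N ⟶* M′ → M · N ⟶* M · M′
appR* ε* = ε*
appR* (s ◅ ss) = appR s ◅ appR* ss

-- Substitution

sub-id : ∀ {s} M → (∀ i σ → s i σ ≡ ` i ∶ σ) → sub s M ≡ M
sub-id (` i ∶ σ) h = h i σ
sub-id (ƛ σ M) h = cong (ƛ σ) (sub-id M λ { zero σ → refl ; (suc i) σ → cong (ren suc) (h i σ) })
sub-id (M · N) h = cong₂ _·_ (sub-id M h) (sub-id N h)
sub-id (c0 a b) h = refl
sub-id (c1 a b) h = refl
sub-id (ccase a b c) h = refl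
sub-id (cpcase a b c) h = refl
sub-id (cpair a b) h = refl
sub-id (cfst a b) h = refl
sub-id (csnd a b) h = refl
sub-id (cΩ a) h = refl

ren-ren : ∀ {r r′ r″} M → (∀ i → r′ (r i) ≡ r″ i) → ren r′ (ren r M) ≡ ren r″ M
ren-ren (` i ∶ σ) h = cong (`_∶ σ) (h i)
ren-ren (ƛ σ M) h = cong (ƛ σ) (ren-ren M λ { zero → refl ; (suc i) → cong suc (h i) })
ren-ren (M · N) h = cong₂ _·_ (ren-ren M h) (ren-ren N h)
ren-ren (c0 a b) h = refl
ren-ren (c1 a b) h = refl
ren-ren (ccase a b c) h = refl
ren-ren (cpcase a b c) h = refl
ren-ren (cpair a b) h = refl
ren-ren (cfst a b) h = refl
ren-ren (csnd a b) h = refl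
ren-ren (cΩ a) h = refl

sub-ren : ∀ {r s t} M → (∀ i σ → s (r i) σ ≡ t i σ) → sub s (ren r M) ≡ sub t M
sub-ren (` i ∶ σ) h = h i σ
sub-ren (ƛ σ M) h = cong (ƛ σ) (sub-ren M λ { zero σ → refl ; (suc i) σ → cong (ren suc) (h i σ) })
sub-ren (M · N) h = cong₂ _·_ (sub-ren M h) (sub-ren N h)
sub-ren (c0 a b) h = refl
sub-ren (c1 a b) h = refl
sub-ren (ccase a b c) h = refl
sub-ren (cpcase a b c) h = refl
sub-ren (cpair a b) h = refl
sub-ren (cfst a b) h = refl
sub-ren (csnd a b) h = refl
sub-ren (cΩ a) h = refl

ren-sub : ∀ {r s t} M → (∀ i σ → ren r (s i σ) ≡ t i σ) → ren r (sub s M) ≡ sub t M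
ren-sub (` i ∶ σ) h = h i σ
ren-sub {r} {s} {t} (ƛ σ M) h = cong (ƛ σ) (ren-sub M λ
  { zero σ → refl
  ; (suc i) σ → trans (ren-ren (s i σ) λ _ → refl)
      (trans (sym (ren-ren (s i σ) λ _ → refl)) (cong (ren suc) (h i σ))) })
ren-sub (M · N) h = cong₂ _·_ (ren-sub M h) (ren-sub N h)
ren-sub (c0 a b) h = refl
ren-sub (c1 a b) h = refl
ren-sub (ccase a b c) h = refl
ren-sub (cpcase a b c) h = refl
ren-sub (cpair a b) h = refl
ren-sub (cfst a b) h = refl
ren-sub (csnd a b) h = refl
ren-sub (cΩ a) h = refl

sub-sub : ∀ {s t u} M → (∀ i σ → sub t (s i σ) ≡ u i σ) → sub t (sub s M) ≡ sub u M
sub-sub (` i ∶ σ) h = h i σ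
sub-sub {s} {t} {u} (ƛ σ M) h = cong (ƛ σ) (sub-sub M λ
  { zero σ → refl
  ; (suc i) σ → trans (sub-ren (s i σ) λ _ _ → refl)
      (trans (sym (ren-sub (s i σ) λ _ _ → refl)) (cong (ren suc) (h i σ))) })
sub-sub (M · N) h = cong₂ _·_ (sub-sub M h) (sub-sub N h)
sub-sub (c0 a b) h = refl
sub-sub (c1 a b) h = refl
sub-sub (ccase a b c) h = refl
sub-sub (cpcase a b c) h = refl
sub-sub (cpair a b) h = refl
sub-sub (cfst a b) h = refl
sub-sub (csnd a b) h = refl
sub-sub (cΩ a) h = refl

_∷ₛ_ : Tm → Subst → Subst
(N ∷ₛ s) zero    σ = N
(N ∷ₛ s) (suc i) σ = s i σ

-- Turns the β-reduct of a substituted abstraction into the simultaneous substitution for which the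
-- induction hypothesis of `⟦⟧-⊩ᴾ` is stated.
sub-lift-[] : ∀ s M N → sub (liftₛ s) M [ N ] ≡ sub (N ∷ₛ s) M
sub-lift-[] s M N = sub-sub M λ
  { zero σ → refl
  ; (suc i) σ → trans (sub-ren (s i σ) λ _ _ → refl) (sub-id (s i σ) λ _ _ → refl) }

⟦ren⟧ : ∀ {r} M → (∀ i → η (r i) ≐ θ i) → ⟦ ren r M ⟧ η ≐ ⟦ M ⟧ θ
⟦ren⟧ (` i ∶ σ) h = h i
⟦ren⟧ {η = η} {θ} {r} (ƛ σ M) h =
  Pr-⊆ σ (λ d → proj₁ (under d)) , Pr-⊆ σ (λ d → proj₂ (under d))
  where
  under : ∀ d → ⟦ ren (liftᵣ r) M ⟧ (d ∷ₑ η) ≐ ⟦ M ⟧ (d ∷ₑ θ)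
  under d = ⟦ren⟧ M λ { zero → ≐-refl ; (suc i) → h i }
⟦ren⟧ (M · N) h = apS-cong (⟦ren⟧ M h) (⟦ren⟧ N h)
⟦ren⟧ (c0 a b) h = ≐-refl
⟦ren⟧ (c1 a b) h = ≐-refl
⟦ren⟧ (ccase a b c) h = ≐-refl
⟦ren⟧ (cpcase a b c) h = ≐-refl
⟦ren⟧ (cpair a b) h = ≐-refl
⟦ren⟧ (cfst a b) h = ≐-refl
⟦ren⟧ (csnd a b) h = ≐-refl
⟦ren⟧ (cΩ a) h = ≐-refl

⟦sub⟧ : ∀ {s} M → (∀ i σ → ⟦ s i σ ⟧ η ⊆ θ i) → ⟦ sub s M ⟧ η ⊆ ⟦ M ⟧ θ
⟦sub⟧ (` i ∶ σ) h = h i σ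
⟦sub⟧ {s = s} (ƛ σ M) h = Pr-⊆ σ λ d → ⟦sub⟧ M λ
  { zero σ → ⊆-refl
  ; (suc i) σ p → h i σ p ∘ proj₁ (⟦ren⟧ (s i σ) λ _ → ≐-refl) p }
⟦sub⟧ (M · N) h = apS-⊆ (⟦sub⟧ M h) (⟦sub⟧ N h)
⟦sub⟧ (c0 a b) h = ⊆-refl
⟦sub⟧ (c1 a b) h = ⊆-refl
⟦sub⟧ (ccase a b c) h = ⊆-refl
⟦sub⟧ (cpcase a b c) h = ⊆-refl
⟦sub⟧ (cpair a b) h = ⊆-refl
⟦sub⟧ (cfst a b) h = ⊆-refl
⟦sub⟧ (csnd a b) h = ⊆-refl
⟦sub⟧ (cΩ a) h = ⊆-refl

⟦[]⟧ : ∀ M N → ⟦ M [ N ] ⟧ η ⊆ ⟦ M ⟧ (⟦ N ⟧ η ∷ₑ η)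
⟦[]⟧ M N = ⟦sub⟧ M λ { zero σ → ⊆-refl ; (suc i) σ → ⊆-refl }

-- Soundness of reduction

module _ (v : Valid Γ η) where
  ⟦c0⟧ : Γ ⊢ M ∶ a → apS (Pr a inj0) (⟦ M ⟧ η) ≐ inj0 (⟦ M ⟧ η)
  ⟦c0⟧ h = apS-inj0 _ (⟦⟧-elem h v)

  ⟦c1⟧ : Γ ⊢ M ∶ b → apS (Pr b inj1) (⟦ M ⟧ η) ≐ inj1 (⟦ M ⟧ η)
  ⟦c1⟧ h = apS-inj1 _ (⟦⟧-elem h v)

  ⟦fst⟧ : Γ ⊢ M ∶ a ⊗ b → ⟦ cfst a b · M ⟧ η ≐ fstS (⟦ M ⟧ η)
  ⟦fst⟧ h = apS-fst _ _ (⟦⟧-elem h v)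

  ⟦snd⟧ : Γ ⊢ M ∶ a ⊗ b → ⟦ csnd a b · M ⟧ η ≐ sndS (⟦ M ⟧ η)
  ⟦snd⟧ h = apS-snd _ _ (⟦⟧-elem h v)

  ⟦pair⟧ : Γ ⊢ M ∶ a → Γ ⊢ N ∶ b → ⟦ cpair a b · M · N ⟧ η ≐ pairS (⟦ M ⟧ η) (⟦ N ⟧ η)
  ⟦pair⟧ h h′ = apS-pair _ _ (⟦⟧-elem h v) (⟦⟧-elem h′ v)

  ⟦case⟧ : Γ ⊢ M ∶ a ⊕ b → Γ ⊢ N ∶ a ⇒ c → Γ ⊢ M′ ∶ b ⇒ c →
    ⟦ ccase a b c · M · N · M′ ⟧ η ≐ caseS (⟦ M ⟧ η) (⟦ N ⟧ η) (⟦ M′ ⟧ η)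
  ⟦case⟧ h h′ h″ = apS-case _ _ _ (⟦⟧-elem h v) (⟦⟧-elem h′ v) (⟦⟧-elem h″ v)

  ⟦pcase⟧ : Γ ⊢ M ∶ a ⊕ b → Γ ⊢ N ∶ c → Γ ⊢ M′ ∶ c →
    ⟦ cpcase a b c · M · N · M′ ⟧ η ≐ pcaseS (⟦ M ⟧ η) (⟦ N ⟧ η) (⟦ M′ ⟧ η)
  ⟦pcase⟧ h h′ h″ = apS-pcase _ _ _ (⟦⟧-elem h v) (⟦⟧-elem h′ v) (⟦⟧-elem h″ v)

⊆-trans : d ⊆ e → e ⊆ f → d ⊆ f
⊆-trans s t p = t p ∘ s p

pcaseS-⊆ʳ : ∀ d → e ⊆ e′ → f ⊆ g → pcaseS d e f ⊆ pcaseS d e′ g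
pcaseS-⊆ʳ d = pcaseS-⊆ {d} {d} ⊆-refl

inj0-pcaseS : ∀ d e f → inj0 (pcaseS d e f) ⊆ pcaseS d (inj0 e) (inj0 f)
inj0-pcaseS d e f tag0 h = inj₂ (inj₂ (tt , tt))
inj0-pcaseS d e f (in0 p) h = h

inj1-pcaseS : ∀ d e f → inj1 (pcaseS d e f) ⊆ pcaseS d (inj1 e) (inj1 f)
inj1-pcaseS d e f tag1 h = inj₂ (inj₂ (tt , tt))
inj1-pcaseS d e f (in1 p) h = h

pairS-pcaseS : ∀ d e e′ f f′ →
  pairS (pcaseS d e f) (pcaseS d e′ f′) ⊆ pcaseS d (pairS e e′) (pairS f f′)
pairS-pcaseS d e e′ f f′ (pr0 p) h = h
pairS-pcaseS d e e′ f f′ (pr1 p) h = h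

-- In the parallel case the two applications may use different finite parts `X` and `Y` of `g`. Both
-- are replaced by one antichain `Z` covering their union: enlarging the argument set makes a
-- function prime smaller, and elements are downward closed.
pcaseS-apS : ∀ a b d → IsElem (a ⇒ b) e → IsElem (a ⇒ b) f → IsElem a g →
  pcaseS d (apS e g) (apS f g) ⊆ apS (pcaseS d e f) g
pcaseS-apS a b d E F G p (inj₁ (t , X , h , h′)) = X , h , inj₁ (t , h′)
pcaseS-apS a b d E F G p (inj₂ (inj₁ (t , X , h , h′))) = X , h , inj₂ (inj₁ (t , h′))
pcaseS-apS {e} {f} {g} a b d E F (u , _ , w) p (inj₂ (inj₂ ((X , h , h′) , Y , k , k′))) =
  let Z , ps , sub , cov = primeSet a (X ++ Y) (λ {x} i → u x (g∋ i)) (λ {x} {y} i j → w x y (g∋ i) (g∋ j))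
  in Z , All.tabulate (g∋ ∘ sub) ,
     inj₂ (inj₂ (narrow Z ps E X (cov ∘ ∈-++⁺ˡ) h′ , narrow Z ps F Y (cov ∘ ∈-++⁺ʳ X) k′))
  where
  g∋ : ∀ {x} → x ∈ X ++ Y → g x
  g∋ = All.lookup (++⁺ h k)

  narrow : ∀ {e} Z → PrimeSet a Z → IsElem (a ⇒ b) e → ∀ X → (∀ {x} → x ∈ X → down a Z x) →
    e (fun X p) → e (fun Z p)
  narrow Z ps (u , v , _) X c h = let hp = proj₂ (u (fun X p) h) in
    v (fun Z p) (fun X p) (ps , hp) (Leq-refl b p hp , AllAny⁺ a X Z (proj₂ ∘ c)) h

sound : M ⟶ M′ → Γ ⊢ M ∶ τ → Valid Γ η → ⟦ M′ ⟧ η ⊆ ⟦ M ⟧ η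
sound {η = η} (β {M = M} {N}) h v with _ , h₁ , h₂ ← app-inv h with _ , h₃ , e ← lam-inv h₁
  with e₁ , _ ← ⇒-inj e =
  ⊆-trans (⟦[]⟧ M N) (proj₂ (apS-ƛ M η (⟦⟧-elem (tconv h₂ (≈-sym e₁)) v)))
sound case0 h v with hx , hy , hz , e ← case-inv h with hx′ , e′ ← c0-inv hx =
  λ { p (X , k , k′) → proj₂ (⟦case⟧ v hx hy hz) p (inj₁
    ( proj₂ (⟦c0⟧ v hx′) tag0 tt
    , X , All.map (λ {x} → proj₂ (⟦c0⟧ v hx′) (in0 x)) k , k′)) }
sound case1 h v with hx , hy , hz , e ← case-inv h with hx′ , e′ ← c1-inv hx =
  λ { p (X , k , k′) → proj₂ (⟦case⟧ v hx hy hz) p (inj₂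
    ( proj₂ (⟦c1⟧ v hx′) tag1 tt
    , X , All.map (λ {x} → proj₂ (⟦c1⟧ v hx′) (in1 x)) k , k′)) }
sound fstβ h v with h′ , e ← fst-inv h with hx , hy , e′ ← pair-inv h′ =
  λ p → proj₂ (⟦fst⟧ v h′) p ∘ proj₂ (⟦pair⟧ v hx hy) (pr0 p)
sound sndβ h v with h′ , e ← snd-inv h with hx , hy , e′ ← pair-inv h′ =
  λ p → proj₂ (⟦snd⟧ v h′) p ∘ proj₂ (⟦pair⟧ v hx hy) (pr1 p)
sound pcase0 h v with hx , hy , hz , e ← pcase-inv h with hx′ , _ ← c0-inv hx =
  λ p k → proj₂ (⟦pcase⟧ v hx hy hz) p (inj₁ (proj₂ (⟦c0⟧ v hx′) tag0 tt , k))
sound pcase1 h v with hx , hy , hz , e ← pcase-inv h with hx′ , _ ← c1-inv hx =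
  λ p k → proj₂ (⟦pcase⟧ v hx hy hz) p (inj₂ (inj₁ (proj₂ (⟦c1⟧ v hx′) tag1 tt , k)))
sound {η = η} s@(pcase00 {x = x} {y} {z}) h v with hx , hy , hz , e ← pcase-inv h
  with hy′ , _ ← c0-inv hy | hz′ , _ ← c0-inv hz | hp , _ ← c0-inv (subject-reduction s h)
  -- The inner `pcase` carries the annotation of the left branch; the typing of the reduct gives `z`
  -- at that type.
  with _ , _ , hz″ , _ ← pcase-inv hp =
  ⊆-trans (proj₁ (⟦c0⟧ v hp)) (⊆-trans (inj0-mono (proj₁ (⟦pcase⟧ v hx hy′ hz″)))
  (⊆-trans (inj0-pcaseS (⟦ x ⟧ η) (⟦ y ⟧ η) (⟦ z ⟧ η))
  (⊆-trans (pcaseS-⊆ʳ (⟦ x ⟧ η) (proj₂ (⟦c0⟧ v hy′)) (proj₂ (⟦c0⟧ v hz′)))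
  (proj₂ (⟦pcase⟧ v hx hy hz)))))
sound {η = η} s@(pcase11 {x = x} {y} {z}) h v with hx , hy , hz , e ← pcase-inv h
  with hy′ , _ ← c1-inv hy | hz′ , _ ← c1-inv hz | hp , _ ← c1-inv (subject-reduction s h)
  with _ , _ , hz″ , _ ← pcase-inv hp =
  ⊆-trans (proj₁ (⟦c1⟧ v hp)) (⊆-trans (inj1-mono (proj₁ (⟦pcase⟧ v hx hy′ hz″)))
  (⊆-trans (inj1-pcaseS (⟦ x ⟧ η) (⟦ y ⟧ η) (⟦ z ⟧ η))
  (⊆-trans (pcaseS-⊆ʳ (⟦ x ⟧ η) (proj₂ (⟦c1⟧ v hy′)) (proj₂ (⟦c1⟧ v hz′)))
  (proj₂ (⟦pcase⟧ v hx hy hz)))))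
sound {η = η} s@(pcasePair {x = x} {y₁} {y₂} {z₁} {z₂}) h v with hx , hy , hz , e ← pcase-inv h
  with hy₁ , hy₂ , _ ← pair-inv hy | hz₁ , hz₂ , _ ← pair-inv hz
     | hp , hq , _ ← pair-inv (subject-reduction s h)
  with _ , _ , hz₁′ , _ ← pcase-inv hp | _ , _ , hz₂′ , _ ← pcase-inv hq =
  ⊆-trans (proj₁ (⟦pair⟧ v hp hq))
  (⊆-trans (pairS-⊆ (proj₁ (⟦pcase⟧ v hx hy₁ hz₁′)) (proj₁ (⟦pcase⟧ v hx hy₂ hz₂′)))
  (⊆-trans (pairS-pcaseS (⟦ x ⟧ η) (⟦ y₁ ⟧ η) (⟦ y₂ ⟧ η) (⟦ z₁ ⟧ η) (⟦ z₂ ⟧ η))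
  (⊆-trans (pcaseS-⊆ʳ (⟦ x ⟧ η) (proj₂ (⟦pair⟧ v hy₁ hy₂)) (proj₂ (⟦pair⟧ v hz₁ hz₂)))
  (proj₂ (⟦pcase⟧ v hx hy hz)))))
sound {η = η} s@(pcaseApp {ρ₁ = ρ₁} {ρ₂} {x} {w = w} eq) h v with _ , h₁ , hw ← app-inv h
  with hx , hy , hz , e ← pcase-inv h₁ with hyw , hzw ← proj₂ (pcase-inv (subject-reduction s h))
  with e₁ , _ ← ⇒-inj (≈-trans (≈-sym (head≡⇒≈ eq)) e) =
  ⊆-trans (proj₁ (⟦pcase⟧ v hx hyw (proj₁ hzw)))
  (⊆-trans (pcaseS-apS ρ₁ ρ₂ (⟦ x ⟧ η) (⟦⟧-elem (tconv hy (head≡⇒≈ eq)) v)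
    (⟦⟧-elem (tconv hz (head≡⇒≈ eq)) v) (⟦⟧-elem (tconv hw (≈-sym e₁)) v))
  (apS-⊆ (proj₂ (⟦pcase⟧ v hx hy hz)) ⊆-refl))
sound (appL s) h v with _ , h₁ , h₂ ← app-inv h = apS-⊆ (sound s h₁ v) λ p → id
sound {η = η} (appR {M} s) h v with _ , h₁ , h₂ ← app-inv h = apS-⊆ {⟦ M ⟧ η} ⊆-refl (sound s h₂ v)
sound (lamξ {σ} s) h v with _ , h′ , e ← lam-inv h =
  λ { (fun X p) (u , k) → u , sound s h′ (Valid-∷ (down-primeSet σ X u) v) p k }

sound* : M ⟶* M′ → Γ ⊢ M ∶ τ → Valid Γ η → ⟦ M′ ⟧ η ⊆ ⟦ M ⟧ η
sound* ε* h v = ⊆-refl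
sound* (s ◅ ss) h v = ⊆-trans (sound* ss (subject-reduction s h) v) (sound s h v)

⇓0-sound : Γ ⊢ M ∶ τ → Valid Γ η → M ⇓0 → ⟦ M ⟧ η tag0
⇓0-sound h v (a , b , M′ , s) =
  sound* s h v tag0 (proj₂ (⟦c0⟧ v (proj₁ (c0-inv (subject-reduction* s h)))) tag0 tt)

⇓1-sound : Γ ⊢ M ∶ τ → Valid Γ η → M ⇓1 → ⟦ M ⟧ η tag1
⇓1-sound h v (a , b , M′ , s) =
  sound* s h v tag1 (proj₂ (⟦c1⟧ v (proj₁ (c1-inv (subject-reduction* s h)))) tag1 tt)

-- Stands in for confluence: whatever a reduct shows is in the denotation, and no element contains
-- both tags.
⇓-exclusive : [] ⊢ M ∶ a ⊕ b → M ⇓0 → M ⇓1 → ⊥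
⇓-exclusive h u v = tags-disjoint _ _ (⟦⟧-elem h valid) (⇓0-sound h valid u) (⇓1-sound h valid v)
  where
  valid : Valid [] (λ _ _ → ⊥)
  valid ()

-- Adequacy

-- Entailment with the types erased, to match the realisability relation, which is indexed by primes
-- and not by types.
data _≼_ : Prm → Prm → Set where
  tag0≼tag0 : tag0 ≼ tag0
  tag0≼in0  : tag0 ≼ in0 q
  in0≼in0   : p ≼ q → in0 p ≼ in0 q
  tag1≼tag1 : tag1 ≼ tag1
  tag1≼in1  : tag1 ≼ in1 q
  in1≼in1   : p ≼ q → in1 p ≼ in1 q
  pr0≼pr0   : p ≼ q → pr0 p ≼ pr0 q
  pr1≼pr1   : p ≼ q → pr1 p ≼ pr1 q
  fun≼fun   : p ≼ q → All (λ y → Any (y ≼_) X) Y → fun X p ≼ fun Y q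

mutual
  Leq⇒≼ : ∀ σ p q → Leq σ p q → p ≼ q
  Leq⇒≼ σ = LeqH⇒≼ (head σ)

  LeqH⇒≼ : ∀ H p q → LeqH H p q → p ≼ q
  LeqH⇒≼ (sumH a b) tag0 tag0 h = tag0≼tag0
  LeqH⇒≼ (sumH a b) tag0 (in0 q) h = tag0≼in0
  LeqH⇒≼ (sumH a b) (in0 p) (in0 q) h = in0≼in0 (Leq⇒≼ a p q h)
  LeqH⇒≼ (sumH a b) tag1 tag1 h = tag1≼tag1
  LeqH⇒≼ (sumH a b) tag1 (in1 q) h = tag1≼in1
  LeqH⇒≼ (sumH a b) (in1 p) (in1 q) h = in1≼in1 (Leq⇒≼ b p q h)
  LeqH⇒≼ (prodH a b) (pr0 p) (pr0 q) h = pr0≼pr0 (Leq⇒≼ a p q h)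
  LeqH⇒≼ (prodH a b) (pr1 p) (pr1 q) h = pr1≼pr1 (Leq⇒≼ b p q h)
  LeqH⇒≼ (arrH a b) (fun X p) (fun Y q) (h , h′) = fun≼fun (Leq⇒≼ b p q h) (AllAny⇒≼ a Y X h′)

  AllAny⇒≼ : ∀ σ Y X → AllAny σ Y X → All (λ y → Any (y ≼_) X) Y
  AllAny⇒≼ σ [] X h = []
  AllAny⇒≼ σ (y ∷ Y) X (h , h′) = AnyLeq⇒≼ σ y X h ∷ AllAny⇒≼ σ Y X h′

  AnyLeq⇒≼ : ∀ σ y X → AnyLeq σ y X → Any (y ≼_) X
  AnyLeq⇒≼ σ y (x ∷ X) (inj₁ h) = here (Leq⇒≼ σ y x h)
  AnyLeq⇒≼ σ y (x ∷ X) (inj₂ h) = there (AnyLeq⇒≼ σ y X h)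

mutual
  ≼-refl : ∀ p → p ≼ p
  ≼-refl tag0 = tag0≼tag0
  ≼-refl tag1 = tag1≼tag1
  ≼-refl (in0 p) = in0≼in0 (≼-refl p)
  ≼-refl (in1 p) = in1≼in1 (≼-refl p)
  ≼-refl (pr0 p) = pr0≼pr0 (≼-refl p)
  ≼-refl (pr1 p) = pr1≼pr1 (≼-refl p)
  ≼-refl (fun X p) = fun≼fun (≼-refl p) (≼L-refl X X id)

  ≼L-refl : ∀ Y X → (∀ {y} → Any (y ≼_) Y → Any (y ≼_) X) → All (λ y → Any (y ≼_) X) Y
  ≼L-refl [] X i = []
  ≼L-refl (y ∷ Y) X i = i (here (≼-refl y)) ∷ ≼L-refl Y X (i ∘ there)

infix 4 _≼L_
_≼L_ : List Prm → List Prm → Set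
Y ≼L X = ∀ {y} → y ∈ Y → ∃ λ x → x ∈ X × y ≼ x

⊆⇒≼L : (∀ {y} → y ∈ Y → y ∈ X) → Y ≼L X
⊆⇒≼L h {y} i = y , h i , ≼-refl y

injection : Bool → Type → Type → Tm
injection false = c0
injection true  = c1

data Tagged : Bool → Prm → Set where
  tag0 : Tagged false tag0
  in0  : Tagged false (in0 p)
  tag1 : Tagged true tag1
  in1  : Tagged true (in1 p)

data Paired : Prm → Set where
  pr0 : Paired (pr0 p)
  pr1 : Paired (pr1 p)

inB : Bool → Prm → Prm
inB false = in0
inB true  = in1

injS : Bool → Pred → Pred
injS false = inj0
injS true  = inj1

Steps : Set
Steps = List (List Prm × Prm)

step : List Prm × Prm → Prm
step (X , p) = fun X p

args : Steps → List Prm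
args = concatMap proj₁

results : Steps → List Prm
results = map proj₂

∈-args⁺ : ∀ {S s} → s ∈ S → x ∈ proj₁ s → x ∈ args S
∈-args⁺ i j = ∈-concatMap⁺ proj₁ (Any.map (λ { refl → j }) i)

∈-args⁻ : ∀ S → x ∈ args S → ∃ λ s → s ∈ S × x ∈ proj₁ s
∈-args⁻ S i with s , j , k ← find (∈-concatMap⁻ proj₁ {xs = S} i) = s , j , k

∈-results⁻ : ∀ S → p ∈ results S → ∃ λ X → (X , p) ∈ S
∈-results⁻ S i with (X , _) , j , refl ← ∈-map⁻ proj₂ {xs = S} i = X , j

choose : ∀ {ℓ} {A B : Set} {P : A → B → Set ℓ} xs → (∀ {x} → x ∈ xs → ∃ (P x)) → ∃ λ ys →
  (∀ {x} → x ∈ xs → ∃ λ y → y ∈ ys × P x y) × (∀ {y} → y ∈ ys → ∃ λ x → x ∈ xs × P x y)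
choose [] h = [] , (λ ()) , λ ()
choose (x ∷ xs) h with y , hy ← h (here refl) | ys , u , v ← choose xs (h ∘ there) =
  y ∷ ys ,
  (λ { (here refl) → y , here refl , hy ; (there i) → let z , j , k = u i in z , there j , k }) ,
  (λ { (here refl) → x , here refl , hy ; (there i) → let z , j , k = v i in z , there j , k })

-- Realisability relates a term to a finite set of primes, not to single primes: the witnesses
-- M′ below then serve all members of the set at once, and no confluence theorem is needed
-- (reduction is confluent only up to equivalence of the type annotations).
mutual
  R : ℕ → List Prm → Tm → Set
  R zero X M = ⊤
  R (suc n) X M = RSum n X M × RPair n X M × RFun n X M

  -- The tagged witness makes the empty list demand nothing. Since `Q` may be empty, a bare tag in
  -- `X` already forces `M` to reduce to an injection.
  RSum : ℕ → List Prm → Tm → Set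
  RSum n X M = ∀ i Q → (∀ {q} → q ∈ Q → inB i q ∈ X) → (∃ λ t → t ∈ X × Tagged i t) →
    ∃ λ a → ∃ λ b → ∃ λ M′ → (M ⟶* injection i a b · M′) × R n Q M′

  RPair : ℕ → List Prm → Tm → Set
  RPair n X M = ∀ Q₀ Q₁ → (∀ {q} → q ∈ Q₀ → pr0 q ∈ X) → (∀ {q} → q ∈ Q₁ → pr1 q ∈ X) →
    (∃ λ t → t ∈ X × Paired t) →
    ∃ λ a → ∃ λ b → ∃ λ M₀ → ∃ λ M₁ → (M ⟶* cpair a b · M₀ · M₁) × R n Q₀ M₀ × R n Q₁ M₁

  -- Finitely many steps are taken together: an argument realising all their argument lists must
  -- yield all their results. The typing premise later excludes arguments that show two tags.
  RFun : ℕ → List Prm → Tm → Set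
  RFun n X M = ∀ S → (∀ {s} → s ∈ S → step s ∈ X) → ∀ N τ → [] ⊢ M · N ∶ τ →
    R n (args S) N → R n (results S) (M · N)

inB-≼ : ∀ i → inB i q ≼ x → ∃ λ q′ → x ≡ inB i q′ × q ≼ q′
inB-≼ false (in0≼in0 h) = _ , refl , h
inB-≼ true (in1≼in1 h) = _ , refl , h

pr0-≼ : pr0 q ≼ x → ∃ λ q′ → x ≡ pr0 q′ × q ≼ q′
pr0-≼ (pr0≼pr0 h) = _ , refl , h

pr1-≼ : pr1 q ≼ x → ∃ λ q′ → x ≡ pr1 q′ × q ≼ q′
pr1-≼ (pr1≼pr1 h) = _ , refl , h

Tagged-≼ : ∀ {i} → p ≼ q → Tagged i p → Tagged i q
Tagged-≼ tag0≼tag0 tag0 = tag0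
Tagged-≼ tag0≼in0 tag0 = in0
Tagged-≼ (in0≼in0 h) in0 = in0
Tagged-≼ tag1≼tag1 tag1 = tag1
Tagged-≼ tag1≼in1 tag1 = in1
Tagged-≼ (in1≼in1 h) in1 = in1

Paired-≼ : p ≼ q → Paired p → Paired q
Paired-≼ (pr0≼pr0 h) pr0 = pr0
Paired-≼ (pr1≼pr1 h) pr1 = pr1

choose-≼ : ∀ {c : Prm → Prm} Q → (∀ {q x} → c q ≼ x → ∃ λ q′ → x ≡ c q′ × q ≼ q′) →
  Y ≼L X → (∀ {q} → q ∈ Q → c q ∈ Y) → ∃ λ L → (∀ {q} → q ∈ L → c q ∈ X) × Q ≼L L
choose-≼ {X = X} {c} Q inv le h
  with L , u , v ← choose {P = λ q q′ → c q′ ∈ X × q ≼ q′} Q (λ {q} i →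
         case le (h i) of λ (x , j , l) → case inv l of λ { (q′ , refl , m) → q′ , j , m }) =
  L , (λ i → let _ , _ , j , _ = v i in j) , (λ i → let x , j , _ , m = u i in x , j , m)

-- In the function case each step is replaced by one above it in `X`, which asks less of the
-- argument and promises more of the result.
R-≼ : ∀ n → Y ≼L X → R n X M → R n Y M
R-≼ zero le h = tt
R-≼ {Y} {X} {M} (suc n) le (hS , hP , hF) = sum , pair , func
  where
  sum : RSum n Y M
  sum i Q h (t , j , T) with x , k , l ← le j with L , u , v ← choose-≼ {c = inB i} Q (inB-≼ i) le h
    with a , b , M′ , s , r ← hS i L u (x , k , Tagged-≼ l T) = a , b , M′ , s , R-≼ n v r

  pair : RPair n Y M
  pair Q₀ Q₁ h₀ h₁ (t , j , T) with x , k , l ← le j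
    with L₀ , u₀ , v₀ ← choose-≼ Q₀ pr0-≼ le h₀ | L₁ , u₁ , v₁ ← choose-≼ Q₁ pr1-≼ le h₁
    with a , b , M₀ , M₁ , s , r₀ , r₁ ← hP L₀ L₁ u₀ u₁ (x , k , Paired-≼ l T) =
    a , b , M₀ , M₁ , s , R-≼ n v₀ r₀ , R-≼ n v₁ r₁

  Above : List Prm × Prm → List Prm × Prm → Set
  Above (Z , p) (Z′ , p′) = fun Z′ p′ ∈ X × p ≼ p′ × Z′ ≼L Z

  above : ∀ {s} → step s ∈ Y → ∃ (Above s)
  above i with le i
  ... | fun Z′ p′ , j , fun≼fun l m = (Z′ , p′) , j , l , λ k → find (All.lookup m k)

  func : RFun n Y M
  func S h N τ t r with S′ , u , v ← choose {P = Above} S (above ∘ h) =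
    R-≼ n res (hF S′ (λ i → let _ , _ , j , _ = v i in j) N τ t (R-≼ n arg r))
    where
    arg : args S′ ≼L args S
    arg i with s′ , j , k ← ∈-args⁻ S′ i with s , j′ , _ , _ , l ← v j with z , k′ , m ← l k =
      z , ∈-args⁺ j′ k′ , m

    res : results S ≼L results S′
    res i with Z , j ← ∈-results⁻ S i with (_ , p′) , k , _ , l , _ ← u j = p′ , ∈-map⁺ proj₂ k , l

R-empty : ∀ n → (∀ {x} → ¬ x ∈ X) → R n X M
R-empty zero h = tt
R-empty (suc n) h = (λ { i Q _ (t , j , _) → ⊥-elim (h j) }) ,
  (λ { _ _ _ _ (t , j , _) → ⊥-elim (h j) }) ,
  (λ S k N τ _ _ → R-empty n λ i → h (k (proj₂ (∈-results⁻ S i))))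

R-exp : ∀ n → M ⟶* M′ → R n X M′ → R n X M
R-exp zero s h = tt
R-exp (suc n) s (hS , hP , hF) =
  (λ i Q u t → let a , b , M″ , s′ , r = hS i Q u t in a , b , M″ , s ◅◅ s′ , r) ,
  (λ Q₀ Q₁ u₀ u₁ t → let a , b , M₀ , M₁ , s′ , r = hP Q₀ Q₁ u₀ u₁ t in a , b , M₀ , M₁ , s ◅◅ s′ , r) ,
  (λ S u N τ t r → R-exp n (appL* s) (hF S u N τ (subject-reduction* (appL* s) t) r))

Bound : ℕ → List Prm → Set
Bound n X = ∀ {x} → x ∈ X → depth x ≤ n

inB-depth : ∀ i {n} → depth (inB i q) ≤ suc n → depth q ≤ n
inB-depth false = s≤s⁻¹
inB-depth true = s≤s⁻¹

args-Bound : ∀ {n} S → (∀ {s} → s ∈ S → step s ∈ X) → Bound (suc n) X → Bound n (args S)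
args-Bound S h b i with (Z , p) , j , k ← ∈-args⁻ S i = fun-argsDepth Z p (b (h j)) k

results-Bound : ∀ {n} S → (∀ {s} → s ∈ S → step s ∈ X) → Bound (suc n) X → Bound n (results S)
results-Bound S h b i with Z , j ← ∈-results⁻ S i = fun-resultDepth Z _ (b (h j))

-- The index is mere fuel. As with consistency, both bounds are assumed because arguments in `RFun`
-- are transferred in the opposite direction.
R-stable : ∀ n m → Bound n X → Bound m X → R n X M → R m X M
R-stable n zero b b′ h = tt
R-stable zero (suc m) b b′ h = R-empty (suc m) λ {x} i → ¬depth≤0 x (b i)
R-stable (suc n) (suc m) b b′ (hS , hP , hF) =
  (λ i Q u t → let a , c , M′ , s , r = hS i Q u t in
     a , c , M′ , s , R-stable n m (inB-depth i ∘ b ∘ u) (inB-depth i ∘ b′ ∘ u) r) ,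
  (λ Q₀ Q₁ u₀ u₁ t → let a , c , M₀ , M₁ , s , r₀ , r₁ = hP Q₀ Q₁ u₀ u₁ t in
     a , c , M₀ , M₁ , s ,
     R-stable n m (s≤s⁻¹ ∘ b ∘ u₀) (s≤s⁻¹ ∘ b′ ∘ u₀) r₀ ,
     R-stable n m (s≤s⁻¹ ∘ b ∘ u₁) (s≤s⁻¹ ∘ b′ ∘ u₁) r₁) ,
  (λ S u N τ t r → R-stable n m (results-Bound S u b) (results-Bound S u b′)
     (hF S u N τ t (R-stable m n (args-Bound S u b′) (args-Bound S u b) r)))

-- Realisability of predicates and the fundamental lemma

infix 4 _⊩_ _⊩ᴾ_
-- Index-free realisability: by `R-stable`, one sufficient index settles all of them.
_⊩_ : List Prm → Tm → Set
X ⊩ M = ∀ n → Bound n X → R n X M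

R⇒⊩ : ∀ n → Bound n X → R n X M → X ⊩ M
R⇒⊩ n b h m b′ = R-stable n m b b′ h

⊩-≼ : Y ≼L X → X ⊩ M → Y ⊩ M
⊩-≼ {Y} {X} le h = R⇒⊩ (depthL X ⊔ depthL Y)
  (λ i → ≤-trans (∈⇒depth≤ i) (m≤n⊔m (depthL X) _))
  (R-≼ (depthL X ⊔ depthL Y) le (h _ λ i → ≤-trans (∈⇒depth≤ i) (m≤m⊔n _ _)))

⊩-exp : M ⟶* M′ → X ⊩ M′ → X ⊩ M
⊩-exp s h n b = R-exp n s (h n b)

_⊩ᴾ_ : Pred → Tm → Set
d ⊩ᴾ M = ∀ X → (∀ {x} → x ∈ X → d x) → X ⊩ M

⊩ᴾ-exp : M ⟶* M′ → d ⊩ᴾ M′ → d ⊩ᴾ M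
⊩ᴾ-exp s h X u = ⊩-exp s (h X u)

app-⊩ : ∀ S → (∀ {s} → s ∈ S → f (step s)) → f ⊩ᴾ M → args S ⊩ N → [] ⊢ M · N ∶ τ →
  results S ⊩ M · N
app-⊩ {f} {M} {N} {τ} S u h h′ t = R⇒⊩ n bR
  (proj₂ (proj₂ (h (map step S) (λ i → ∈f i) (suc n) bS)) S (∈-map⁺ step) N τ t (h′ n bA))
  where
  -- Bounds arguments and results alike, so that `suc n` bounds the steps and a single use of `RFun`
  -- connects the three.
  n = depthL (args S) ⊔ depthL (results S)

  bA : Bound n (args S)
  bA i = ≤-trans (∈⇒depth≤ i) (m≤m⊔n _ _)

  bR : Bound n (results S)
  bR i = ≤-trans (∈⇒depth≤ i) (m≤n⊔m (depthL (args S)) _)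

  bS : Bound (suc n) (map step S)
  bS i with (X , p) , j , refl ← ∈-map⁻ step i =
    s≤s (⊔-lub (depthL-lub X (λ k → bA (∈-args⁺ j k))) (bR (∈-map⁺ proj₂ j)))

  ∈f : ∀ {x} → x ∈ map step S → f x
  ∈f i with s , j , refl ← ∈-map⁻ step i = u j

apS-finite : ∀ P → (∀ {p} → p ∈ P → apS f d p) → ∃ λ S →
  (∀ {s} → s ∈ S → f (step s)) × (∀ {x} → x ∈ args S → d x) × (∀ {p} → p ∈ P → p ∈ results S)
apS-finite {f} {d} P h
  with S , u , v ← choose {P = λ p s → proj₂ s ≡ p × f (step s) × All d (proj₁ s)} P
         (λ i → let X , k , k′ = h i in (X , _) , refl , k′ , k) =
  S , (λ i → let _ , _ , _ , k , _ = v i in k) ,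
  (λ i → let s , j , k = ∈-args⁻ S i ; _ , _ , _ , _ , l = v j in All.lookup l k) ,
  λ i → case u i of λ { (s , j , refl , _) → ∈-map⁺ proj₂ j }

apS-⊩ᴾ : f ⊩ᴾ M → d ⊩ᴾ N → [] ⊢ M · N ∶ τ → apS f d ⊩ᴾ M · N
apS-⊩ᴾ {f} {d = d} h h′ t P k with S , u , v , w ← apS-finite {f} {d} P k =
  ⊩-≼ (⊆⇒≼L w) (app-⊩ S u h (h′ (args S) v) t)

-- The premise is used at `d = down σ (args S)`. Each step has a consistent argument set, but their
-- union may be inconsistent, so `d` ranges over sets of primes and not over elements. Where
-- consistency matters, it must come from the realising term.
Pr-⊩ᴾ : ∀ {f : Pred → Pred} σ → Mono f →
  (∀ N τ d → [] ⊢ M · N ∶ τ → d ⊆ IsPrime σ → d ⊩ᴾ N → f d ⊩ᴾ M · N) → Pr σ f ⊩ᴾ M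
Pr-⊩ᴾ {M} {f} σ m h P u zero b = tt
Pr-⊩ᴾ {M} {f} σ m h P u (suc n) b = (λ i Q _ (t , j , T) → ⊥-elim (noTag T (u j))) ,
  (λ Q₀ Q₁ _ _ (t , j , T) → ⊥-elim (noPair T (u j))) , func
  where
  noTag : ∀ {i t} → Tagged i t → ¬ Pr σ f t
  noTag tag0 ()
  noTag in0 ()
  noTag tag1 ()
  noTag in1 ()

  noPair : ∀ {t} → Paired t → ¬ Pr σ f t
  noPair pr0 ()
  noPair pr1 ()

  func : RFun n P M
  func S k N τ t r = h N τ (down σ (args S)) t (λ p → proj₁) real (results S) res n
      (results-Bound S k b)
    where
    real : down σ (args S) ⊩ᴾ N
    real X l = ⊩-≼ (λ {x} i → let y , j , le = AnyLeq⁻ σ x (args S) (proj₂ (l i)) in y , j , Leq⇒≼ σ x y le)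
      (R⇒⊩ n (args-Bound S k b) r)

    res : ∀ {p} → p ∈ results S → f (down σ (args S)) p
    res {p} i with Z , j ← ∈-results⁻ S i = m (down-mono σ Z (args S) (∈-args⁺ j)) p (proj₂ (u (k j)))

tagB : Bool → Prm
tagB false = tag0
tagB true  = tag1

Tagged-tagB : ∀ i → Tagged i (tagB i)
Tagged-tagB false = tag0
Tagged-tagB true  = tag1

inB-depth⁺ : ∀ i {n} → depth q ≤ n → depth (inB i q) ≤ suc n
inB-depth⁺ false = s≤s
inB-depth⁺ true = s≤s

tagB-depth : ∀ i {n} → depth (tagB i) ≤ suc n
tagB-depth false = s≤s z≤n
tagB-depth true = s≤s z≤n

-- Adding the bare tag to the list provides the tagged witness even when `Q` is empty.
sum-elim : ∀ i Q → d ⊩ᴾ M → d (tagB i) → (∀ {q} → q ∈ Q → d (inB i q)) →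
  ∃ λ a → ∃ λ b → ∃ λ M′ → (M ⟶* injection i a b · M′) × Q ⊩ M′
sum-elim {d} i Q h t u =
  let a , b , M′ , s , r = proj₁ (h (tagB i ∷ map (inB i) Q) ∈d (suc n) bound) i Q
        (λ k → there (∈-map⁺ (inB i) k)) (_ , here refl , Tagged-tagB i)
  in a , b , M′ , s , R⇒⊩ n ∈⇒depth≤ r
  where
  n = depthL Q

  ∈d : ∀ {x} → x ∈ tagB i ∷ map (inB i) Q → d x
  ∈d (here refl) = t
  ∈d (there k) with q , j , refl ← ∈-map⁻ (inB i) k = u j

  bound : Bound (suc n) (tagB i ∷ map (inB i) Q)
  bound (here refl) = tagB-depth i
  bound (there k) with q , j , refl ← ∈-map⁻ (inB i) k = inB-depth⁺ i (∈⇒depth≤ j)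

injS-Tagged : ∀ i → injS i d x → Tagged i x
injS-Tagged {x = tag0} false h = tag0
injS-Tagged {x = in0 x} false h = in0
injS-Tagged {x = tag1} true h = tag1
injS-Tagged {x = in1 x} true h = in1

Tagged-unique : ∀ {i j} → Tagged i x → Tagged j x → i ≡ j
Tagged-unique tag0 tag0 = refl
Tagged-unique in0 in0 = refl
Tagged-unique tag1 tag1 = refl
Tagged-unique in1 in1 = refl

injS-inB : ∀ i → injS i d (inB i q) → d q
injS-inB false h = h
injS-inB true h = h

Tagged-¬Paired : ∀ {i} → Tagged i x → ¬ Paired x
Tagged-¬Paired tag0 ()
Tagged-¬Paired in0 ()
Tagged-¬Paired tag1 ()
Tagged-¬Paired in1 ()

Tagged-¬step : ∀ {i s} → ¬ Tagged i (step s)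
Tagged-¬step ()

injS-⊩ᴾ : ∀ i → d ⊩ᴾ M → injS i d ⊩ᴾ injection i a b · M
injS-⊩ᴾ {d} {M} {a} {b} i h X u zero _ = tt
injS-⊩ᴾ {d} {M} {a} {b} i h X u (suc n) bd = sum ,
  (λ _ _ _ _ (t , j , T) → ⊥-elim (Tagged-¬Paired (injS-Tagged i (u j)) T)) ,
  (λ S k _ _ _ _ → R-empty n λ l → let Z , j = ∈-results⁻ S l in
    Tagged-¬step {s = Z , _} (injS-Tagged i (u (k j))))
  where
  sum : RSum n X (injection i a b · M)
  sum j Q v (t , k , T) with refl ← Tagged-unique (injS-Tagged i (u k)) T =
    a , b , M , ε* , h Q (injS-inB i ∘ u ∘ v) n (inB-depth i ∘ bd ∘ v)

pairS-Paired : pairS d e x → Paired x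
pairS-Paired {x = pr0 x} h = pr0
pairS-Paired {x = pr1 x} h = pr1

pairS-⊩ᴾ : d ⊩ᴾ M → e ⊩ᴾ N → pairS d e ⊩ᴾ cpair a b · M · N
pairS-⊩ᴾ h h′ X u zero _ = tt
pairS-⊩ᴾ {d} {M} {e} {N} {a} {b} h h′ X u (suc n) bd =
  (λ i _ _ (t , j , T) → ⊥-elim (Tagged-¬Paired T (pairS-Paired {d} {e} (u j)))) ,
  (λ Q₀ Q₁ u₀ u₁ _ → a , b , M , N , ε* ,
    h Q₀ (u ∘ u₀) n (s≤s⁻¹ ∘ bd ∘ u₀) , h′ Q₁ (u ∘ u₁) n (s≤s⁻¹ ∘ bd ∘ u₁)) ,
  (λ S k _ _ _ _ → R-empty n λ {p} l → let Z , j = ∈-results⁻ S l in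
    case pairS-Paired {d} {e} {fun Z p} (u (k j)) of λ ())

-- The empty list is treated apart: without a prime nothing forces the argument to reduce to a pair,
-- and nothing is demanded of the projection.
fstS-⊩ᴾ : d ⊩ᴾ M → fstS d ⊩ᴾ cfst a b · M
fstS-⊩ᴾ h [] u n _ = R-empty n λ ()
fstS-⊩ᴾ {d} {M} h P@(p ∷ _) u =
  let _ , _ , M₀ , M₁ , s , r , _ = proj₁ (proj₂ (h (map pr0 P) ∈d (suc n) bound)) P []
        (∈-map⁺ pr0) (λ ()) (_ , here refl , pr0)
  in ⊩-exp (appR* s ◅◅ fstβ ◅ ε*) (R⇒⊩ n ∈⇒depth≤ r)
  where
  n = depthL P

  ∈d : ∀ {x} → x ∈ map pr0 P → d x
  ∈d k with q , j , refl ← ∈-map⁻ pr0 k = u j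

  bound : Bound (suc n) (map pr0 P)
  bound k with q , j , refl ← ∈-map⁻ pr0 k = s≤s (∈⇒depth≤ j)

sndS-⊩ᴾ : d ⊩ᴾ M → sndS d ⊩ᴾ csnd a b · M
sndS-⊩ᴾ h [] u n _ = R-empty n λ ()
sndS-⊩ᴾ {d} {M} h P@(p ∷ _) u =
  let _ , _ , M₀ , M₁ , s , _ , r = proj₁ (proj₂ (h (map pr1 P) ∈d (suc n) bound)) [] P
        (λ ()) (∈-map⁺ pr1) (_ , here refl , pr1)
  in ⊩-exp (appR* s ◅◅ sndβ ◅ ε*) (R⇒⊩ n ∈⇒depth≤ r)
  where
  n = depthL P

  ∈d : ∀ {x} → x ∈ map pr1 P → d x
  ∈d k with q , j , refl ← ∈-map⁻ pr1 k = u j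

  bound : Bound (suc n) (map pr1 P)
  bound k with q , j , refl ← ∈-map⁻ pr1 k = s≤s (∈⇒depth≤ j)

prime-fun-head : ∀ c → IsPrime c (fun X p) → ∃ λ c₁ → ∃ λ c₂ → head c ≡ arrH c₁ c₂
prime-fun-head c h with arrH c₁ c₂ ← head c = c₁ , c₂ , refl

pcase-cong₂₃ : ∀ {x y y′ z z′} → y ⟶* y′ → z ⟶* z′ →
  cpcase a b c · x · y · z ⟶* cpcase a b c · x · y′ · z′
pcase-cong₂₃ s t = appL* (appR* s) ◅◅ appR* t

-- The scrutinee stays arbitrary. Each distribution rule moves `pcase` below the constructor that
-- both branches show, or past an argument, and the index drops by one. That the members of `X` are
-- primes of `c` yields the arrow head required by `pcaseApp`.
R-pcase : ∀ n {x y z} → [] ⊢ cpcase a b c · x · y · z ∶ τ → (∀ {p} → p ∈ X → IsPrime c p) →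
  R n X y → R n X z → R n X (cpcase a b c · x · y · z)
R-pcase zero t u h h′ = tt
R-pcase {a} {b} {c} {τ} {X} (suc n) {x} {y} {z} t u (hS , hP , hF) (hS′ , hP′ , hF′) = sum , pair , func
  where
  sum : RSum n X (cpcase a b c · x · y · z)
  sum false Q v w with a′ , b′ , y′ , s , r ← hS false Q v w | _ , _ , z′ , s′ , r′ ← hS′ false Q v w =
    let ss = pcase-cong₂₃ s s′ ◅◅ pcase00 ◅ ε*
        e  = proj₂ (c0-inv (subject-reduction* s (proj₁ (proj₂ (pcase-inv t)))))
    in a′ , b′ , _ , ss , R-pcase n (proj₁ (c0-inv (subject-reduction* ss t)))
         (λ {q} i → IsPrime-≈ (in0 q) (≈-sym e) (u (v i))) r r′
  sum true Q v w with a′ , b′ , y′ , s , r ← hS true Q v w | _ , _ , z′ , s′ , r′ ← hS′ true Q v w =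
    let ss = pcase-cong₂₃ s s′ ◅◅ pcase11 ◅ ε*
        e  = proj₂ (c1-inv (subject-reduction* s (proj₁ (proj₂ (pcase-inv t)))))
    in a′ , b′ , _ , ss , R-pcase n (proj₁ (c1-inv (subject-reduction* ss t)))
         (λ {q} i → IsPrime-≈ (in1 q) (≈-sym e) (u (v i))) r r′

  pair : RPair n X (cpcase a b c · x · y · z)
  pair Q₀ Q₁ v₀ v₁ w
    with a′ , b′ , _ , _ , s , r₀ , r₁ ← hP Q₀ Q₁ v₀ v₁ w
       | _ , _ , _ , _ , s′ , r₀′ , r₁′ ← hP′ Q₀ Q₁ v₀ v₁ w =
    let ss = pcase-cong₂₃ s s′ ◅◅ pcasePair ◅ ε*
        _ , _ , e = pair-inv (subject-reduction* s (proj₁ (proj₂ (pcase-inv t))))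
        t₀ , t₁ , _ = pair-inv (subject-reduction* ss t)
    in a′ , b′ , _ , _ , ss ,
       R-pcase n t₀ (λ {q} i → IsPrime-≈ (pr0 q) (≈-sym e) (u (v₀ i))) r₀ r₀′ ,
       R-pcase n t₁ (λ {q} i → IsPrime-≈ (pr1 q) (≈-sym e) (u (v₁ i))) r₁ r₁′

  func : RFun n X (cpcase a b c · x · y · z)
  func [] v N τ t′ r = R-empty n λ ()
  func S@((Z , p) ∷ _) v N τ t′ r with c₁ , c₂ , eq ← prime-fun-head c (u (v (here refl))) =
    let t″ = subject-reduction (pcaseApp eq) t′
        _ , ty , tz , _ = pcase-inv t″
    in R-exp n (pcaseApp eq ◅ ε*) (R-pcase n t″
         (λ {q} i → let Z , j = ∈-results⁻ S i in
            proj₂ (IsPrime-≈ (fun Z q) (head≡⇒≈ {c} eq) (u (v j))))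
         (hF S v N _ ty r) (hF′ S v N _ tz r))

case-cong₁ : ∀ {x x′ y z} → x ⟶* x′ → ccase a b c · x · y · z ⟶* ccase a b c · x′ · y · z
case-cong₁ s = appL* (appL* (appR* s))

pcase-cong₁ : ∀ {x x′ y z} → x ⟶* x′ → cpcase a b c · x · y · z ⟶* cpcase a b c · x′ · y · z
pcase-cong₁ s = appL* (appL* (appR* s))

⊩ᴾ⇒⇓0 : d ⊩ᴾ M → d tag0 → M ⇓0
⊩ᴾ⇒⇓0 h t = let a , b , M′ , s , _ = sum-elim false [] h t (λ ()) in a , b , M′ , s

⊩ᴾ⇒⇓1 : d ⊩ᴾ M → d tag1 → M ⇓1
⊩ᴾ⇒⇓1 h t = let a , b , M′ , s , _ = sum-elim true [] h t (λ ()) in a , b , M′ , s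

-- The first prime fixes the branch for the whole list. As `d` need not be consistent, agreement of
-- the other primes comes from `x`, which cannot reduce to both injections.
caseS-⊩ᴾ : ∀ {x y z} → [] ⊢ ccase a b c · x · y · z ∶ τ → d ⊩ᴾ x → e ⊩ᴾ y → f ⊩ᴾ z →
  caseS d e f ⊩ᴾ ccase a b c · x · y · z
caseS-⊩ᴾ t hx hy hz [] u n _ = R-empty n λ ()
caseS-⊩ᴾ {d = d} {e} {f} {x} t hx hy hz P@(_ ∷ _) u with tx , _ ← case-inv t with u (here refl)
... | inj₁ (tag , _) =
  let S , v , w , res = apS-finite {e} P (λ i → left (u i))
      _ , _ , x′ , s , r = sum-elim false (args S) hx tag w
      ss = case-cong₁ s ◅◅ case0 ◅ ε*
  in ⊩-exp ss (⊩-≼ (⊆⇒≼L res) (app-⊩ S v hy r (subject-reduction* ss t)))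
  where
  left : caseS d e f p → apS e (λ p → d (in0 p)) p
  left (inj₁ (_ , h)) = h
  left (inj₂ (tag′ , _)) = ⊥-elim (⇓-exclusive tx (⊩ᴾ⇒⇓0 hx tag) (⊩ᴾ⇒⇓1 hx tag′))
... | inj₂ (tag , _) =
  let S , v , w , res = apS-finite {f} P (λ i → right (u i))
      _ , _ , x′ , s , r = sum-elim true (args S) hx tag w
      ss = case-cong₁ s ◅◅ case1 ◅ ε*
  in ⊩-exp ss (⊩-≼ (⊆⇒≼L res) (app-⊩ S v hz r (subject-reduction* ss t)))
  where
  right : caseS d e f p → apS f (λ p → d (in1 p)) p
  right (inj₂ (_ , h)) = h
  right (inj₁ (tag′ , _)) = ⊥-elim (⇓-exclusive tx (⊩ᴾ⇒⇓0 hx tag′) (⊩ᴾ⇒⇓1 hx tag))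

module _ {x y z : Tm} (t : [] ⊢ cpcase a b c · x · y · z ∶ τ)
         (hx : d ⊩ᴾ x) (hy : e ⊩ᴾ y) (hz : f ⊩ᴾ z) (prime : e ⊆ IsPrime c) where
  private
    Outcome : List Prm → Set
    Outcome P = (d tag0 × (∀ {p} → p ∈ P → e p)) ⊎ (d tag1 × (∀ {p} → p ∈ P → f p)) ⊎
      (∀ {p} → p ∈ P → e p × f p)

    disjoint : d tag0 → d tag1 → ⊥
    disjoint h h′ = ⇓-exclusive (proj₁ (pcase-inv t)) (⊩ᴾ⇒⇓0 hx h) (⊩ᴾ⇒⇓1 hx h′)

    _∷ᵃ_ : ∀ {P p} {g : Pred} → g p → (∀ {p} → p ∈ P → g p) → ∀ {q} → q ∈ p ∷ P → g q
    (h ∷ᵃ hs) (here refl) = h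
    (h ∷ᵃ hs) (there i) = hs i

    -- One reduct must serve the whole list: primes lying in both branches join the side that the
    -- others force, and two opposite sides contradict `disjoint`.
    outcome : ∀ P → (∀ {p} → p ∈ P → pcaseS d e f p) → Outcome P
    outcome [] u = inj₂ (inj₂ λ ())
    outcome (p ∷ P) u with u (here refl) | outcome P (u ∘ there)
    ... | inj₁ (h , k) | inj₁ (_ , ks) = inj₁ (h , _∷ᵃ_ {g = e} k ks)
    ... | inj₁ (h , k) | inj₂ (inj₁ (h′ , _)) = ⊥-elim (disjoint h h′)
    ... | inj₁ (h , k) | inj₂ (inj₂ ks) = inj₁ (h , _∷ᵃ_ {g = e} k (proj₁ ∘ ks))
    ... | inj₂ (inj₁ (h , k)) | inj₁ (h′ , _) = ⊥-elim (disjoint h′ h)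
    ... | inj₂ (inj₁ (h , k)) | inj₂ (inj₁ (_ , ks)) = inj₂ (inj₁ (h , _∷ᵃ_ {g = f} k ks))
    ... | inj₂ (inj₁ (h , k)) | inj₂ (inj₂ ks) = inj₂ (inj₁ (h , _∷ᵃ_ {g = f} k (proj₂ ∘ ks)))
    ... | inj₂ (inj₂ (k , k′)) | inj₁ (h , ks) = inj₁ (h , _∷ᵃ_ {g = e} k ks)
    ... | inj₂ (inj₂ (k , k′)) | inj₂ (inj₁ (h , ks)) = inj₂ (inj₁ (h , _∷ᵃ_ {g = f} k′ ks))
    ... | inj₂ (inj₂ k) | inj₂ (inj₂ ks) = inj₂ (inj₂ (_∷ᵃ_ {g = λ p → e p × f p} k ks))

  pcaseS-⊩ᴾ : pcaseS d e f ⊩ᴾ cpcase a b c · x · y · z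
  pcaseS-⊩ᴾ P u with outcome P u
  ... | inj₁ (h , k) = let _ , _ , _ , s = ⊩ᴾ⇒⇓0 hx h in
    ⊩-exp (pcase-cong₁ s ◅◅ pcase0 ◅ ε*) (hy P k)
  ... | inj₂ (inj₁ (h , k)) = let _ , _ , _ , s = ⊩ᴾ⇒⇓1 hx h in
    ⊩-exp (pcase-cong₁ s ◅◅ pcase1 ◅ ε*) (hz P k)
  ... | inj₂ (inj₂ k) = λ n bd → R-pcase n t (λ i → prime _ (proj₁ (k i)))
    (hy P (proj₁ ∘ k) n bd) (hz P (proj₂ ∘ k) n bd)

-- The fundamental lemma of the logical relation. The entries of `η` are arbitrary predicates, as
-- the abstraction case extends `η` by a possibly inconsistent one.
⟦⟧-⊩ᴾ : ∀ {s} → Γ ⊢ M ∶ τ → (∀ {i σ} → Γ ∋ i ∶ σ → [] ⊢ s i σ ∶ σ) →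
  (∀ {i σ} → Γ ∋ i ∶ σ → η i ⊩ᴾ s i σ) → ⟦ M ⟧ η ⊩ᴾ sub s M
⟦⟧-⊩ᴾ (tvar i) t h = h i
⟦⟧-⊩ᴾ {η = η} {s} (tlam {σ = σ} {M = M} k) t h = Pr-⊩ᴾ σ (⟦⟧-mono-∷ M η) λ N τ d tN prime hN →
  ⊩ᴾ-exp (β ◅ ε*) (subst (⟦ M ⟧ (d ∷ₑ η) ⊩ᴾ_) (sym (sub-lift-[] s M N))
    (⟦⟧-⊩ᴾ k (λ { here → arg tN ; (there i) → t i }) (λ { here → hN ; (there i) → h i })))
  where
  arg : [] ⊢ ƛ σ (sub (liftₛ s) M) · N ∶ τ → [] ⊢ N ∶ σ
  arg tN with _ , t₁ , t₂ ← app-inv tN with _ , _ , e ← lam-inv t₁ = tconv t₂ (≈-sym (proj₁ (⇒-inj e)))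
⟦⟧-⊩ᴾ (tapp k k′) t h = apS-⊩ᴾ (⟦⟧-⊩ᴾ k t h) (⟦⟧-⊩ᴾ k′ t h) (tapp (sub-⊢ t k) (sub-⊢ t k′))
⟦⟧-⊩ᴾ (tc0 {σ = a}) t h = Pr-⊩ᴾ a inj0-mono λ N τ d tN _ → injS-⊩ᴾ false
⟦⟧-⊩ᴾ (tc1 {τ = b}) t h = Pr-⊩ᴾ b inj1-mono λ N τ d tN _ → injS-⊩ᴾ true
⟦⟧-⊩ᴾ (tcase {σ = a} {b} {c}) t h =
  Pr-⊩ᴾ (a ⊕ b) mono₁ λ _ _ d _ _ hx → Pr-⊩ᴾ (a ⇒ c) (mono₂ d) λ _ _ e _ _ hy →
  Pr-⊩ᴾ (b ⇒ c) (mono₃ d e) λ _ _ f t _ hz → caseS-⊩ᴾ t hx hy hz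
  where open Case a b c
⟦⟧-⊩ᴾ (tpcase {σ = a} {b} {c}) t h =
  Pr-⊩ᴾ (a ⊕ b) mono₁ λ _ _ d _ _ hx → Pr-⊩ᴾ c (mono₂ d) λ _ _ e _ prime hy →
  Pr-⊩ᴾ c (mono₃ d e) λ _ _ f t _ hz → pcaseS-⊩ᴾ t hx hy hz prime
  where open PCase a b c
⟦⟧-⊩ᴾ (tpair {σ = a} {b}) t h =
  Pr-⊩ᴾ a mono₁ λ _ _ d _ _ hx → Pr-⊩ᴾ b (mono₂ d) λ _ _ e _ _ hy → pairS-⊩ᴾ hx hy
  where open Pair a b
⟦⟧-⊩ᴾ (tfst {σ = a} {b}) t h = Pr-⊩ᴾ (a ⊗ b) fstS-mono λ _ _ d _ _ → fstS-⊩ᴾ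
⟦⟧-⊩ᴾ (tsnd {σ = a} {b}) t h = Pr-⊩ᴾ (a ⊗ b) sndS-mono λ _ _ d _ _ → sndS-⊩ᴾ
⟦⟧-⊩ᴾ tΩ t h P u n _ = R-empty n u
⟦⟧-⊩ᴾ (tconv k e) t h = ⟦⟧-⊩ᴾ k t h

closed-⊩ᴾ : [] ⊢ M ∶ τ → ⟦ M ⟧ η ⊩ᴾ M
closed-⊩ᴾ {M} {η = η} h = subst (⟦ M ⟧ η ⊩ᴾ_) (sub-id {s = λ i σ → ` i ∶ σ} M λ _ _ → refl)
  (⟦⟧-⊩ᴾ h (λ ()) (λ ()))

adequate0 : [] ⊢ M ∶ τ → ⟦ M ⟧ η tag0 → M ⇓0
adequate0 h = ⊩ᴾ⇒⇓0 (closed-⊩ᴾ h)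

adequate1 : [] ⊢ M ∶ τ → ⟦ M ⟧ η tag1 → M ⇓1
adequate1 h = ⊩ᴾ⇒⇓1 (closed-⊩ᴾ h)

-- Definability

true₀ false₁ : Tm
true₀  = c0 void void · cΩ void
false₁ = c1 void void · cΩ void

⊢true₀ : Γ ⊢ true₀ ∶ bool
⊢true₀ = tapp tc0 tΩ

⊢false₁ : Γ ⊢ false₁ ∶ bool
⊢false₁ = tapp tc1 tΩ

⟦true₀⟧ : ∀ η → ⟦ true₀ ⟧ η ≐ inj0 (λ _ → ⊥)
⟦true₀⟧ η = apS-inj0 void (⊥-elem void)

⟦false₁⟧ : ∀ η → ⟦ false₁ ⟧ η ≐ inj1 (λ _ → ⊥)
⟦false₁⟧ η = apS-inj1 void (⊥-elem void)

infix 4 _⟺_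
_⟺_ : Set → Set → Set
A ⟺ B = (A → B) × (B → A)

Holds : REnv → Tm → Set
Holds η g = ⟦ g ⟧ η tag0

Guard : Set
Guard = Tm × Prm

-- g and g′ never hold together; S tells which of the two holds, and is unspecified otherwise.
Separated : Ctxt → Tm → Tm → Set₁
Separated Γ g g′ = Σ Tm λ S → Γ ⊢ S ∶ bool ×
  (∀ η → Valid Γ η → (Holds η g → ⟦ S ⟧ η tag0) × (Holds η g′ → ⟦ S ⟧ η tag1))

-- With one list empty this is an iterated parallel or: while `g` is undefined, `pcase` returns what
-- the constant branch and `D` share. With both lists nonempty, the separator of `g` and `h` chooses
-- which of the two guards is dropped.
decide : ∀ Γ A B → (∀ {g} → g ∈ A → Γ ⊢ g ∶ bool) → (∀ {g} → g ∈ B → Γ ⊢ g ∶ bool) →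
  (∀ {g h} → g ∈ A → h ∈ B → Separated Γ g h) → Σ Tm λ D → Γ ⊢ D ∶ bool × (∀ η → Valid Γ η →
  (⟦ D ⟧ η tag0 ⟺ Any (Holds η) A) × (⟦ D ⟧ η tag1 ⟺ Any (Holds η) B))
decide Γ [] [] tA tB sep = cΩ bool , tΩ , λ η v → ((λ ()) , λ ()) , ((λ ()) , λ ())
decide Γ (g ∷ A) [] tA tB sep with D , t , spec ← decide Γ A [] (tA ∘ there) tB (λ _ ()) =
  cpcase void void bool · g · true₀ · D , tapp (tapp (tapp tpcase (tA (here refl))) ⊢true₀) t , λ η v →
    let (to0 , from0) , (to1 , from1) = spec η v
        to , from = ⟦pcase⟧ v (tA (here refl)) ⊢true₀ t
    in ((λ h → case to tag0 h of λ
          { (inj₁ (h , _)) → here h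
          ; (inj₂ (inj₁ (_ , h))) → there (to0 h)
          ; (inj₂ (inj₂ (_ , h))) → there (to0 h) }) ,
        (λ { (here h) → from tag0 (inj₁ (h , proj₂ (⟦true₀⟧ η) tag0 tt))
           ; (there h) → from tag0 (inj₂ (inj₂ (proj₂ (⟦true₀⟧ η) tag0 tt , from0 h))) })) ,
       ((λ h → case to tag1 h of λ
          { (inj₁ (_ , h)) → ⊥-elim (proj₁ (⟦true₀⟧ η) tag1 h)
          ; (inj₂ (inj₁ (_ , h))) → to1 h
          ; (inj₂ (inj₂ (h , _))) → ⊥-elim (proj₁ (⟦true₀⟧ η) tag1 h) }) ,
        λ ())
decide Γ [] (g ∷ B) tA tB sep with D , t , spec ← decide Γ [] B tA (tB ∘ there) (λ ()) =
  cpcase void void bool · g · false₁ · D , tapp (tapp (tapp tpcase (tB (here refl))) ⊢false₁) t , λ η v →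
    let (to0 , from0) , (to1 , from1) = spec η v
        to , from = ⟦pcase⟧ v (tB (here refl)) ⊢false₁ t
    in ((λ h → case to tag0 h of λ
          { (inj₁ (_ , h)) → ⊥-elim (proj₁ (⟦false₁⟧ η) tag0 h)
          ; (inj₂ (inj₁ (_ , h))) → to0 h
          ; (inj₂ (inj₂ (h , _))) → ⊥-elim (proj₁ (⟦false₁⟧ η) tag0 h) }) ,
        λ ()) ,
       ((λ h → case to tag1 h of λ
          { (inj₁ (h , _)) → here h
          ; (inj₂ (inj₁ (_ , h))) → there (to1 h)
          ; (inj₂ (inj₂ (_ , h))) → there (to1 h) }) ,
        (λ { (here h) → from tag1 (inj₁ (h , proj₂ (⟦false₁⟧ η) tag1 tt))
           ; (there h) → from tag1 (inj₂ (inj₂ (proj₂ (⟦false₁⟧ η) tag1 tt , from1 h))) }))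
-- If neither g nor h holds then both recursive calls already decide correctly, so S may be
-- arbitrary there, even ⊥: pcase then returns the intersection of two equal results.
decide Γ (g ∷ A) (h ∷ B) tA tB sep
  with D₁ , t₁ , spec₁ ← decide Γ (g ∷ A) B tA (tB ∘ there) (λ i j → sep i (there j))
     | D₂ , t₂ , spec₂ ← decide Γ A (h ∷ B) (tA ∘ there) tB (λ i j → sep (there i) j)
     | S , t , specS ← sep (here refl) (here refl) =
  cpcase void void bool · S · D₁ · D₂ , tapp (tapp (tapp tpcase t) t₁) t₂ , λ η v →
    let (to0 , from0) , (to1 , from1) = spec₁ η v
        (to0′ , from0′) , (to1′ , from1′) = spec₂ η v
        s0 , s1 = specS η v
        to , from = ⟦pcase⟧ v t t₁ t₂
    in ((λ k → case to tag0 k of λ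
          { (inj₁ (_ , k)) → to0 k
          ; (inj₂ (inj₁ (_ , k))) → there (to0′ k)
          ; (inj₂ (inj₂ (k , _))) → to0 k }) ,
        (λ { (here k) → from tag0 (inj₁ (s0 k , from0 (here k)))
           ; (there k) → from tag0 (inj₂ (inj₂ (from0 (there k) , from0′ k))) })) ,
       ((λ k → case to tag1 k of λ
          { (inj₁ (_ , k)) → there (to1 k)
          ; (inj₂ (inj₁ (_ , k))) → to1′ k
          ; (inj₂ (inj₂ (_ , k))) → to1′ k }) ,
        (λ { (here k) → from tag1 (inj₂ (inj₁ (s1 k , from1′ (here k))))
           ; (there k) → from tag1 (inj₂ (inj₂ (from1 k , from1′ (there k)))) }))

conjunction : Γ ⊢ M ∶ bool → Γ ⊢ N ∶ bool → Σ Tm λ K → Γ ⊢ K ∶ bool ×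
  (∀ η → Valid Γ η → Holds η K ⟺ (Holds η M × Holds η N))
conjunction {Γ} {M} {N} t t′ =
  cpcase void void bool · M · N · cΩ bool , tapp (tapp (tapp tpcase t) t′) tΩ , spec
  where
  spec : ∀ η → Valid Γ η → Holds η (cpcase void void bool · M · N · cΩ bool) ⟺ (Holds η M × Holds η N)
  spec η v = (λ h → case proj₁ (⟦pcase⟧ v t t′ tΩ) tag0 h of λ
    { (inj₁ h) → h ; (inj₂ (inj₁ (_ , ()))) ; (inj₂ (inj₂ (_ , ()))) }) ,
    (λ h → proj₂ (⟦pcase⟧ v t t′ tΩ) tag0 (inj₁ h))

out0 : Type → Type → Tm → Tm
out0 a b M = ccase a b a · M · ƛ a (` 0 ∶ a) · ƛ b (cΩ a)

out1 : Type → Type → Tm → Tm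
out1 a b M = ccase a b b · M · ƛ a (cΩ b) · ƛ b (` 0 ∶ b)

⊢out0 : Γ ⊢ M ∶ a ⊕ b → Γ ⊢ out0 a b M ∶ a
⊢out0 t = tapp (tapp (tapp tcase t) (tlam (tvar here))) (tlam tΩ)

⊢out1 : Γ ⊢ M ∶ a ⊕ b → Γ ⊢ out1 a b M ∶ b
⊢out1 t = tapp (tapp (tapp tcase t) (tlam tΩ)) (tlam (tvar here))

⟦out0⟧ : Valid Γ η → Γ ⊢ M ∶ a ⊕ b → ⟦ out0 a b M ⟧ η ≐ (λ p → ⟦ M ⟧ η (in0 p))
⟦out0⟧ {η = η} {M} {a} {b} v t =
  ≐-trans (⟦case⟧ v t (tlam (tvar here)) (tlam tΩ)) (to , from)
  where
  E = ⟦⟧-elem t v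
  id-eq = apS-ƛ (` 0 ∶ a) η (out0-elem a b E)

  to : caseS (⟦ M ⟧ η) (⟦ ƛ a (` 0 ∶ a) ⟧ η) (⟦ ƛ b (cΩ a) ⟧ η) ⊆ (λ p → ⟦ M ⟧ η (in0 p))
  to p (inj₁ (_ , h)) = proj₁ id-eq p h
  to p (inj₂ (_ , h)) = ⊥-elim (proj₁ (apS-ƛ (cΩ a) η (out1-elem a b E)) p h)

  from : (λ p → ⟦ M ⟧ η (in0 p)) ⊆ caseS (⟦ M ⟧ η) (⟦ ƛ a (` 0 ∶ a) ⟧ η) (⟦ ƛ b (cΩ a) ⟧ η)
  -- Downward closure puts the tag below `in0 p` into the value, so `case` takes the left branch.
  from p h = inj₁ (proj₁ (proj₂ E) tag0 (in0 p) tt tt h , proj₂ id-eq p h)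

⟦out1⟧ : Valid Γ η → Γ ⊢ M ∶ a ⊕ b → ⟦ out1 a b M ⟧ η ≐ (λ p → ⟦ M ⟧ η (in1 p))
⟦out1⟧ {η = η} {M} {a} {b} v t =
  ≐-trans (⟦case⟧ v t (tlam tΩ) (tlam (tvar here))) (to , from)
  where
  E = ⟦⟧-elem t v
  id-eq = apS-ƛ (` 0 ∶ b) η (out1-elem a b E)

  to : caseS (⟦ M ⟧ η) (⟦ ƛ a (cΩ b) ⟧ η) (⟦ ƛ b (` 0 ∶ b) ⟧ η) ⊆ (λ p → ⟦ M ⟧ η (in1 p))
  to p (inj₁ (_ , h)) = ⊥-elim (proj₁ (apS-ƛ (cΩ b) η (out0-elem a b E)) p h)
  to p (inj₂ (_ , h)) = proj₁ id-eq p h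

  from : (λ p → ⟦ M ⟧ η (in1 p)) ⊆ caseS (⟦ M ⟧ η) (⟦ ƛ a (cΩ b) ⟧ η) (⟦ ƛ b (` 0 ∶ b) ⟧ η)
  from p h = inj₂ (proj₁ (proj₂ E) tag1 (in1 p) tt tt h , proj₂ id-eq p h)

-- The supremum of the primes whose guards hold in `η`. It is consistent for lists satisfying
-- `Guarded`.
join : Type → List Guard → REnv → Pred
join τ L η p = IsPrime τ p × ∃ λ l → l ∈ L × Holds η (proj₁ l) × Leq τ p (proj₂ l)

Definable : Ctxt → Type → List Guard → Set₁
Definable Γ τ L = Σ Tm λ M → Γ ⊢ M ∶ τ × (∀ η → Valid Γ η → ⟦ M ⟧ η ≐ join τ L η)

record Guarded (Γ : Ctxt) (τ : Type) (m : ℕ) (L : List Guard) : Set₁ where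
  field
    typed     : ∀ {l} → l ∈ L → Γ ⊢ proj₁ l ∶ bool
    prime     : ∀ {l} → l ∈ L → IsPrime τ (proj₂ l)
    bound     : ∀ {l} → l ∈ L → depth (proj₂ l) ≤ m
    separated : ∀ {l l′} → l ∈ L → l′ ∈ L →
      Con τ (proj₂ l) (proj₂ l′) ⊎ Separated Γ (proj₁ l) (proj₁ l′)
open Guarded

Defines : ℕ → Set₁
Defines m = ∀ Γ τ L → Guarded Γ τ m L → Definable Γ τ L

-- Stated for a term in context instead of a function into `bool`, so that descending to a component
-- of a prime just replaces `M` by a projection or an application of it.
Test : Ctxt → Tm → Prm → Set₁
Test Γ M p = Σ Tm λ t → Γ ⊢ t ∶ bool × (∀ η → Valid Γ η → Holds η t ⟺ ⟦ M ⟧ η p)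

Tests : ℕ → Set₁
Tests m = ∀ Γ σ p M → Γ ⊢ M ∶ σ → IsPrime σ p → depth p ≤ m → Test Γ M p

Separator : Ctxt → Tm → Prm → Prm → Set₁
Separator Γ M p q = Σ Tm λ S → Γ ⊢ S ∶ bool ×
  (∀ η → Valid Γ η → (⟦ M ⟧ η p → ⟦ S ⟧ η tag0) × (⟦ M ⟧ η q → ⟦ S ⟧ η tag1))

Separates : ℕ → Set₁
Separates m = ∀ Γ σ p q M → Γ ⊢ M ∶ σ → IsPrime σ p → IsPrime σ q → depth p ≤ m → depth q ≤ m →
  ¬ Con σ p q → Separator Γ M p q

Guarded-≈ : ∀ {m L} → σ ≈ τ → Guarded Γ σ m L → Guarded Γ τ m L
Guarded-≈ e G = record
  { typed = typed G
  ; prime = λ {l} i → IsPrime-≈ (proj₂ l) e (prime G i)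
  ; bound = bound G
  ; separated = λ {l} {l′} i j → case separated G i j of λ
      { (inj₁ c) → inj₁ (Con-≈ (proj₂ l) (proj₂ l′) e c) ; (inj₂ s) → inj₂ s } }

Definable-≈ : ∀ {L} → σ ≈ τ → Definable Γ σ L → Definable Γ τ L
Definable-≈ e (M , t , spec) = M , tconv t e , λ η v → ≐-trans (spec η v)
  ( (λ { p (h , l , i , g , k) → IsPrime-≈ p e h , l , i , g , Leq-≈ p (proj₂ l) e k })
  , (λ { p (h , l , i , g , k) → IsPrime-≈ p (≈-sym e) h , l , i , g , Leq-≈ p (proj₂ l) (≈-sym e) k }))

-- The `tag0` and `tag1` returned by the last two are placeholders: from those selections only the
-- guards are kept.
in0? in1? pr0? pr1? 0tagged? 1tagged? : Prm → Maybe Prm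
in0? (in0 p) = just p
in0? _       = nothing
in1? (in1 p) = just p
in1? _       = nothing
pr0? (pr0 p) = just p
pr0? _       = nothing
pr1? (pr1 p) = just p
pr1? _       = nothing
0tagged? tag0    = just tag0
0tagged? (in0 p) = just tag0
0tagged? _       = nothing
1tagged? tag1    = just tag1
1tagged? (in1 p) = just tag1
1tagged? _       = nothing

select : (Prm → Maybe Prm) → List Guard → List Guard
select u [] = []
select u ((g , x) ∷ L) with u x
... | just p  = (g , p) ∷ select u L
... | nothing = select u L

select⁺ : ∀ u L {g} → (g , x) ∈ L → u x ≡ just p → (g , p) ∈ select u L
select⁺ u ((g , x) ∷ L) (here refl) eq rewrite eq = here refl
select⁺ u ((g , x) ∷ L) (there i) eq with u x
... | just _  = there (select⁺ u L i eq)
... | nothing = select⁺ u L i eq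

select⁻ : ∀ u L {g} → (g , p) ∈ select u L → ∃ λ x → (g , x) ∈ L × u x ≡ just p
select⁻ u ((g , x) ∷ L) i with u x in eq
select⁻ u ((g , x) ∷ L) (here refl) | just p = x , here refl , eq
select⁻ u ((g , x) ∷ L) (there i) | just p with y , j , e ← select⁻ u L i = y , there j , e
select⁻ u ((g , x) ∷ L) i | nothing with y , j , e ← select⁻ u L i = y , there j , e

in0?-just : ∀ x → in0? x ≡ just p → x ≡ in0 p
in0?-just (in0 p) refl = refl

in1?-just : ∀ x → in1? x ≡ just p → x ≡ in1 p
in1?-just (in1 p) refl = refl

pr0?-just : ∀ x → pr0? x ≡ just p → x ≡ pr0 p
pr0?-just (pr0 p) refl = refl

pr1?-just : ∀ x → pr1? x ≡ just p → x ≡ pr1 p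
pr1?-just (pr1 p) refl = refl

0tagged?-just : ∀ x → 0tagged? x ≡ just p → Tagged false x
0tagged?-just tag0 e = tag0
0tagged?-just (in0 x) e = in0

1tagged?-just : ∀ x → 1tagged? x ≡ just p → Tagged true x
1tagged?-just tag1 e = tag1
1tagged?-just (in1 x) e = in1

tagged-¬Con : Tagged false x → Tagged true y → ¬ Con (a ⊕ b) x y
tagged-¬Con tag0 tag1 h = h
tagged-¬Con tag0 in1 h = h
tagged-¬Con in0 tag1 h = h
tagged-¬Con in0 in1 h = h

tag0≤ : Tagged false x → Leq (a ⊕ b) tag0 x
tag0≤ tag0 = tt
tag0≤ in0 = tt

tag1≤ : Tagged true x → Leq (a ⊕ b) tag1 x
tag1≤ tag1 = tt
tag1≤ in1 = tt

Guarded-select : ∀ {m L} τ a u (c : Prm → Prm) → (∀ {p} x → u x ≡ just p → x ≡ c p) →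
  (∀ p → IsPrime τ (c p) → IsPrime a p) → (∀ p → depth (c p) ≤ suc m → depth p ≤ m) →
  (∀ p q → Con τ (c p) (c q) → Con a p q) → Guarded Γ τ (suc m) L → Guarded Γ a m (select u L)
Guarded-select {Γ} {m} {L} τ a u c inv pr dp cn G = record
  { typed = λ i → typed G (entry i)
  ; prime = λ {l} i → pr (proj₂ l) (prime G (entry i))
  ; bound = λ {l} i → dp (proj₂ l) (bound G (entry i))
  ; separated = λ {l} {l′} i j → case separated G (entry i) (entry j) of λ
      { (inj₁ k) → inj₁ (cn (proj₂ l) (proj₂ l′) k) ; (inj₂ s) → inj₂ s } }
  where
  entry : ∀ {l} → l ∈ select u L → (proj₁ l , c (proj₂ l)) ∈ L
  entry i with x , j , e ← select⁻ u L i with refl ← inv x e = j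

-- The induction step on the depth of primes

module Step (m : ℕ) (define : Defines m) (test : Tests m) (separate : Separates m) where

  define-⊗ : ∀ Γ a b L → Guarded Γ (a ⊗ b) (suc m) L → Definable Γ (a ⊗ b) L
  define-⊗ Γ a b L G
    with M₀ , t₀ , spec₀ ← define Γ a (select pr0? L) (Guarded-select (a ⊗ b) a pr0? pr0
           pr0?-just (λ _ h → h) (λ _ → s≤s⁻¹) (λ _ _ h → h) G)
       | M₁ , t₁ , spec₁ ← define Γ b (select pr1? L) (Guarded-select (a ⊗ b) b pr1? pr1
           pr1?-just (λ _ h → h) (λ _ → s≤s⁻¹) (λ _ _ h → h) G) =
    cpair a b · M₀ · M₁ , tapp (tapp tpair t₀) t₁ , λ η v →
      ≐-trans (⟦pair⟧ v t₀ t₁) (to η v , from η v)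
    where
    to : ∀ η → Valid Γ η → pairS (⟦ M₀ ⟧ η) (⟦ M₁ ⟧ η) ⊆ join (a ⊗ b) L η
    to η v (pr0 p) h with h′ , (g , q) , i , k , l ← proj₁ (spec₀ η v) p h
      with x , j , e ← select⁻ pr0? L i with refl ← pr0?-just x e = h′ , (g , pr0 q) , j , k , l
    to η v (pr1 p) h with h′ , (g , q) , i , k , l ← proj₁ (spec₁ η v) p h
      with x , j , e ← select⁻ pr1? L i with refl ← pr1?-just x e = h′ , (g , pr1 q) , j , k , l

    from : ∀ η → Valid Γ η → join (a ⊗ b) L η ⊆ pairS (⟦ M₀ ⟧ η) (⟦ M₁ ⟧ η)
    from η v (pr0 p) (h , (g , pr0 q) , i , k , l) =
      proj₂ (spec₀ η v) p (h , (g , q) , select⁺ pr0? L i refl , k , l)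
    from η v (pr1 p) (h , (g , pr1 q) , i , k , l) =
      proj₂ (spec₁ η v) p (h , (g , q) , select⁺ pr1? L i refl , k , l)

  -- Primes with different tags are inconsistent, so their guards are separated and `decide`
  -- computes the tag from the guards. While `D` is undefined the two injections share no prime, and
  -- the result is ⊥ as it should be.
  define-⊕ : ∀ Γ a b L → Guarded Γ (a ⊕ b) (suc m) L → Definable Γ (a ⊕ b) L
  define-⊕ Γ a b L G =
    cpcase void void (a ⊕ b) · D · (c0 a b · M₀) · (c1 a b · M₁) ,
    tapp (tapp (tapp tpcase tD) (tapp tc0 t₀)) (tapp tc1 t₁) , λ η v →
      ≐-trans (⟦pcase⟧ v tD (tapp tc0 t₀) (tapp tc1 t₁)) (to η v , from η v)
    where
    A = map proj₁ (select 0tagged? L)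
    B = map proj₁ (select 1tagged? L)

    A⁻ : ∀ {g} → g ∈ A → ∃ λ x → (g , x) ∈ L × Tagged false x
    A⁻ i with (g , _) , j , refl ← ∈-map⁻ proj₁ i with x , k , e ← select⁻ 0tagged? L j =
      x , k , 0tagged?-just x e

    B⁻ : ∀ {g} → g ∈ B → ∃ λ x → (g , x) ∈ L × Tagged true x
    B⁻ i with (g , _) , j , refl ← ∈-map⁻ proj₁ i with x , k , e ← select⁻ 1tagged? L j =
      x , k , 1tagged?-just x e

    sep : ∀ {g h} → g ∈ A → h ∈ B → Separated Γ g h
    sep i j with x , i′ , T ← A⁻ i | y , j′ , U ← B⁻ j with separated G i′ j′
    ... | inj₁ c = ⊥-elim (tagged-¬Con {a = a} {b} T U c)
    ... | inj₂ s = s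

    dec = decide Γ A B (λ i → typed G (proj₁ (proj₂ (A⁻ i)))) (λ i → typed G (proj₁ (proj₂ (B⁻ i)))) sep
    def₀ = define Γ a (select in0? L) (Guarded-select (a ⊕ b) a in0? in0
      in0?-just (λ _ h → h) (λ _ → s≤s⁻¹) (λ _ _ h → h) G)
    def₁ = define Γ b (select in1? L) (Guarded-select (a ⊕ b) b in1? in1
      in1?-just (λ _ h → h) (λ _ → s≤s⁻¹) (λ _ _ h → h) G)
    D = proj₁ dec
    M₀ = proj₁ def₀
    M₁ = proj₁ def₁
    tD = proj₁ (proj₂ dec)
    t₀ = proj₁ (proj₂ def₀)
    t₁ = proj₁ (proj₂ def₁)

    0branch : ∀ η → Valid Γ η → ⟦ c0 a b · M₀ ⟧ η ≐ inj0 (⟦ M₀ ⟧ η)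
    0branch η v = ⟦c0⟧ v t₀

    1branch : ∀ η → Valid Γ η → ⟦ c1 a b · M₁ ⟧ η ≐ inj1 (⟦ M₁ ⟧ η)
    1branch η v = ⟦c1⟧ v t₁

    ∅ : ∀ {d e} p → inj0 d p → inj1 e p → ⊥
    ∅ tag0 h ()
    ∅ (in0 p) h ()

    join0 : ∀ η → Valid Γ η → ∀ p → ⟦ D ⟧ η tag0 → inj0 (⟦ M₀ ⟧ η) p → join (a ⊕ b) L η p
    join0 η v tag0 h _ with g , i , k ← find (proj₁ (proj₁ (proj₂ (proj₂ dec) η v)) h)
      with x , j , T ← A⁻ i = tt , (g , x) , j , k , tag0≤ {a = a} {b} T
    join0 η v (in0 p) h h′ with h″ , (g , q) , i , k , l ← proj₁ (proj₂ (proj₂ def₀) η v) p h′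
      with x , j , e ← select⁻ in0? L i with refl ← in0?-just x e = h″ , (g , in0 q) , j , k , l

    join1 : ∀ η → Valid Γ η → ∀ p → ⟦ D ⟧ η tag1 → inj1 (⟦ M₁ ⟧ η) p → join (a ⊕ b) L η p
    join1 η v tag1 h _ with g , i , k ← find (proj₁ (proj₂ (proj₂ (proj₂ dec) η v)) h)
      with x , j , T ← B⁻ i = tt , (g , x) , j , k , tag1≤ {a = a} {b} T
    join1 η v (in1 p) h h′ with h″ , (g , q) , i , k , l ← proj₁ (proj₂ (proj₂ def₁) η v) p h′
      with x , j , e ← select⁻ in1? L i with refl ← in1?-just x e = h″ , (g , in1 q) , j , k , l

    to : ∀ η → Valid Γ η →
      pcaseS (⟦ D ⟧ η) (⟦ c0 a b · M₀ ⟧ η) (⟦ c1 a b · M₁ ⟧ η) ⊆ join (a ⊕ b) L η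
    to η v p (inj₁ (h , h′)) = join0 η v p h (proj₁ (0branch η v) p h′)
    to η v p (inj₂ (inj₁ (h , h′))) = join1 η v p h (proj₁ (1branch η v) p h′)
    to η v p (inj₂ (inj₂ (h , h′))) =
      ⊥-elim (∅ p (proj₁ (0branch η v) p h) (proj₁ (1branch η v) p h′))

    holds0 : ∀ η → Valid Γ η → ∀ {g x q} → (g , x) ∈ L → 0tagged? x ≡ just q → Holds η g → ⟦ D ⟧ η tag0
    holds0 η v i e k = proj₂ (proj₁ (proj₂ (proj₂ dec) η v)) (lose (∈-map⁺ proj₁ (select⁺ 0tagged? L i e)) k)

    holds1 : ∀ η → Valid Γ η → ∀ {g x q} → (g , x) ∈ L → 1tagged? x ≡ just q → Holds η g → ⟦ D ⟧ η tag1
    holds1 η v i e k = proj₂ (proj₂ (proj₂ (proj₂ dec) η v)) (lose (∈-map⁺ proj₁ (select⁺ 1tagged? L i e)) k)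

    from : ∀ η → Valid Γ η →
      join (a ⊕ b) L η ⊆ pcaseS (⟦ D ⟧ η) (⟦ c0 a b · M₀ ⟧ η) (⟦ c1 a b · M₁ ⟧ η)
    from η v tag0 (_ , (g , tag0) , i , k , l) =
      inj₁ (holds0 η v i refl k , proj₂ (0branch η v) tag0 tt)
    from η v tag0 (_ , (g , in0 q) , i , k , l) =
      inj₁ (holds0 η v i refl k , proj₂ (0branch η v) tag0 tt)
    from η v (in0 p) (h , (g , in0 q) , i , k , l) =
      inj₁ (holds0 η v i refl k , proj₂ (0branch η v) (in0 p)
        (proj₂ (proj₂ (proj₂ def₀) η v) p (h , (g , q) , select⁺ in0? L i refl , k , l)))
    from η v tag1 (_ , (g , tag1) , i , k , l) =
      inj₂ (inj₁ (holds1 η v i refl k , proj₂ (1branch η v) tag1 tt))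
    from η v tag1 (_ , (g , in1 q) , i , k , l) =
      inj₂ (inj₁ (holds1 η v i refl k , proj₂ (1branch η v) tag1 tt))
    from η v (in1 p) (h , (g , in1 q) , i , k , l) =
      inj₂ (inj₁ (holds1 η v i refl k , proj₂ (1branch η v) (in1 p)
        (proj₂ (proj₂ (proj₂ def₁) η v) p (h , (g , q) , select⁺ in1? L i refl , k , l))))

  testAll : ∀ Γ σ M g → Γ ⊢ M ∶ σ → Γ ⊢ g ∶ bool → ∀ Y → (∀ {y} → y ∈ Y → IsPrime σ y × depth y ≤ m) →
    Σ Tm λ t → Γ ⊢ t ∶ bool ×
      (∀ η → Valid Γ η → Holds η t ⟺ (Holds η g × (∀ {y} → y ∈ Y → ⟦ M ⟧ η y)))
  testAll Γ σ M g tM tg [] h = g , tg , λ η v → (λ k → k , λ ()) , proj₁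
  testAll Γ σ M g tM tg (y ∷ Y) h
    with t₁ , ty₁ , spec₁ ← test Γ σ y M tM (proj₁ (h (here refl))) (proj₂ (h (here refl)))
       | t₂ , ty₂ , spec₂ ← testAll Γ σ M g tM tg Y (h ∘ there)
    with t , ty , spec ← conjunction ty₁ ty₂ = t , ty , λ η v →
      (λ k → let k₁ , k₂ = proj₁ (spec η v) k ; kg , kY = proj₁ (spec₂ η v) k₂ in
         kg , λ { (here refl) → proj₁ (spec₁ η v) k₁ ; (there i) → kY i }) ,
      (λ (kg , kY) → proj₂ (spec η v)
         (proj₂ (spec₁ η v) (kY (here refl)) , proj₂ (spec₂ η v) (kg , λ {y} i → kY {y} (there i))))

  -- Below the abstraction an entry `(g, fun Y c)` becomes `(g′, c)`, where `g′` says that `g` holds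
  -- and that the bound variable contains all of `Y`. Tests for `Y` exist by the induction
  -- hypothesis, and the new list is again guarded one level down.
  define-⇒ : ∀ Γ a b L → Guarded Γ (a ⇒ b) (suc m) L → Definable Γ (a ⇒ b) L
  define-⇒ Γ a b L G = ƛ a (proj₁ def) , tlam (proj₁ (proj₂ def)) , λ η v → to η v , from η v
    where
    record Under (l l′ : Guard) : Set₁ where
      field
        dom   : List Prm
        shape : proj₂ l ≡ fun dom (proj₂ l′)
        ⊢g    : (a ∷ Γ) ⊢ proj₁ l′ ∶ bool
        spec  : ∀ η → Valid (a ∷ Γ) η →
          Holds η (proj₁ l′) ⟺ (Holds (η ∘ suc) (proj₁ l) × (∀ {y} → y ∈ dom → η 0 y))
    open Under

    under : ∀ {l} → l ∈ L → Σ Guard (Under l)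
    under {g , x} i with x | prime G i | bound G i
    ... | fun Y c | hY , hc | bd
      with t , ty , sp ← testAll (a ∷ Γ) a (` 0 ∶ a) (ren suc g) (tvar here)
             (ren-⊢ there (typed G i)) Y
             (λ j → PrimeSet⇒prime a Y hY j , fun-argsDepth Y c bd j) =
      (t , c) , record
        { dom = Y ; shape = refl ; ⊢g = ty
        ; spec = λ η v → let ren→ , ren← = ⟦ren⟧ {η = η} {r = suc} g (λ _ → ≐-refl) in
            (λ k → let k₁ , k₂ = proj₁ (sp η v) k in ren→ tag0 k₁ , λ {y} → k₂ {y}) ,
            (λ (k₁ , k₂) → proj₂ (sp η v) (ren← tag0 k₁ , λ {y} → k₂ {y})) }

    chosen = choose {P = Under} L under
    L′ = proj₁ chosen

    back : ∀ {l′} → l′ ∈ L′ → Σ Guard λ l → l ∈ L × Under l l′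
    back = proj₂ (proj₂ chosen)

    G′ : Guarded (a ∷ Γ) b m L′
    G′ = record
      { typed = λ i → ⊢g (proj₂ (proj₂ (back i)))
      ; prime = λ i → prime′ (back i)
      ; bound = λ i → bound′ (back i)
      ; separated = λ i j → separated′ (back i) (back j) }
      where
      prime′ : ∀ {l′} → (Σ Guard λ l → l ∈ L × Under l l′) → IsPrime b (proj₂ l′)
      prime′ (l , i , u) with h ← prime G i rewrite shape u = proj₂ h

      bound′ : ∀ {l′} → (Σ Guard λ l → l ∈ L × Under l l′) → depth (proj₂ l′) ≤ m
      bound′ {l′} (l , i , u) with h ← bound G i rewrite shape u = fun-resultDepth (dom u) (proj₂ l′) h

      domain : ∀ {l l′} (i : l ∈ L) (u : Under l l′) → PrimeSet a (dom u)
      domain i u with h ← prime G i rewrite shape u = proj₁ h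

      domain-depth : ∀ {l l′} (i : l ∈ L) (u : Under l l′) → ∀ {y} → y ∈ dom u → depth y ≤ m
      domain-depth {l′ = l′} i u j with h ← bound G i rewrite shape u = fun-argsDepth (dom u) (proj₂ l′) h j

      separated′ : ∀ {l′ k′} → (Σ Guard λ l → l ∈ L × Under l l′) → (Σ Guard λ k → k ∈ L × Under k k′) →
        Con b (proj₂ l′) (proj₂ k′) ⊎ Separated (a ∷ Γ) (proj₁ l′) (proj₁ k′)
      separated′ {l′} {k′} (l , i , u) (k , j , w) with separated G i j
      ... | inj₂ (S , tS , sp) = inj₂ (ren suc S , ren-⊢ there tS , λ η v →
        let ren→ , ren← = ⟦ren⟧ {η = η} {r = suc} S (λ _ → ≐-refl)
            s0 , s1 = sp (η ∘ suc) (Valid-tail v)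
        in (λ h → ren← tag0 (s0 (proj₁ (proj₁ (spec u η v) h)))) ,
           (λ h → ren← tag1 (s1 (proj₁ (proj₁ (spec w η v) h)))))
      -- Consistent function primes have consistent results once their domains are consistent.
      -- Otherwise the domains contain inconsistent `x` and `y`, and a separator of these on the
      -- bound variable separates the new guards.
      ... | inj₁ c with ConAll⊎ a (dom u) (dom w)
      ... | inj₁ all rewrite shape u | shape w = inj₁
        (Con-fun⁻ a b (dom u) (proj₂ l′) (dom w) (proj₂ k′) c
          (PrimeSet⇒ConAll a (dom u) (domain i u)) all (PrimeSet⇒ConAll a (dom w) (domain j w)))
      ... | inj₂ (x , y , ix , iy , ¬c)
        with S , tS , sp ← separate (a ∷ Γ) a x y (` 0 ∶ a) (tvar here)
               (PrimeSet⇒prime a (dom u) (domain i u) ix) (PrimeSet⇒prime a (dom w) (domain j w) iy)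
               (domain-depth i u ix) (domain-depth j w iy) ¬c =
        inj₂ (S , tS , λ η v → let s0 , s1 = sp η v in
          (λ h → s0 (proj₂ (proj₁ (spec u η v) h) ix)) , (λ h → s1 (proj₂ (proj₁ (spec w η v) h) iy)))

    def = define (a ∷ Γ) b L′ G′

    valid : ∀ {η X} → Valid Γ η → PrimeSet a X → Valid (a ∷ Γ) (down a X ∷ₑ η)
    valid {X = X} v ps = Valid-∷ (down-primeSet a X ps) v

    to : ∀ η → Valid Γ η → ⟦ ƛ a (proj₁ def) ⟧ η ⊆ join (a ⇒ b) L η
    to η v (fun X c) (ps , h)
      with hc , l′ , i , k , le ← proj₁ (proj₂ (proj₂ def) _ (valid v ps)) c h
      with l , j , u ← back i with kg , kY ← proj₁ (spec u _ (valid v ps)) k =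
      (ps , hc) , l , j , kg , subst (Leq (a ⇒ b) (fun X c)) (sym (shape u))
        (le , AllAny⁺ a (dom u) X (λ iy → proj₂ (kY iy)))

    from : ∀ η → Valid Γ η → join (a ⇒ b) L η ⊆ ⟦ ƛ a (proj₁ def) ⟧ η
    from η v (fun X c) ((ps , hc) , l , i , k , le) with l′ , j , u ← proj₁ (proj₂ chosen) i
      with le′ , lY ← subst (Leq (a ⇒ b) (fun X c)) (shape u) le
         | hY , _ ← subst (IsPrime (a ⇒ b)) (shape u) (prime G i) =
      ps , proj₂ (proj₂ (proj₂ def) _ (valid v ps)) c
        (hc , l′ , j , proj₂ (spec u _ (valid v ps)) (k , λ {y} iy →
          PrimeSet⇒prime a (dom u) hY iy , AllAny⁻ a (dom u) X lY iy) , le′)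

  define-empty : ∀ Γ τ L → (∀ p → ¬ IsPrime τ p) → Definable Γ τ L
  define-empty Γ τ L ¬h = cΩ τ , tΩ , λ η v → (λ p ()) , λ p (h , _) → ⊥-elim (¬h p h)

  define-head : ∀ Γ τ L → Guarded Γ τ (suc m) L → ∀ H → head τ ≡ H → Definable Γ τ L
  define-head Γ τ L G voidH eq = define-empty Γ τ L λ p h → subst (λ H → IsPrimeH H p) eq h
  define-head Γ τ L G loopH eq = define-empty Γ τ L λ p h → subst (λ H → IsPrimeH H p) eq h
  define-head Γ τ L G (sumH a b) eq =
    Definable-≈ (≈-sym (head≡⇒≈ eq)) (define-⊕ Γ a b L (Guarded-≈ (head≡⇒≈ eq) G))
  define-head Γ τ L G (prodH a b) eq =
    Definable-≈ (≈-sym (head≡⇒≈ eq)) (define-⊗ Γ a b L (Guarded-≈ (head≡⇒≈ eq) G))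
  define-head Γ τ L G (arrH a b) eq =
    Definable-≈ (≈-sym (head≡⇒≈ eq)) (define-⇒ Γ a b L (Guarded-≈ (head≡⇒≈ eq) G))

  define-suc : Defines (suc m)
  define-suc Γ τ L G = define-head Γ τ L G (head τ) refl

  -- With all guards equal to `true₀` the join is unconditional, and consistency of `X` replaces
  -- separation. These are the arguments to which functions are applied in tests and separators.
  define-↓ : ∀ Γ a X → (∀ {x} → x ∈ X → IsPrime a x) → (∀ {x} → x ∈ X → depth x ≤ m) → ConAll a X X →
    Σ Tm λ D → Γ ⊢ D ∶ a × (∀ η → Valid Γ η → ⟦ D ⟧ η ≐ down a X)
  define-↓ Γ a X hX bX cX with D , t , spec ← define Γ a (map (true₀ ,_) X) (record
      { typed = λ i → case ∈-map⁻ (true₀ ,_) i of λ { (x , j , refl) → ⊢true₀ }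
      ; prime = λ i → case ∈-map⁻ (true₀ ,_) i of λ { (x , j , refl) → hX j }
      ; bound = λ i → case ∈-map⁻ (true₀ ,_) i of λ { (x , j , refl) → bX j }
      ; separated = λ i j → case ∈-map⁻ (true₀ ,_) i of λ { (x , i′ , refl) → case ∈-map⁻ (true₀ ,_) j of λ
          { (y , j′ , refl) → inj₁ (cX i′ j′) } } }) =
    D , t , λ η v → ≐-trans (spec η v)
      ( (λ { p (h , l , i , _ , le) → case ∈-map⁻ (true₀ ,_) i of λ { (x , j , refl) → h , AnyLeq⁺ a p j le } })
      , (λ p (h , le) → let x , i , le′ = AnyLeq⁻ a p X le in
           h , (true₀ , x) , ∈-map⁺ (true₀ ,_) i , proj₂ (⟦true₀⟧ η) tag0 tt , le′))

  tagTest : ∀ Γ a b M → Γ ⊢ M ∶ a ⊕ b → Σ Tm λ t → Γ ⊢ t ∶ bool ×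
    (∀ η → Valid Γ η → (Holds η t ⟺ ⟦ M ⟧ η tag0) × (⟦ t ⟧ η tag1 ⟺ ⟦ M ⟧ η tag1))
  tagTest Γ a b M tM = cpcase a b bool · M · true₀ · false₁ ,
    tapp (tapp (tapp tpcase tM) ⊢true₀) ⊢false₁ , λ η v →
    let to , from = ⟦pcase⟧ v tM ⊢true₀ ⊢false₁ in
    ((λ h → case to tag0 h of λ
        { (inj₁ (k , _)) → k
        ; (inj₂ (inj₁ (_ , k))) → ⊥-elim (proj₁ (⟦false₁⟧ η) tag0 k)
        ; (inj₂ (inj₂ (_ , k))) → ⊥-elim (proj₁ (⟦false₁⟧ η) tag0 k) }) ,
     (λ h → from tag0 (inj₁ (h , proj₂ (⟦true₀⟧ η) tag0 tt)))) ,
    ((λ h → case to tag1 h of λ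
        { (inj₁ (_ , k)) → ⊥-elim (proj₁ (⟦true₀⟧ η) tag1 k)
        ; (inj₂ (inj₁ (k , _))) → k
        ; (inj₂ (inj₂ (k , _))) → ⊥-elim (proj₁ (⟦true₀⟧ η) tag1 k) }) ,
     (λ h → from tag1 (inj₂ (inj₁ (h , proj₂ (⟦false₁⟧ η) tag1 tt)))))

  swap : Γ ⊢ M ∶ bool → Σ Tm λ t → Γ ⊢ t ∶ bool ×
    (∀ η → Valid Γ η → (Holds η t ⟺ ⟦ M ⟧ η tag1) × (⟦ t ⟧ η tag1 ⟺ Holds η M))
  swap {M = M} tM = cpcase void void bool · M · false₁ · true₀ ,
    tapp (tapp (tapp tpcase tM) ⊢false₁) ⊢true₀ , λ η v →
    let to , from = ⟦pcase⟧ v tM ⊢false₁ ⊢true₀ in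
    ((λ h → case to tag0 h of λ
        { (inj₁ (_ , k)) → ⊥-elim (proj₁ (⟦false₁⟧ η) tag0 k)
        ; (inj₂ (inj₁ (k , _))) → k
        ; (inj₂ (inj₂ (k , _))) → ⊥-elim (proj₁ (⟦false₁⟧ η) tag0 k) }) ,
     (λ h → from tag0 (inj₂ (inj₁ (h , proj₂ (⟦true₀⟧ η) tag0 tt))))) ,
    ((λ h → case to tag1 h of λ
        { (inj₁ (k , _)) → k
        ; (inj₂ (inj₁ (_ , k))) → ⊥-elim (proj₁ (⟦true₀⟧ η) tag1 k)
        ; (inj₂ (inj₂ (_ , k))) → ⊥-elim (proj₁ (⟦true₀⟧ η) tag1 k) }) ,
     (λ h → from tag1 (inj₁ (h , proj₂ (⟦false₁⟧ η) tag1 tt))))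

  -- (X , p) ∈ f iff p ∈ f (↓X), and ↓X is definable.
  test-head : ∀ Γ H p M → Γ ⊢ M ∶ headType H → IsPrimeH H p → depth p ≤ suc m → Test Γ M p
  test-head Γ (sumH a b) tag0 M tM _ _ with t , ty , spec ← tagTest Γ a b M tM =
    t , ty , λ η v → proj₁ (spec η v)
  test-head Γ (sumH a b) tag1 M tM _ _ with t , ty , spec ← tagTest Γ a b M tM
    with t′ , ty′ , spec′ ← swap ty = t′ , ty′ , λ η v →
      proj₁ (proj₂ (spec η v)) ∘ proj₁ (proj₁ (spec′ η v)) ,
      proj₂ (proj₁ (spec′ η v)) ∘ proj₂ (proj₂ (spec η v))
  test-head Γ (sumH a b) (in0 p) M tM h bd
    with t , ty , spec ← test Γ a p (out0 a b M) (⊢out0 tM) h (s≤s⁻¹ bd) = t , ty , λ η v →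
      proj₁ (⟦out0⟧ v tM) p ∘ proj₁ (spec η v) , proj₂ (spec η v) ∘ proj₂ (⟦out0⟧ v tM) p
  test-head Γ (sumH a b) (in1 p) M tM h bd
    with t , ty , spec ← test Γ b p (out1 a b M) (⊢out1 tM) h (s≤s⁻¹ bd) = t , ty , λ η v →
      proj₁ (⟦out1⟧ v tM) p ∘ proj₁ (spec η v) , proj₂ (spec η v) ∘ proj₂ (⟦out1⟧ v tM) p
  test-head Γ (prodH a b) (pr0 p) M tM h bd
    with t , ty , spec ← test Γ a p (cfst a b · M) (tapp tfst tM) h (s≤s⁻¹ bd) = t , ty , λ η v →
      proj₁ (⟦fst⟧ v tM) p ∘ proj₁ (spec η v) , proj₂ (spec η v) ∘ proj₂ (⟦fst⟧ v tM) p
  test-head Γ (prodH a b) (pr1 p) M tM h bd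
    with t , ty , spec ← test Γ b p (csnd a b · M) (tapp tsnd tM) h (s≤s⁻¹ bd) = t , ty , λ η v →
      proj₁ (⟦snd⟧ v tM) p ∘ proj₁ (spec η v) , proj₂ (spec η v) ∘ proj₂ (⟦snd⟧ v tM) p
  test-head Γ (arrH a b) (fun X p) M tM (hX , hp) bd
    with D , tD , specD ← define-↓ Γ a X (PrimeSet⇒prime a X hX) (fun-argsDepth X p bd) (PrimeSet⇒ConAll a X hX)
    with t , ty , spec ← test Γ b p (M · D) (tapp tM tD) hp (fun-resultDepth X p bd) = t , ty , λ η v →
      (λ k → let Y , hY , h = proj₁ (spec η v) k in
         proj₁ (proj₂ (⟦⟧-elem tM v)) (fun X p) (fun Y p) (hX , hp)
           (Leq-refl b p hp , AllAny⁺ a Y X (λ {y} i → proj₂ (proj₁ (specD η v) y (All.lookup hY i)))) h) ,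
      (λ h → proj₂ (spec η v) (X , All.tabulate (λ {x} i →
         proj₂ (specD η v) x (∈⇒down a X (PrimeSet⇒prime a X hX i) i)) , h))

  test-suc : Tests (suc m)
  test-suc Γ σ p M tM = test-head Γ (head σ) p M (tconv tM (head≡⇒≈ refl))

  tagged⇒tag0 : Γ ⊢ M ∶ a ⊕ b → Valid Γ η → Tagged false x → ⟦ M ⟧ η x → ⟦ M ⟧ η tag0
  tagged⇒tag0 {a = a} {b} {x = x} tM v T = proj₁ (proj₂ (⟦⟧-elem tM v)) tag0 x tt (tag0≤ {a = a} {b} T)

  tagged⇒tag1 : Γ ⊢ M ∶ a ⊕ b → Valid Γ η → Tagged true x → ⟦ M ⟧ η x → ⟦ M ⟧ η tag1
  tagged⇒tag1 {a = a} {b} {x = x} tM v T = proj₁ (proj₂ (⟦⟧-elem tM v)) tag1 x tt (tag1≤ {a = a} {b} T)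

  separate-tags : ∀ Γ a b {p q} M → Γ ⊢ M ∶ a ⊕ b → Tagged false p → Tagged true q → Separator Γ M p q
  separate-tags Γ a b M tM T U with S , tS , spec ← tagTest Γ a b M tM = S , tS , λ η v →
    proj₂ (proj₁ (spec η v)) ∘ tagged⇒tag0 tM v T , proj₂ (proj₂ (spec η v)) ∘ tagged⇒tag1 tM v U

  separator-swap : ∀ M p q → Separator Γ M p q → Separator Γ M q p
  separator-swap M p q (S , tS , spec) with S′ , tS′ , spec′ ← swap tS = S′ , tS′ , λ η v →
    proj₂ (proj₁ (spec′ η v)) ∘ proj₂ (spec η v) , proj₂ (proj₂ (spec′ η v)) ∘ proj₁ (spec η v)

  -- Inconsistency of `(X, p)` and `(Y, q)` means that `X ++ Y` is consistent while `p` and `q` are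
  -- not. Applying `M` to the definable element `↓(X ++ Y)` therefore reduces the task to separating
  -- `p` and `q`. For sums, different tags are separated by copying the tag of `M` to `bool`.
  separate-head : ∀ Γ H p q M → Γ ⊢ M ∶ headType H → IsPrimeH H p → IsPrimeH H q →
    depth p ≤ suc m → depth q ≤ suc m → ¬ Con (headType H) p q → Separator Γ M p q
  separate-head Γ (sumH a b) tag0 tag0 M tM hp hq bp bq ¬c = ⊥-elim (¬c tt)
  separate-head Γ (sumH a b) tag0 (in0 q) M tM hp hq bp bq ¬c = ⊥-elim (¬c tt)
  separate-head Γ (sumH a b) (in0 p) tag0 M tM hp hq bp bq ¬c = ⊥-elim (¬c tt)
  separate-head Γ (sumH a b) tag1 tag1 M tM hp hq bp bq ¬c = ⊥-elim (¬c tt)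
  separate-head Γ (sumH a b) tag1 (in1 q) M tM hp hq bp bq ¬c = ⊥-elim (¬c tt)
  separate-head Γ (sumH a b) (in1 p) tag1 M tM hp hq bp bq ¬c = ⊥-elim (¬c tt)
  separate-head Γ (sumH a b) tag0 tag1 M tM hp hq bp bq ¬c = separate-tags Γ a b M tM tag0 tag1
  separate-head Γ (sumH a b) tag0 (in1 q) M tM hp hq bp bq ¬c = separate-tags Γ a b M tM tag0 in1
  separate-head Γ (sumH a b) (in0 p) tag1 M tM hp hq bp bq ¬c = separate-tags Γ a b M tM in0 tag1
  separate-head Γ (sumH a b) (in0 p) (in1 q) M tM hp hq bp bq ¬c = separate-tags Γ a b M tM in0 in1
  separate-head Γ (sumH a b) tag1 tag0 M tM hp hq bp bq ¬c =
    separator-swap M tag0 tag1 (separate-tags Γ a b M tM tag0 tag1)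
  separate-head Γ (sumH a b) tag1 (in0 q) M tM hp hq bp bq ¬c =
    separator-swap M (in0 q) tag1 (separate-tags Γ a b M tM in0 tag1)
  separate-head Γ (sumH a b) (in1 p) tag0 M tM hp hq bp bq ¬c =
    separator-swap M tag0 (in1 p) (separate-tags Γ a b M tM tag0 in1)
  separate-head Γ (sumH a b) (in1 p) (in0 q) M tM hp hq bp bq ¬c =
    separator-swap M (in0 q) (in1 p) (separate-tags Γ a b M tM in0 in1)
  separate-head Γ (sumH a b) (in0 p) (in0 q) M tM hp hq bp bq ¬c
    with S , tS , spec ← separate Γ a p q (out0 a b M) (⊢out0 tM) hp hq (s≤s⁻¹ bp) (s≤s⁻¹ bq) ¬c =
    S , tS , λ η v → let _ , from = ⟦out0⟧ v tM in
      proj₁ (spec η v) ∘ from p , proj₂ (spec η v) ∘ from q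
  separate-head Γ (sumH a b) (in1 p) (in1 q) M tM hp hq bp bq ¬c
    with S , tS , spec ← separate Γ b p q (out1 a b M) (⊢out1 tM) hp hq (s≤s⁻¹ bp) (s≤s⁻¹ bq) ¬c =
    S , tS , λ η v → let _ , from = ⟦out1⟧ v tM in
      proj₁ (spec η v) ∘ from p , proj₂ (spec η v) ∘ from q
  separate-head Γ (prodH a b) (pr0 p) (pr0 q) M tM hp hq bp bq ¬c
    with S , tS , spec ← separate Γ a p q (cfst a b · M) (tapp tfst tM) hp hq (s≤s⁻¹ bp) (s≤s⁻¹ bq) ¬c =
    S , tS , λ η v → let _ , from = ⟦fst⟧ v tM in
      proj₁ (spec η v) ∘ from p , proj₂ (spec η v) ∘ from q
  separate-head Γ (prodH a b) (pr0 p) (pr1 q) M tM hp hq bp bq ¬c = ⊥-elim (¬c tt)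
  separate-head Γ (prodH a b) (pr1 p) (pr0 q) M tM hp hq bp bq ¬c = ⊥-elim (¬c tt)
  separate-head Γ (prodH a b) (pr1 p) (pr1 q) M tM hp hq bp bq ¬c
    with S , tS , spec ← separate Γ b p q (csnd a b · M) (tapp tsnd tM) hp hq (s≤s⁻¹ bp) (s≤s⁻¹ bq) ¬c =
    S , tS , λ η v → let _ , from = ⟦snd⟧ v tM in
      proj₁ (spec η v) ∘ from p , proj₂ (spec η v) ∘ from q
  separate-head Γ (arrH a b) (fun X p) (fun Y q) M tM (hX , hp) (hY , hq) bp bq ¬c
    with ConAll⊎ a X Y
  ... | inj₂ (x , y , i , j , ¬c′) = ⊥-elim (¬c (Con-fun⁺ a b X p Y q λ _ c _ → ⊥-elim (¬c′ (c i j))))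
  ... | inj₁ c
    with D , tD , specD ← define-↓ Γ a (X ++ Y)
           (λ i → case ∈-++⁻ X i of λ
              { (inj₁ i) → PrimeSet⇒prime a X hX i ; (inj₂ i) → PrimeSet⇒prime a Y hY i })
           (λ i → case ∈-++⁻ X i of λ
              { (inj₁ i) → fun-argsDepth X p bp i ; (inj₂ i) → fun-argsDepth Y q bq i })
           (ConAll-++ a X Y (PrimeSet⇒ConAll a X hX) c (PrimeSet⇒ConAll a Y hY))
    with S , tS , spec ← separate Γ b p q (M · D) (tapp tM tD) hp hq
           (fun-resultDepth X p bp) (fun-resultDepth Y q bq)
           (λ c → ¬c (Con-fun⁺ a b X p Y q λ _ _ _ → c)) =
    S , tS , λ η v →
      (λ h → proj₁ (spec η v) (X , All.tabulate (λ {x} i → proj₂ (specD η v) x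
         (∈⇒down a (X ++ Y) (PrimeSet⇒prime a X hX i) (∈-++⁺ˡ i))) , h)) ,
      (λ h → proj₂ (spec η v) (Y , All.tabulate (λ {x} i → proj₂ (specD η v) x
         (∈⇒down a (X ++ Y) (PrimeSet⇒prime a Y hY i) (∈-++⁺ʳ X i))) , h))

  separate-suc : Separates (suc m)
  separate-suc Γ σ p q M tM hp hq bp bq ¬c =
    separate-head Γ (head σ) p q M (tconv tM σ≈) hp hq bp bq (¬c ∘ Con-≈ p q (≈-sym σ≈))
    where
    σ≈ : σ ≈ headType (head σ)
    σ≈ = head≡⇒≈ refl

-- No prime has depth 0: a list bounded by 0 is empty and defined by Ω, and nothing remains to be
-- tested or separated.
levels : ∀ m → Defines m × Tests m × Separates m
levels zero =
  (λ Γ τ L G → cΩ τ , tΩ , λ η v → (λ p ()) , λ p (_ , l , i , _) → ¬depth≤0 (proj₂ l) (bound G i)) ,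
  (λ Γ σ p M tM h bd → ⊥-elim (¬depth≤0 p bd)) ,
  (λ Γ σ p q M tM hp hq bp bq ¬c → ⊥-elim (¬depth≤0 p bp))
levels (suc m) with d , t , s ← levels m = define-suc , test-suc , separate-suc
  where open Step m d t s

finite-definable : ∀ Γ a X → (∀ {x} → x ∈ X → IsPrime a x) → ConAll a X X →
  Σ Tm λ D → Γ ⊢ D ∶ a × (∀ η → Valid Γ η → ⟦ D ⟧ η ≐ down a X)
finite-definable Γ a X hX with d , t , s ← levels (depthL X) =
  Step.define-↓ (depthL X) d t s Γ a X hX ∈⇒depth≤

prime-testable : ∀ Γ σ p M → Γ ⊢ M ∶ σ → IsPrime σ p → Test Γ M p
prime-testable Γ σ p M tM hp = proj₁ (proj₂ (levels (depth p))) Γ σ p M tM hp ≤-refl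

-- Full abstraction

-- M is typed in both contexts, so only the common entries can occur in it.
⟦⟧-agree : ∀ M → Γ ⊢ M ∶ σ → Δ ⊢ M ∶ τ → (∀ {i ρ} → Γ ∋ i ∶ ρ → Δ ∋ i ∶ ρ → η i ⊆ θ i) →
  ⟦ M ⟧ η ⊆ ⟦ M ⟧ θ
⟦⟧-agree (` i ∶ σ) t t′ h = h (var-inv t) (var-inv t′)
⟦⟧-agree (ƛ σ M) t t′ h with _ , u , _ ← lam-inv t | _ , u′ , _ ← lam-inv t′ =
  Pr-⊆ σ λ d → ⟦⟧-agree M u u′ λ { here here p → id ; (there i) (there j) → h i j }
⟦⟧-agree (M · N) t t′ h with _ , u , v ← app-inv t | _ , u′ , v′ ← app-inv t′ =
  apS-⊆ (⟦⟧-agree M u u′ h) (⟦⟧-agree N v v′ h)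
⟦⟧-agree (c0 a b) t t′ h = ⊆-refl
⟦⟧-agree (c1 a b) t t′ h = ⊆-refl
⟦⟧-agree (ccase a b c) t t′ h = ⊆-refl
⟦⟧-agree (cpcase a b c) t t′ h = ⊆-refl
⟦⟧-agree (cpair a b) t t′ h = ⊆-refl
⟦⟧-agree (cfst a b) t t′ h = ⊆-refl
⟦⟧-agree (csnd a b) t t′ h = ⊆-refl
⟦⟧-agree (cΩ a) t t′ h = ⊆-refl

envR-valid : (ε : Env Γ) → Valid Γ (envR ε)
envR-valid ((d , E) ∷ ε) here = E
envR-valid (_ ∷ ε) (there i) = envR-valid ε i

mkEnv : ∀ Γ (E : ℕ → Type → Pred) → (∀ i σ → IsElem σ (E i σ)) → Env Γ
mkEnv [] E h = []
mkEnv (σ ∷ Γ) E h = (E 0 σ , h 0 σ) ∷ mkEnv Γ (E ∘ suc) (h ∘ suc)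

envR-mkEnv : ∀ (E : ℕ → Type → Pred) h {i} → Γ ∋ i ∶ σ → envR (mkEnv Γ E h) i ≐ E i σ
envR-mkEnv E h here = ≐-refl
envR-mkEnv E h (there i) = envR-mkEnv (E ∘ suc) (h ∘ suc) i

-- The hole may be typed in a context Δ other than Γ. The two contexts agree on the variables
-- that occur in the terms, and the restriction of an environment for Δ to the entries shared
-- with Γ extends by ⊥ to one for Γ.
module _ (tM : Γ ⊢ M ∶ σ) (tN : Γ ⊢ N ∶ σ) (le : (ε : Env Γ) → ⟦ M ⟧ (envR ε) ⊆ ⟦ N ⟧ (envR ε)) where

  hole-mono : Δ ⊢ M ∶ τ → Δ ⊢ N ∶ ρ → Valid Δ η → ⟦ M ⟧ η ⊆ ⟦ N ⟧ η
  hole-mono {Δ} {η = η} tM′ tN′ v =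
    ⊆-trans (⟦⟧-agree M tM tM′ λ {i} k k′ p h → proj₂ (envR-mkEnv E elem k) p (k′ , h))
    (⊆-trans (le (mkEnv _ E elem))
    (⟦⟧-agree N tN tN′ λ {i} k k′ p h → proj₂ (proj₁ (envR-mkEnv E elem k) p h)))
    where
    E : ℕ → Type → Pred
    E i σ p = (Δ ∋ i ∶ σ) × η i p

    elem : ∀ i σ → IsElem σ (E i σ)
    elem i σ =
      (λ p (k , h) → proj₁ (v k) p h) ,
      (λ p q hp l (k , h) → k , proj₁ (proj₂ (v k)) p q hp l h) ,
      (λ p q (k , h) (_ , h′) → proj₂ (proj₂ (v k)) p q h h′)

  context-mono : ∀ C → Δ ⊢ C ⟨ M ⟩ ∶ τ → Δ ⊢ C ⟨ N ⟩ ∶ ρ → Valid Δ η → ⟦ C ⟨ M ⟩ ⟧ η ⊆ ⟦ C ⟨ N ⟩ ⟧ η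
  context-mono ∙ t t′ v = hole-mono t t′ v
  context-mono (ƛC σ C) t t′ v with _ , u , _ ← lam-inv t | _ , u′ , _ ← lam-inv t′ =
    λ { (fun X p) (ps , h) → ps , context-mono C u u′ (Valid-∷ (down-primeSet σ X ps) v) p h }
  context-mono {η = η} (C ·L K) t t′ v with _ , u , _ ← app-inv t | _ , u′ , _ ← app-inv t′ =
    apS-⊆ {e = ⟦ K ⟧ η} (context-mono C u u′ v) ⊆-refl
  context-mono {η = η} (K ·R C) t t′ v with _ , _ , u ← app-inv t | _ , _ , u′ ← app-inv t′ =
    apS-⊆ {⟦ K ⟧ η} ⊆-refl (context-mono C u u′ v)

∅ₑ : REnv
∅ₑ i p = ⊥

∅-valid : Valid [] ∅ₑ
∅-valid ()

⟦⟧⊆⇒⊑ : Γ ⊢ M ∶ σ → Γ ⊢ N ∶ σ → ((ε : Env Γ) → ⟦ M ⟧ (envR ε) ⊆ ⟦ N ⟧ (envR ε)) → M ⊑ N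
⟦⟧⊆⇒⊑ {M = M} {N = N} tM tN le C t t′ =
  (λ h → adequate0 {η = ∅ₑ} t′ (mono tag0 (⇓0-sound t ∅-valid h))) ,
  (λ h → adequate1 {η = ∅ₑ} t′ (mono tag1 (⇓1-sound t ∅-valid h)))
  where
  mono : ⟦ C ⟨ M ⟩ ⟧ ∅ₑ ⊆ ⟦ C ⟨ N ⟩ ⟧ ∅ₑ
  mono = context-mono tM tN le C t t′ ∅-valid

-- Closing contexts for finite environments

finiteEnv : Ctxt → (ℕ → List Prm) → REnv
finiteEnv [] F = ∅ₑ
finiteEnv (σ ∷ Γ) F = down σ (F 0) ∷ₑ finiteEnv Γ (F ∘ suc)

Below : Env Γ → (ℕ → List Prm) → Set
Below ε F = ∀ i → ⌊ F i ⌋ ⊆ envR ε i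

Below-primes : ∀ (ε : Env Γ) F → Below ε F → ∀ {i} → Γ ∋ i ∶ σ → ∀ {x} → x ∈ F i → IsPrime σ x
Below-primes ε F s k {x} j = proj₁ (envR-valid ε k) x (s _ x j)

Below-con : ∀ (ε : Env Γ) F → Below ε F → ∀ {i} → Γ ∋ i ∶ σ → ConAll σ (F i) (F i)
Below-con ε F s k {x} {y} j j′ = proj₂ (proj₂ (envR-valid ε k)) x y (s _ x j) (s _ y j′)

finiteEnv-valid : ∀ (ε : Env Γ) F → Below ε F → Valid Γ (finiteEnv Γ F)
finiteEnv-valid {σ ∷ Γ} ε F s here = down-elem σ (F 0) (Below-con ε F s here)
finiteEnv-valid (_ ∷ ε) F s (there k) = finiteEnv-valid ε (F ∘ suc) (s ∘ suc) k

⌊⌋⊆finiteEnv : ∀ (ε : Env Γ) F → Below ε F → ∀ {i} → Γ ∋ i ∶ σ → ⌊ F i ⌋ ⊆ finiteEnv Γ F i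
⌊⌋⊆finiteEnv {σ ∷ Γ} ε F s here x j = ∈⇒down σ (F 0) (Below-primes ε F s here j) j
⌊⌋⊆finiteEnv (_ ∷ ε) F s (there k) = ⌊⌋⊆finiteEnv ε (F ∘ suc) (s ∘ suc) k

finiteEnv⊆ : ∀ (ε : Env Γ) F → Below ε F → ∀ {i} → Γ ∋ i ∶ σ → finiteEnv Γ F i ⊆ envR ε i
finiteEnv⊆ {σ ∷ Γ} ε F s here = down⊆ σ (F 0) (envR-valid ε here) (λ {x} → s 0 x)
finiteEnv⊆ (_ ∷ ε) F s (there k) = finiteEnv⊆ ε (F ∘ suc) (s ∘ suc) k

-- The most recent variable is bound first and the abstraction is applied to a definition of its
-- finite value. That definition is typed in the remaining context, so the layers of `K` are wrapped
-- around `C` from the inside outwards.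
closing : (ε : Env Γ) (F : ℕ → List Prm) → Below ε F → Σ (Ctx → Ctx) λ K → ∀ C M {τ} →
  Γ ⊢ C ⟨ M ⟩ ∶ τ → [] ⊢ K C ⟨ M ⟩ ∶ τ × ⟦ K C ⟨ M ⟩ ⟧ ∅ₑ ≐ ⟦ C ⟨ M ⟩ ⟧ (finiteEnv Γ F)
closing [] F s = id , λ C M t → t , ≐-refl
closing {σ ∷ Γ} ε₀@(_ ∷ ε) F s
  with K , spec ← closing ε (F ∘ suc) (s ∘ suc)
     | D , tD , specD ← finite-definable Γ σ (F 0) (Below-primes ε₀ F s here) (Below-con ε₀ F s here) =
  (λ C → K (ƛC σ C ·L D)) , λ C M t →
    let tK , eq = spec (ƛC σ C ·L D) M (tapp (tlam t) tD)
        v = finiteEnv-valid ε (F ∘ suc) (s ∘ suc)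
        D→ , D← = specD _ v
    in tK , ≐-trans eq (≐-trans (apS-ƛ (C ⟨ M ⟩) _ (⟦⟧-elem tD v))
         (⟦⟧-mono-∷ (C ⟨ M ⟩) _ D→ , ⟦⟧-mono-∷ (C ⟨ M ⟩) _ D←))

⊑⇒⟦⟧⊆ : Γ ⊢ M ∶ σ → Γ ⊢ N ∶ σ → M ⊑ N → (ε : Env Γ) → ⟦ M ⟧ (envR ε) ⊆ ⟦ N ⟧ (envR ε)
⊑⇒⟦⟧⊆ {Γ} {M} {σ} {N} tM tN le ε p h
  with F , s , h′ ← ⟦⟧-support M (envR ε) p h
  with K , closed ← closing ε F s
     -- The test is made for a fresh variable of type `σ` and not for `M`, so that one context tests
     -- `M` and `N` alike.
     | t , ty , spec ← prime-testable (σ ∷ Γ) σ p (` 0 ∶ σ) (tvar here)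
         (proj₁ (⟦⟧-elem tM (envR-valid ε)) p h) =
  ⟦⟧-agree N tN tN (λ k _ → finiteEnv⊆ ε F s k) p (proj₁ (tested tN) inN)
  where
  φ = finiteEnv Γ F

  v : Valid Γ φ
  v = finiteEnv-valid ε F s

  C : Ctx
  C = ƛ σ t ·R ∙

  program : ∀ {L} → Γ ⊢ L ∶ σ → Γ ⊢ C ⟨ L ⟩ ∶ bool
  program = tapp (tlam ty)

  tested : ∀ {L} → Γ ⊢ L ∶ σ → ⟦ K C ⟨ L ⟩ ⟧ ∅ₑ tag0 ⟺ ⟦ L ⟧ φ p
  tested {L} tL =
    (λ k → proj₁ test (proj₁ apply tag0 (proj₁ eq tag0 k))) ,
    (λ k → proj₂ eq tag0 (proj₂ apply tag0 (proj₂ test k)))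
    where
    E = ⟦⟧-elem tL v
    eq = proj₂ (closed C L (program tL))
    apply = apS-ƛ t φ E
    test = spec (⟦ L ⟧ φ ∷ₑ φ) (Valid-∷ E v)

  inM : ⟦ K C ⟨ M ⟩ ⟧ ∅ₑ tag0
  inM = proj₂ (tested tM) (⟦⟧-agree M tM tM (λ k _ → ⌊⌋⊆finiteEnv ε F s k) p h′)

  pM = proj₁ (closed C M (program tM))
  pN = proj₁ (closed C N (program tN))

  inN : ⟦ K C ⟨ N ⟩ ⟧ ∅ₑ tag0
  inN = ⇓0-sound pN ∅-valid (proj₁ (le (K C) pM pN) (adequate0 pM inM))

mainTheorem17 : (Γ : Ctxt) (σ : Type) (M N : Tm) →
    Γ ⊢ M ∶ σ → Γ ⊢ N ∶ σ →
    (M ⊑ N) ⇔ (∀ (ε : Env Γ) → ⟦ M ⟧ (envR ε) ⊆ ⟦ N ⟧ (envR ε))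
mainTheorem17 Γ σ M N tM tN = mk⇔ (⊑⇒⟦⟧⊆ tM tN) (⟦⟧⊆⇒⊑ tM tN)
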